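{- Let $a_n,b_n,c_n,d_n,e_n,f_n,g_n,h_n,k_n$ denote the numbers of vertices of type $A,B,C,D,E,F,G,H,K$, respectively, on level $n$ of the hyperbolic Pascal simplex based on the hypercube mosaic $\{4,3,3,5\}$, and let $s_n$ be the number of all its vertices on level $n$, so that $s_n=a_n+b_n+c_n+d_n+e_n+f_n+g_n+h_n+k_n+4$ for $n\ge1$. (1) Each of the ten sequences $\{a_n\},\{b_n\},\{c_n\},\{d_n\},\{e_n\},\{f_n\},\{g_n\},\{h_n\},\{k_n\},\{s_n\}$ satisfies, for all $n\ge 10$, the ninth order linear homogeneous recurrence $$x_n=128x_{n-1}-1795x_{n-2}+8837x_{n-3}-19239x_{n-4}+19239x_{n-5}-8837x_{n-6}+1795x_{n-7}-128x_{n-8}+x_{n-9},$$ with the following initial values for $n=1,\dots,9$: - $a_n$: $0, 6, 12, 24, 54, 132, 336, 870, 2268$; - $b_n$: $0, 0, 6, 24, 72, 198, 528, 1392, 3654$; - $c_n$: $0, 0, 4, 12, 36, 136, 696, 4512, 33004$; - $d_n$: $0, 0, 0, 12, 96, 708, 5388, 41868, 328116$; - $e_n$: $0, 0, 0, 12, 156, 1428, 11808, 94488, 747936$; - $f_n$: $0, 0, 0, 1, 4, 16, 86, 1111, 70970$; - $g_n$: $0, 0, 0, 0, 6, 72, 1702, 137462, 15061942$; - $h_n$: $0, 0, 0, 0, 12, 774, 79254, 8862504, 998747934$; - $k_n$: $0, 0, 0, 0, 94, 12228, 1395058, 157449038, 17755598218$; - $s_n$: $4, 10, 26, 89, 534,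 15696, 1494860, 166593249, 18770594046$. (2) Each of the sequences $\{a_n\},\{b_n\},\{c_n\},\{d_n\},\{e_n\}$ also satisfies $$x_n=12x_{n-1}-37x_{n-2}+37x_{n-3}-12x_{n-4}+x_{n-5}\qquad (n\ge 6).$$ (3) Each of the sequences $\{a_n\},\{b_n\}$ satisfies $$x_n=4x_{n-1}-4x_{n-2}+x_{n-3}\qquad (n\ge 4).$$
   Context: The mosaic $\{4,3,3,5\}$ is the regular tessellation of hyperbolic 4-space by 4-dimensional hypercubes $\{4,3,3\}$ with vertex figure the 600-cell $\{3,3,5\}$ (so 600 hypercubes and 120 edges meet at each vertex). Hyperbolic Pascal simplex. Fix a vertex $V_0$ of the mosaic. The value (sign) of a vertex is the number of shortest paths along mosaic edges from $V_0$ to that vertex (the value of $V_0$ is $1$). Define a convex part $\mathcal P$ of the mosaic as follows. Take one hypercube containing $V_0$ and let $V_1$ be its vertex opposite to $V_0$ (the vertex of this hypercube with the largest value, namely $24$). Next take all new hypercubes of the mosaic containing $V_1$, and in each of them the vertex with the largest value. Then take all hypercubes containing these vertices, and in each new one the vertex with the largest value, and so on without end. $\mathcal P$ is the set of all hypercubes obtained. The vertices and edges of $\mathcal P$, with each edge directed from its endpoint nearer to $V_0$ to its endpoint farther from $V_0$, form an infinite digraph called the hyperbolic Pascal simplex. Level $n$ is the set of its vertices whose edge-distance from $V_0$ along edges of $\mathcal P$ is $n$. An incoming edge of a vertex on level $n$ is an edge from a vertex on level $n-1$. Vertex types. The boundary of $\mathcal P$ has the combinatorial shape of an infinite simplicial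 cone with apex $V_0$: four boundary rays, six 2-dimensional faces and four 3-dimensional faces. - Type $1$: vertices on the boundary rays (value $1$). They have degree $5$ in $\mathcal P$, except $V_0$, which has degree $4$. There are four of them on each level $n\ge1$. - Types $A$, $B$: vertices in the interior of a 2-dimensional face (degree $7$ in $\mathcal P$), with exactly two (type $A$) or one (type $B$) incoming edges. - Types $C$, $D$, $E$: vertices in the interior of a 3-dimensional face (degree $13$ in $\mathcal P$), with exactly three (type $C$), two (type $D$) or one (type $E$) incoming edges. - Types $F$, $G$, $H$, $K$: vertices in the interior of $\mathcal P$ (degree $120$), with exactly four (type $F$), three (type $G$), two (type $H$) or one (type $K$) incoming edges.
   Formalization: Read literally, the step-by-step construction of P leaves gaps (some neighbours of V₁ would have degree 33, not 120); the formal P also takes all hypercubes at every vertex reached by an edge leading away from V₀ from a vertex all of whose hypercubes are taken. -}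

module Defs where

open import Data.Fin.Base using (Fin)
open import Data.Fin.Patterns using (0F; 1F; 2F; 3F; 4F)
open import Data.Integer.Base as Int using (ℤ; +_)
open import Data.List.Base using (List; []; _∷_; length; foldr)
open import Data.List.Membership.Propositional using (_∈_)
open import Data.List.Relation.Unary.Unique.Propositional using (Unique)
open import Data.Nat.Base using (ℕ; suc; _≤_; _∸_)
open import Data.Product.Base using (_×_; ∃-syntax)
open import Data.Vec.Base using (Vec; []; _∷_)
open import Function.Bundles using (_⇔_)
open import Relation.Binary.Core using (Rel)
open import Relation.Binary.PropositionalEquality using (_≡_; _≢_)
open import Relation.Nullary using (¬_)
open import Level using (0ℓ)

-- The set { x | P x } is finite with exactly n elements.

HasCount : {A : Set} → (A → Set) → ℕ → Set
HasCount P n = ∃[ xs ] Unique xs × (∀ x → x ∈ xs ⇔ P x) × length xs ≡ n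

-- Walk R u v p: p lists the vertices of an R-walk from u to v, without u
-- itself, so that length p is the number of edges.

data Walk {A : Set} (R : Rel A 0ℓ) : A → A → List A → Set where
  stop : ∀ {u} → Walk R u u []
  step : ∀ {u w v p} → R u w → Walk R w v p → Walk R u v (w ∷ p)

ShortestWalk : {A : Set} → Rel A 0ℓ → A → A → List A → Set
ShortestWalk R u v p = Walk R u v p × (∀ q → Walk R u v q → length p ≤ length q)

Distance : {A : Set} → Rel A 0ℓ → A → A → ℕ → Set
Distance R u v n = ∃[ p ] ShortestWalk R u v p × length p ≡ n

-- [ a , b ] is a + bφ, where φ = (1 + √5) / 2, so φ² = φ + 1.

record ℤ[φ] : Set where
  constructor [_,_]
  field
    one-part φ-part : ℤ

infixl 6 _+φ_ _-φ_

_+φ_ _-φ_ : ℤ[φ] → ℤ[φ] → ℤ[φ]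
[ a , b ] +φ [ c , d ] = [ a Int.+ c , b Int.+ d ]
[ a , b ] -φ [ c , d ] = [ a Int.- c , b Int.- d ]

-φ_ φ·_ : ℤ[φ] → ℤ[φ]
-φ [ a , b ] = [ Int.- a , Int.- b ]
φ· [ a , b ] = [ b , a Int.+ b ]

0φ 1φ φ³ : ℤ[φ]
0φ = [ + 0 , + 0 ]
1φ = [ + 1 , + 0 ]
φ³ = [ + 1 , + 2 ]

-- The mosaic {4,3,3,5} in the projective hyperboloid model.  A vector
-- t ∷ x₁ ∷ x₂ ∷ x₃ ∷ x₄ ∷ [] lies in the Lorentzian space with quadratic form
-- x₁² + x₂² + x₃² + x₄² − φ⁻³ t²; points of hyperbolic 4-space are the rays on
-- which the form is negative and t > 0.

Point : Set
Point = Vec ℤ[φ] 5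

-- The reflections in the walls of a characteristic simplex, i.e. the Coxeter
-- generators of the symmetry group [4,3,3,5].  The wall normals are e₁,
-- e₁ − e₂, e₂ − e₃, e₃ − e₄ and n = (1 ; 0, 0, 0, 1); consecutive walls meet at
-- π/4, π/3, π/3, π/5, the others at π/2.  As n has norm 1 − φ⁻³ = 2φ⁻², the last
-- reflection subtracts φ² (x₄ − φ⁻³ t) n = (φ² x₄ − φ⁻¹ t) n.

reflect : Fin 5 → Point → Point
reflect 0F (t ∷ x₁ ∷ x₂ ∷ x₃ ∷ x₄ ∷ []) = t ∷ -φ x₁ ∷ x₂ ∷ x₃ ∷ x₄ ∷ []
reflect 1F (t ∷ x₁ ∷ x₂ ∷ x₃ ∷ x₄ ∷ []) = t ∷ x₂ ∷ x₁ ∷ x₃ ∷ x₄ ∷ []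
reflect 2F (t ∷ x₁ ∷ x₂ ∷ x₃ ∷ x₄ ∷ []) = t ∷ x₁ ∷ x₃ ∷ x₂ ∷ x₄ ∷ []
reflect 3F (t ∷ x₁ ∷ x₂ ∷ x₃ ∷ x₄ ∷ []) = t ∷ x₁ ∷ x₂ ∷ x₄ ∷ x₃ ∷ []
reflect 4F (t ∷ x₁ ∷ x₂ ∷ x₃ ∷ x₄ ∷ []) =
  t -φ k ∷ x₁ ∷ x₂ ∷ x₃ ∷ x₄ -φ k ∷ []
  where
  k = (x₄ +φ φ· x₄) -φ (φ· t -φ t)

Symmetry : Set
Symmetry = List (Fin 5)

act : Symmetry → Point → Point
act g x = foldr reflect x g

-- The centre of the j-dimensional face in a base flag of the mosaic.  The base
-- hypercube has the vertices (φ³ ; ±1, ±1, ±1, ±1); five hypercubes meet at each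
-- square because its facets make the dihedral angle 2π/5.  The centre is fixed
-- by reflect i exactly for i ≠ j, so its orbit represents all j-dimensional
-- faces of the mosaic without repetition.

baseCentre : Fin 5 → Point
baseCentre 0F = φ³ ∷ 1φ ∷ 1φ ∷ 1φ ∷ 1φ ∷ []
baseCentre 1F = φ³ ∷ 0φ ∷ 1φ ∷ 1φ ∷ 1φ ∷ []
baseCentre 2F = φ³ ∷ 0φ ∷ 0φ ∷ 1φ ∷ 1φ ∷ []
baseCentre 3F = φ³ ∷ 0φ ∷ 0φ ∷ 0φ ∷ 1φ ∷ []
baseCentre 4F = φ³ ∷ 0φ ∷ 0φ ∷ 0φ ∷ 0φ ∷ []

-- x and y are (the centres of) an i-dimensional and a j-dimensional face of the
-- mosaic belonging to a common flag: they are the images of the base faces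
-- under one and the same symmetry.

Incident : Fin 5 → Fin 5 → Rel Point 0ℓ
Incident i j x y = ∃[ g ] act g (baseCentre i) ≡ x × act g (baseCentre j) ≡ y

Adjacent : Rel Point 0ℓ
Adjacent u v = u ≢ v × ∃[ e ] Incident 0F 1F u e × Incident 0F 1F v e

data VertexType : Set where
  A B C D E F G H K : VertexType

-- The hyperbolic Pascal simplex grown from the vertex V₀ of the hypercube C₀.

module Simplex (V₀ C₀ : Point) where

  Value : Point → ℕ → Set
  Value v = HasCount (ShortestWalk Adjacent V₀ v)

  HasLargestValue : (cell v : Point) → Set
  HasLargestValue cell v =
    Incident 0F 4F v cell ×
    ∃[ k ] Value v k × (∀ u j → Incident 0F 4F u cell → Value u j → j ≤ k)

  LeadsAway : Rel Point 0ℓ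
  LeadsAway u v =
    Adjacent u v × ∃[ m ] Distance Adjacent V₀ u m × Distance Adjacent V₀ v (suc m)

  -- InP is the set of hypercubes of the simplex, and Hub the set of vertices all
  -- of whose hypercubes are taken; the first hub is the vertex V₁ of C₀ opposite
  -- to V₀.  The constructors start, largest and around are the successive steps
  -- "take all hypercubes containing the vertices with the largest value".  These
  -- steps alone leave gaps: for instance, a neighbour of V₁ with only one incoming
  -- edge would get degree 33, although it lies inside the simplex and must have
  -- degree 120.  The constructor beyond fills the gaps: past a hub there is no
  -- boundary.

  mutual

    data InP : Point → Set where
      start  : InP C₀
      around : ∀ {v cell} → Hub v → Incident 0F 4F v cell → InP cell

    data Hub : Point → Set where
      largest : ∀ {v cell} → InP cell → HasLargestValue cell v → Hub v
      beyond  : ∀ {u v} → Hub u → LeadsAway u v → Hub v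

  Vertex : Point → Set
  Vertex v = ∃[ cell ] InP cell × Incident 0F 4F v cell

  Edge : Rel Point 0ℓ
  Edge u v =
    u ≢ v ×
    ∃[ e ] Incident 0F 1F u e × Incident 0F 1F v e ×
    ∃[ cell ] InP cell × Incident 1F 4F e cell

  OnLevel : ℕ → Point → Set
  OnLevel n v = Vertex v × Distance Edge V₀ v n

  Degree : Point → ℕ → Set
  Degree v = HasCount (Edge v)

  Incoming : Rel Point 0ℓ
  Incoming v u = Edge u v × ∃[ m ] OnLevel m u × OnLevel (suc m) v

  Indegree : Point → ℕ → Set
  Indegree v = HasCount (Incoming v)

  -- v lies on a boundary ray (j = 1), on a 2-dimensional face (j = 2) or on a
  -- 3-dimensional face (j = 3) of the cone.  As in the orthant ℕ⁴ with its
  -- cubical structure, the j-dimensional faces of the cone are made up of the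
  -- j-dimensional mosaic faces that belong to exactly one hypercube of the cone.

  OnFace : Fin 5 → Point → Set
  OnFace j v =
    ∃[ x ] Incident 0F j v x × HasCount (λ cell → InP cell × Incident j 4F x cell) 1

  Inside2Face Inside3Face InsideP : Point → Set
  Inside2Face v = OnFace 2F v × ¬ OnFace 1F v
  Inside3Face v = OnFace 3F v × ¬ OnFace 2F v
  InsideP     v = Vertex v × ¬ OnFace 3F v

  HasType : VertexType → Point → Set
  HasType A v = Inside2Face v × Degree v 7   × Indegree v 2
  HasType B v = Inside2Face v × Degree v 7   × Indegree v 1
  HasType C v = Inside3Face v × Degree v 13  × Indegree v 3
  HasType D v = Inside3Face v × Degree v 13  × Indegree v 2
  HasType E v = Inside3Face v × Degree v 13  × Indegree v 1
  HasType F v = InsideP v     × Degree v 120 × Indegree v 4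
  HasType G v = InsideP v     × Degree v 120 × Indegree v 3
  HasType H v = InsideP v     × Degree v 120 × Indegree v 2
  HasType K v = InsideP v     × Degree v 120 × Indegree v 1

module _ (x : ℕ → ℕ) where

  open Int using (_+_; _-_; _*_)

  Recurrence₉ Recurrence₅ Recurrence₃ : Set

  Recurrence₉ = ∀ n → 10 ≤ n →
    + x n ≡ + 128 * + x (n ∸ 1) - + 1795 * + x (n ∸ 2) + + 8837 * + x (n ∸ 3)
          - + 19239 * + x (n ∸ 4) + + 19239 * + x (n ∸ 5) - + 8837 * + x (n ∸ 6)
          + + 1795 * + x (n ∸ 7) - + 128 * + x (n ∸ 8) + + x (n ∸ 9)

  Recurrence₅ = ∀ n → 6 ≤ n →
    + x n ≡ + 12 * + x (n ∸ 1) - + 37 * + x (n ∸ 2) + + 37 * + x (n ∸ 3)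
          - + 12 * + x (n ∸ 4) + + x (n ∸ 5)

  Recurrence₃ = ∀ n → 4 ≤ n →
    + x n ≡ + 4 * + x (n ∸ 1) - + 4 * + x (n ∸ 2) + + x (n ∸ 3)

{-# OPTIONS --safe #-}

-- The mirrors that bisect the edges of the mosaic generate a right-angled Coxeter
-- group: the 120 mirrors nearest to V₀ correspond to the vertices of the 600-cell,
-- and two of them commute exactly when they are adjacent there.  The group acts
-- simply transitively on the vertices of the mosaic, so vertices are reduced words,
-- distances are word lengths, incoming edges are descents, and faces are cosets of
-- the subgroups generated by cliques.  A numbers game on the coordinates with
-- respect to the 120 mirrors shows that reduced words act faithfully.
--
-- The four mirrors through the centre of C₀ are the directions of the cone.  A word
-- lies in the cone if each direction is a first letter of it, up to commutation, or
-- commutes with all its letters (it is then called missing); with m missing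
-- directions the vertex is in the interior of a (4 - m)-dimensional boundary face.
-- Since H₄ is transitive on the flags of the 600-cell, the number of edges from a
-- vertex to each kind of vertex on the next level depends only on m and on the
-- number of descents.  Double counting these edges gives a linear system, and each
-- recurrence holds because its polynomial annihilates the functional that picks the
-- sequence out of the system.

module Submission where

open import Defs
open import Data.Empty using (⊥; ⊥-elim)
open import Data.Fin.Base using (Fin; zero; suc; toℕ)
open import Data.Fin.Patterns using (0F; 1F; 2F; 3F; 4F; 5F; 6F; 7F; 8F; 9F)
import Data.Integer.Base as Int
import Data.Integer.Properties as ℤₚ
open import Data.List.Base using (List; []; _∷_; _++_; map; length; take; drop; filter)
open import Data.List.Membership.Propositional using (_∈_; _∉_)
open import Data.List.Membership.Propositional.Properties
  using (∈-map⁺; ∈-map⁻; ∈-filter⁺; ∈-filter⁻; ∈-++⁻; ∈-++⁺ˡ; ∈-++⁺ʳ)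
import Data.List.Properties as Listₚ
import Data.List.Relation.Binary.Permutation.Propositional.Properties as Permₚ
open import Data.List.Relation.Unary.All as All using (All; []; _∷_; all?)
import Data.List.Relation.Unary.All.Properties as Allₚ
open import Data.List.Relation.Unary.AllPairs as AllPairs using (AllPairs; []; _∷_)
import Data.List.Relation.Unary.AllPairs.Properties as AllPairsₚ
open import Data.List.Relation.Unary.Any using (here; there)
open import Data.List.Relation.Unary.Unique.Propositional using (Unique)
import Data.List.Relation.Unary.Unique.Propositional.Properties as Uniqueₚ
open import Data.Nat.Base using (ℕ; zero; suc; _≤_; _<_; z≤n; s≤s)
import Data.Nat.Properties as ℕₚ
open import Data.Product.Base using (_×_; _,_; proj₁; proj₂; ∃-syntax)
open import Data.Sum.Base using (_⊎_; inj₁; inj₂)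
open import Data.Unit.Base using (tt)
open import Data.Vec.Base using (Vec; []; _∷_)
open import Function.Base using (_∘_; case_of_)
open import Relation.Nullary using (¬_; Dec; yes; no)
open import Relation.Binary.PropositionalEquality hiding ([_])

-- The full symmetry group is the semidirect product of the right-angled group and the stabiliser H₄
-- of a vertex; this turns the orbits of the base centres into words and cliques. The numbers game
-- closes because the unit normals of two distinct mirrors at `V₀` are orthogonal or have product at
-- most -1, while the centre of a face at `V₀` has nonnegative coordinates that vanish exactly at
-- the letters of the face.
--
-- The simplex is defined through largest values, yet no value is ever computed. A vertex of a
-- hypercube that lacks some letter of the hypercube among its descents lies strictly below another
-- vertex of it, and extending shortest walks makes the value grow. So the largest value sits at the
-- vertex with all four descents, and hubs are the words in which every direction occurs as a first
-- letter. Membership of a hypercube in the simplex becomes local: the directions missing at any of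
-- its vertices must be among its letters.
--
-- The linear system is block triangular with respect to the dimension of the boundary face, since a
-- direction once passed is never missing again. Hence the shorter recurrences for the boundary
-- types.

-- Words in a right-angled Coxeter group

module RightAngled where
  open import Data.List.Relation.Unary.Any using (any?)
  open import Data.Unit.Base using (⊤)

  record Graph : Set₁ where
    infix 4 _~_
    field
      Gen : Set
      _≟_ : (s t : Gen) → Dec (s ≡ t)
      _~_ : Gen → Gen → Set
      _~?_ : (s t : Gen) → Dec (s ~ t)
      ~-sym : ∀ {s t} → s ~ t → t ~ s
      ~-irrefl : ∀ {s} → ¬ s ~ s

    ~⇒≢ : ∀ {s t} → s ~ t → s ≢ t
    ~⇒≢ p refl = ~-irrefl p

  module Words (Γ : Graph) where
    open Graph Γ

    Word : Set
    Word = List Gen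

    _∈?_ : (t : Gen) (ts : List Gen) → Dec (t ∈ ts)
    t ∈? ts = any? (t ≟_) ts

    Clique : List Gen → Set
    Clique = AllPairs _~_

    -- Words are read from right to left: the head is the last letter.  desc w is the
    -- set of letters that shorten w on the right, provided that w is reduced.

    desc : Word → List Gen
    desc []      = []
    desc (t ∷ w) = t ∷ filter (t ~?_) (desc w)

    Red : Word → Set
    Red []      = ⊤
    Red (t ∷ w) = t ∉ desc w × Red w

    infix 4 _≈_
    data _≈_ : Word → Word → Set where
      ≈-refl  : ∀ {w} → w ≈ w
      ≈-trans : ∀ {u v w} → u ≈ v → v ≈ w → u ≈ w
      prep    : ∀ t {v w} → v ≈ w → t ∷ v ≈ t ∷ w
      swap    : ∀ {s t} w → s ~ t → s ∷ t ∷ w ≈ t ∷ s ∷ w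

    ≈-sym : ∀ {v w} → v ≈ w → w ≈ v
    ≈-sym ≈-refl        = ≈-refl
    ≈-sym (≈-trans p q) = ≈-trans (≈-sym q) (≈-sym p)
    ≈-sym (prep t p)    = prep t (≈-sym p)
    ≈-sym (swap w p)    = swap w (~-sym p)

    ≈-++ʳ : ∀ {v w} u → v ≈ w → v ++ u ≈ w ++ u
    ≈-++ʳ u ≈-refl        = ≈-refl
    ≈-++ʳ u (≈-trans p q) = ≈-trans (≈-++ʳ u p) (≈-++ʳ u q)
    ≈-++ʳ u (prep t p)    = prep t (≈-++ʳ u p)
    ≈-++ʳ u (swap w p)    = swap (w ++ u) p

    ≈-length : ∀ {v w} → v ≈ w → length v ≡ length w
    ≈-length ≈-refl        = refl
    ≈-length (≈-trans p q) = trans (≈-length p) (≈-length q)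
    ≈-length (prep t p)    = cong suc (≈-length p)
    ≈-length (swap w p)    = refl

    ∈-desc⁻ : ∀ {s t} w → s ∈ desc (t ∷ w) → s ≡ t ⊎ (t ~ s × s ∈ desc w)
    ∈-desc⁻         w (here p)  = inj₁ p
    ∈-desc⁻ {t = t} w (there p) = inj₂ (let a , b = ∈-filter⁻ (t ~?_) {xs = desc w} p in b , a)

    ∈-desc⁺ : ∀ {s t} w → t ~ s → s ∈ desc w → s ∈ desc (t ∷ w)
    ∈-desc⁺ {t = t} w p q = there (∈-filter⁺ (t ~?_) q p)

    ∈-desc⇒∈ : ∀ {t} w → t ∈ desc w → t ∈ w
    ∈-desc⇒∈ (s ∷ w) p with ∈-desc⁻ w p
    ... | inj₁ refl    = here refl
    ... | inj₂ (_ , q) = there (∈-desc⇒∈ w q)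

    ≈-desc : ∀ {v w t} → v ≈ w → t ∈ desc v → t ∈ desc w
    ≈-desc ≈-refl        = λ m → m
    ≈-desc (≈-trans p q) m = ≈-desc q (≈-desc p m)
    ≈-desc (prep t {v} {w} p) m with ∈-desc⁻ v m
    ... | inj₁ refl    = here refl
    ... | inj₂ (a , b) = ∈-desc⁺ w a (≈-desc p b)
    ≈-desc (swap {s} {t} w p) m with ∈-desc⁻ (t ∷ w) m
    ... | inj₁ refl = ∈-desc⁺ (s ∷ w) (~-sym p) (here refl)
    ... | inj₂ (a , b) with ∈-desc⁻ w b
    ...   | inj₁ refl    = here refl
    ...   | inj₂ (c , d) = ∈-desc⁺ (s ∷ w) c (∈-desc⁺ w a d)

    ≈-Red : ∀ {v w} → v ≈ w → Red v → Red w
    ≈-Red ≈-refl        r = r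
    ≈-Red (≈-trans p q) r = ≈-Red q (≈-Red p r)
    ≈-Red (prep t p) (a , r) = (λ m → a (≈-desc (≈-sym p) m)) , ≈-Red p r
    ≈-Red (swap {s} {t} w p) (a , b , r) =
      (λ m → case-t (∈-desc⁻ w m)) , (λ m → a (∈-desc⁺ w (~-sym p) m)) , r
      where
      case-t : t ≡ s ⊎ (s ~ t × t ∈ desc w) → ⊥
      case-t (inj₁ refl)    = ~-irrefl p
      case-t (inj₂ (_ , m)) = b m

    -- A descent commutes with every later letter, so it can be carried to the end of the word.
    exchange : ∀ {t} w → t ∈ desc w → ∃[ v ] w ≈ t ∷ v
    exchange (s ∷ w) m with ∈-desc⁻ w m
    ... | inj₁ refl = w , ≈-refl
    ... | inj₂ (a , b) = let v , p = exchange w b in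
                         s ∷ v , ≈-trans (prep s p) (swap v a)

    desc-clique : ∀ w → Clique (desc w)
    desc-clique []      = []
    desc-clique (t ∷ w) = All.tabulate (λ m → proj₂ (∈-filter⁻ (t ~?_) {xs = desc w} m))
                     ∷ APP.filter⁺ (t ~?_) (desc-clique w)
      where import Data.List.Relation.Unary.AllPairs.Properties as APP

    clique-unique : ∀ {ts} → Clique ts → Unique ts
    clique-unique = AllPairs.map ~⇒≢

    clique-~ : ∀ {ts s t} → Clique ts → s ∈ ts → t ∈ ts → s ≢ t → s ~ t
    clique-~ (p ∷ c) (here refl) (here refl) n = ⊥-elim (n refl)
    clique-~ (p ∷ c) (here refl) (there m)   n = All.lookup p m
    clique-~ (p ∷ c) (there m)   (here refl) n = ~-sym (All.lookup p m)
    clique-~ (p ∷ c) (there l)   (there m)   n = clique-~ c l m n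

    infix 4 _≃_
    -- Equality in the group. Unlike `_≈_`, which only permutes commuting letters, it can change the
    -- length; that the two agree on reduced words is proved later by geometry (`reduced-≈`).
    data _≃_ : Word → Word → Set where
      trace   : ∀ {v w} → v ≈ w → v ≃ w
      cancel  : ∀ t w → t ∷ t ∷ w ≃ w
      ≃-sym   : ∀ {v w} → v ≃ w → w ≃ v
      ≃-trans : ∀ {u v w} → u ≃ v → v ≃ w → u ≃ w
      ≃-prep  : ∀ t {v w} → v ≃ w → t ∷ v ≃ t ∷ w

    ≃-++ˡ : ∀ u {v w} → v ≃ w → u ++ v ≃ u ++ w
    ≃-++ˡ []      p = p
    ≃-++ˡ (t ∷ u) p = ≃-prep t (≃-++ˡ u p)

    ≃-++ʳ : ∀ {v w} u → v ≃ w → v ++ u ≃ w ++ u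
    ≃-++ʳ u (trace p)     = trace (≈-++ʳ u p)
    ≃-++ʳ u (cancel t w)  = cancel t (w ++ u)
    ≃-++ʳ u (≃-sym p)     = ≃-sym (≃-++ʳ u p)
    ≃-++ʳ u (≃-trans p q) = ≃-trans (≃-++ʳ u p) (≃-++ʳ u q)
    ≃-++ʳ u (≃-prep t p)  = ≃-prep t (≃-++ʳ u p)

    -- Multiplication by a generator changes the length by exactly one: a descent is brought to the
    -- end by `exchange` and cancelled, any other letter stays.
    append : ∀ t w → Red w →
             (t ∈ desc w × ∃[ v ] w ≈ t ∷ v × Red (t ∷ v) × t ∷ w ≃ v) ⊎ Red (t ∷ w)
    append t w r with t ∈? desc w
    ... | no n  = inj₂ (n , r)
    ... | yes m = let v , p = exchange w m in
                  inj₁ (m , v , p , ≈-Red p r , ≃-trans (≃-prep t (trace p)) (cancel t v))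

    ≈-∈ : ∀ {v w s} → v ≈ w → s ∈ v → s ∈ w
    ≈-∈ ≈-refl        m = m
    ≈-∈ (≈-trans p q) m = ≈-∈ q (≈-∈ p m)
    ≈-∈ (prep t p) (here e)  = here e
    ≈-∈ (prep t p) (there m) = there (≈-∈ p m)
    ≈-∈ (swap w p) (here e)          = there (here e)
    ≈-∈ (swap w p) (there (here e))  = here e
    ≈-∈ (swap w p) (there (there m)) = there (there m)

    -- The field `letters` keeps the reduction inside the subgroup generated by the letters of the
    -- original word.
    record Reduction (w : Word) : Set where
      field
        word    : Word
        reduced : Red word
        equal   : w ≃ word
        shorter : length word ≤ length w
        letters : ∀ {s} → s ∈ word → s ∈ w

    reduce : ∀ w → Reduction w
    reduce [] = record { word = [] ; reduced = tt ; equal = trace ≈-refl ; shorter = z≤n ; letters = λ m → m }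
    reduce (t ∷ w) with reduce w
    ... | record { word = v ; reduced = r ; equal = e ; shorter = l ; letters = f } with append t v r
    ...   | inj₂ r′ = record
      { word = t ∷ v ; reduced = r′ ; equal = ≃-prep t e ; shorter = s≤s l
      ; letters = λ { (here e) → here e ; (there m) → there (f m) } }
    ...   | inj₁ (_ , u , p , (_ , r′) , q) = record
      { word = u ; reduced = r′ ; equal = ≃-trans (≃-prep t e) q
      ; shorter = ℕₚ.≤-trans (ℕₚ.n≤1+n _) (ℕₚ.≤-trans (ℕₚ.≤-reflexive (sym (≈-length p))) (ℕₚ.m≤n⇒m≤1+n l))
      ; letters = λ m → there (f (≈-∈ (≈-sym p) (there m))) }

-- Arithmetic in ℤ[φ], the Lorentzian form and its reflections

module GoldenIntegers where
  open import Algebra.Bundles using (CommutativeRing)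
  import Algebra.Solver.Ring.AlmostCommutativeRing as ACR
  import Algebra.Solver.Ring.Simple
  open import Data.Integer.Base using (+_; -[1+_])
  open import Data.Integer.Tactic.RingSolver using (solve-∀)
  import Data.Vec.Properties as Vecₚ
  open import Relation.Nullary.Decidable using (map′; _×-dec_)
  open import Level using (0ℓ)

  infixl 7 _*φ_
  _*φ_ : ℤ[φ] → ℤ[φ] → ℤ[φ]
  [ a , b ] *φ [ c , d ] = [ a Int.* c Int.+ b Int.* d , a Int.* d Int.+ b Int.* c Int.+ b Int.* d ]

  infix 4 _≟φ_ _≟ₚ_
  _≟φ_ : (x y : ℤ[φ]) → Dec (x ≡ y)
  [ a , b ] ≟φ [ c , d ] = map′ (λ { (refl , refl) → refl }) (λ { refl → refl , refl })
                                (a ℤₚ.≟ c ×-dec b ℤₚ.≟ d)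

  _≟ₚ_ : (x y : Point) → Dec (x ≡ y)
  _≟ₚ_ = Vecₚ.≡-dec _≟φ_

  private
    pair : ∀ {a b c d} → a ≡ c → b ≡ d → [ a , b ] ≡ [ c , d ]
    pair = cong₂ [_,_]

  ℤ[φ]-ring : CommutativeRing 0ℓ 0ℓ
  ℤ[φ]-ring = record
    { Carrier = ℤ[φ] ; _≈_ = _≡_ ; _+_ = _+φ_ ; _*_ = _*φ_ ; -_ = -φ_ ; 0# = 0φ ; 1# = 1φ
    ; isCommutativeRing = record
      { isRing = record
        { +-isAbelianGroup = record
          { isGroup = record
            { isMonoid = record
              { isSemigroup = record
                { isMagma = isMagma _+φ_
                ; assoc = λ { [ a , b ] [ c , d ] [ e , f ] → pair (ℤₚ.+-assoc a c e) (ℤₚ.+-assoc b d f) } }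
              ; identity = (λ { [ a , b ] → pair (ℤₚ.+-identityˡ a) (ℤₚ.+-identityˡ b) })
                         , (λ { [ a , b ] → pair (ℤₚ.+-identityʳ a) (ℤₚ.+-identityʳ b) }) }
            ; inverse = (λ { [ a , b ] → pair (ℤₚ.+-inverseˡ a) (ℤₚ.+-inverseˡ b) })
                      , (λ { [ a , b ] → pair (ℤₚ.+-inverseʳ a) (ℤₚ.+-inverseʳ b) })
            ; ⁻¹-cong = cong (-φ_) }
          ; comm = λ { [ a , b ] [ c , d ] → pair (ℤₚ.+-comm a c) (ℤₚ.+-comm b d) } }
        ; *-cong = cong₂ _*φ_
        ; *-assoc = λ { [ a , b ] [ c , d ] [ e , f ] → pair (assoc₁ a b c d e f) (assoc₂ a b c d e f) }
        ; *-identity = (λ { [ a , b ] → pair (one₁ a b) (one₂ a b) })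
                     , (λ { [ a , b ] → pair (one₃ a b) (one₄ a b) })
        ; distrib = (λ { [ a , b ] [ c , d ] [ e , f ] → pair (dist₁ a b c d e f) (dist₂ a b c d e f) })
                  , (λ { [ a , b ] [ c , d ] [ e , f ] → pair (dist₃ a b c d e f) (dist₄ a b c d e f) }) }
      ; *-comm = λ { [ a , b ] [ c , d ] → pair (comm₁ a b c d) (comm₂ a b c d) } } }
    where
    open Int using (_+_; _*_)
    assoc₁ : ∀ a b c d e f → (a * c + b * d) * e + (a * d + b * c + b * d) * f
                           ≡ a * (c * e + d * f) + b * (c * f + d * e + d * f)
    assoc₁ = solve-∀
    assoc₂ : ∀ a b c d e f →
      (a * c + b * d) * f + (a * d + b * c + b * d) * e + (a * d + b * c + b * d) * f
      ≡ a * (c * f + d * e + d * f) + b * (c * e + d * f) + b * (c * f + d * e + d * f)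
    assoc₂ = solve-∀
    one₁ : ∀ a b → + 1 * a + + 0 * b ≡ a
    one₁ = solve-∀
    one₂ : ∀ a b → + 1 * b + + 0 * a + + 0 * b ≡ b
    one₂ = solve-∀
    one₃ : ∀ a b → a * + 1 + b * + 0 ≡ a
    one₃ = solve-∀
    one₄ : ∀ a b → a * + 0 + b * + 1 + b * + 0 ≡ b
    one₄ = solve-∀
    dist₁ : ∀ a b c d e f → a * (c + e) + b * (d + f) ≡ a * c + b * d + (a * e + b * f)
    dist₁ = solve-∀
    dist₂ : ∀ a b c d e f → a * (d + f) + b * (c + e) + b * (d + f)
                          ≡ a * d + b * c + b * d + (a * f + b * e + b * f)
    dist₂ = solve-∀
    dist₃ : ∀ a b c d e f → (c + e) * a + (d + f) * b ≡ c * a + d * b + (e * a + f * b)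
    dist₃ = solve-∀
    dist₄ : ∀ a b c d e f → (c + e) * b + (d + f) * a + (d + f) * b
                          ≡ c * b + d * a + d * b + (e * b + f * a + f * b)
    dist₄ = solve-∀
    comm₁ : ∀ a b c d → a * c + b * d ≡ c * a + d * b
    comm₁ = solve-∀
    comm₂ : ∀ a b c d → a * d + b * c + b * d ≡ c * b + d * a + d * b
    comm₂ = solve-∀

  open CommutativeRing ℤ[φ]-ring public
    using () renaming (+-comm to +φ-comm; +-assoc to +φ-assoc; *-comm to *φ-comm)

  module φ-Solver = Algebra.Solver.Ring.Simple (ACR.fromCommutativeRing ℤ[φ]-ring) _≟φ_
  open φ-Solver using (solve; con; _:+_; _:*_; _:-_; :-_; _:=_)

  φ 2φ φ⁻³ : ℤ[φ]
  φ = [ + 0 , + 1 ]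
  2φ = [ + 2 , + 0 ]
  φ⁻³ = [ -[1+ 2 ] , + 2 ]

  φ·≡ : ∀ x → φ· x ≡ φ *φ x
  φ·≡ [ a , b ] = pair (l a b) (r a b)
    where
    open Int using (_+_; _*_)
    l : ∀ a b → b ≡ + 0 * a + + 1 * b
    l = solve-∀
    r : ∀ a b → a + b ≡ + 0 * b + + 1 * a + + 1 * b
    r = solve-∀

  infixl 6 _-ᵥ_
  infixr 7 _·ᵥ_

  _-ᵥ_ : Point → Point → Point
  (t ∷ a ∷ b ∷ c ∷ d ∷ []) -ᵥ (t′ ∷ a′ ∷ b′ ∷ c′ ∷ d′ ∷ []) =
    t -φ t′ ∷ a -φ a′ ∷ b -φ b′ ∷ c -φ c′ ∷ d -φ d′ ∷ []

  _·ᵥ_ : ℤ[φ] → Point → Point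
  s ·ᵥ (t ∷ a ∷ b ∷ c ∷ d ∷ []) = s *φ t ∷ s *φ a ∷ s *φ b ∷ s *φ c ∷ s *φ d ∷ []

  ⟨_,_⟩ : Point → Point → ℤ[φ]
  ⟨ t ∷ a ∷ b ∷ c ∷ d ∷ [] , t′ ∷ a′ ∷ b′ ∷ c′ ∷ d′ ∷ [] ⟩ =
    a *φ a′ +φ (b *φ b′ +φ (c *φ c′ +φ (d *φ d′ +φ -φ (φ⁻³ *φ (t *φ t′)))))

  ⟨⟩-comm : ∀ x y → ⟨ x , y ⟩ ≡ ⟨ y , x ⟩
  ⟨⟩-comm (t ∷ a ∷ b ∷ c ∷ d ∷ []) (t′ ∷ a′ ∷ b′ ∷ c′ ∷ d′ ∷ []) =
    cong₂ _+φ_ (*φ-comm a a′) (cong₂ _+φ_ (*φ-comm b b′) (cong₂ _+φ_ (*φ-comm c c′)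
      (cong₂ _+φ_ (*φ-comm d d′) (cong (λ z → -φ (φ⁻³ *φ z)) (*φ-comm t t′)))))

  ⟨⟩-linear : ∀ s x a y → ⟨ x -ᵥ s ·ᵥ a , y ⟩ ≡ ⟨ x , y ⟩ -φ s *φ ⟨ a , y ⟩
  ⟨⟩-linear s (t ∷ a ∷ b ∷ c ∷ d ∷ []) (t′ ∷ a′ ∷ b′ ∷ c′ ∷ d′ ∷ []) (u ∷ p ∷ q ∷ m ∷ n ∷ []) =
    add p a a′ (b *φ q +φ (c *φ m +φ (d *φ n +φ e t))) (b′ *φ q +φ (c′ *φ m +φ (d′ *φ n +φ e t′)))
      (add q b b′ (c *φ m +φ (d *φ n +φ e t)) (c′ *φ m +φ (d′ *φ n +φ e t′))
        (add m c c′ (d *φ n +φ e t) (d′ *φ n +φ e t′)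
          (add n d d′ (e t) (e t′) (last s t t′ u))))
    where
    last : ∀ s t t′ u → -φ (φ⁻³ *φ ((t -φ s *φ t′) *φ u))
                      ≡ -φ (φ⁻³ *φ (t *φ u)) -φ s *φ (-φ (φ⁻³ *φ (t′ *φ u)))
    last = solve 4 (λ s t t′ u → :- (con φ⁻³ :* ((t :- s :* t′) :* u))
                     := :- (con φ⁻³ :* (t :* u)) :- s :* (:- (con φ⁻³ :* (t′ :* u)))) refl
    rearrange : ∀ s p a a′ z z′ → (a -φ s *φ a′) *φ p +φ (z -φ s *φ z′)
                                ≡ (a *φ p +φ z) -φ s *φ (a′ *φ p +φ z′)
    rearrange = solve 6 (λ s p a a′ z z′ → (a :- s :* a′) :* p :+ (z :- s :* z′)
                  := (a :* p :+ z) :- s :* (a′ :* p :+ z′)) refl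
    e : ℤ[φ] → ℤ[φ]
    e t = -φ (φ⁻³ *φ (t *φ u))
    add : ∀ p a a′ z z′ {w} → w ≡ z -φ s *φ z′ →
          (a -φ s *φ a′) *φ p +φ w ≡ (a *φ p +φ z) -φ s *φ (a′ *φ p +φ z′)
    add p a a′ z z′ w = trans (cong ((a -φ s *φ a′) *φ p +φ_) w) (rearrange s p a a′ z z′)

  -- This is φ² d - φ⁻¹ t, the coefficient `k` in the last reflection, with φ as a factor in the
  -- ring so that polynomial identities apply to it.
  κ : ℤ[φ] → ℤ[φ] → ℤ[φ]
  κ t d = (d +φ φ *φ d) -φ (φ *φ t -φ t)

  reflect₄ : Point → Point
  reflect₄ (t ∷ a ∷ b ∷ c ∷ d ∷ []) = t -φ κ t d ∷ a ∷ b ∷ c ∷ d -φ κ t d ∷ []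

  reflect₄≡ : ∀ x → reflect 4F x ≡ reflect₄ x
  reflect₄≡ (t ∷ a ∷ b ∷ c ∷ d ∷ []) =
    cong₂ (λ y z → let k = (d +φ y) -φ (z -φ t) in t -φ k ∷ a ∷ b ∷ c ∷ d -φ k ∷ [])
          (φ·≡ d) (φ·≡ t)

  private
    κ′ : ∀ {n} (t d : φ-Solver.Polynomial n) → φ-Solver.Polynomial n
    κ′ t d = (d :+ con φ :* d) :- (con φ :* t :- t)

    linear-neg : ∀ s a a′ → -φ (a -φ s *φ a′) ≡ (-φ a) -φ s *φ (-φ a′)
    linear-neg = solve 3 (λ s a a′ → :- (a :- s :* a′) := (:- a) :- s :* (:- a′)) refl

    neg*neg : ∀ a a′ → (-φ a) *φ (-φ a′) ≡ a *φ a′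
    neg*neg = solve 2 (λ a a′ → (:- a) :* (:- a′) := a :* a′) refl

    neg-neg : ∀ a → -φ (-φ a) ≡ a
    neg-neg = solve 1 (λ a → :- (:- a) := a) refl

    +φ-swap : ∀ x y z → x +φ (y +φ z) ≡ y +φ (x +φ z)
    +φ-swap = solve 3 (λ x y z → x :+ (y :+ z) := y :+ (x :+ z)) refl

    linear-t : ∀ s t t′ d d′ → (t -φ s *φ t′) -φ κ (t -φ s *φ t′) (d -φ s *φ d′)
                               ≡ (t -φ κ t d) -φ s *φ (t′ -φ κ t′ d′)
    linear-t = solve 5 (λ s t t′ d d′ → (t :- s :* t′) :- κ′ (t :- s :* t′) (d :- s :* d′)
                         := (t :- κ′ t d) :- s :* (t′ :- κ′ t′ d′)) refl

    linear-d : ∀ s t t′ d d′ → (d -φ s *φ d′) -φ κ (t -φ s *φ t′) (d -φ s *φ d′)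
                               ≡ (d -φ κ t d) -φ s *φ (d′ -φ κ t′ d′)
    linear-d = solve 5 (λ s t t′ d d′ → (d :- s :* d′) :- κ′ (t :- s :* t′) (d :- s :* d′)
                         := (d :- κ′ t d) :- s :* (d′ :- κ′ t′ d′)) refl

    isometry-td : ∀ t t′ d d′ →
      (d -φ κ t d) *φ (d′ -φ κ t′ d′) +φ -φ (φ⁻³ *φ ((t -φ κ t d) *φ (t′ -φ κ t′ d′)))
      ≡ d *φ d′ +φ -φ (φ⁻³ *φ (t *φ t′))
    isometry-td = solve 4 (λ t t′ d d′ →
      (d :- κ′ t d) :* (d′ :- κ′ t′ d′) :+ :- (con φ⁻³ :* ((t :- κ′ t d) :* (t′ :- κ′ t′ d′)))
      := d :* d′ :+ :- (con φ⁻³ :* (t :* t′))) refl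

    involutive-t : ∀ t d → (t -φ κ t d) -φ κ (t -φ κ t d) (d -φ κ t d) ≡ t
    involutive-t = solve 2 (λ t d → (t :- κ′ t d) :- κ′ (t :- κ′ t d) (d :- κ′ t d) := t) refl

    involutive-d : ∀ t d → (d -φ κ t d) -φ κ (t -φ κ t d) (d -φ κ t d) ≡ d
    involutive-d = solve 2 (λ t d → (d :- κ′ t d) :- κ′ (t :- κ′ t d) (d :- κ′ t d) := d) refl

    reflect₄-linear : ∀ s x y → reflect₄ (x -ᵥ s ·ᵥ y) ≡ reflect₄ x -ᵥ s ·ᵥ reflect₄ y
    reflect₄-linear s (t ∷ a ∷ b ∷ c ∷ d ∷ []) (t′ ∷ a′ ∷ b′ ∷ c′ ∷ d′ ∷ []) =
      cong₂ (λ t d → t ∷ a -φ s *φ a′ ∷ b -φ s *φ b′ ∷ c -φ s *φ c′ ∷ d ∷ [])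
            (linear-t s t t′ d d′) (linear-d s t t′ d d′)

  reflect-linear : ∀ k s x a → reflect k (x -ᵥ s ·ᵥ a) ≡ reflect k x -ᵥ s ·ᵥ reflect k a
  reflect-linear 0F s (t ∷ a ∷ b ∷ c ∷ d ∷ []) (t′ ∷ a′ ∷ b′ ∷ c′ ∷ d′ ∷ []) =
    cong (λ z → t -φ s *φ t′ ∷ z ∷ b -φ s *φ b′ ∷ c -φ s *φ c′ ∷ d -φ s *φ d′ ∷ []) (linear-neg s a a′)
  reflect-linear 1F s (t ∷ a ∷ b ∷ c ∷ d ∷ []) (t′ ∷ a′ ∷ b′ ∷ c′ ∷ d′ ∷ []) = refl
  reflect-linear 2F s (t ∷ a ∷ b ∷ c ∷ d ∷ []) (t′ ∷ a′ ∷ b′ ∷ c′ ∷ d′ ∷ []) = refl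
  reflect-linear 3F s (t ∷ a ∷ b ∷ c ∷ d ∷ []) (t′ ∷ a′ ∷ b′ ∷ c′ ∷ d′ ∷ []) = refl
  reflect-linear 4F s x y = begin
    reflect 4F (x -ᵥ s ·ᵥ y)             ≡⟨ reflect₄≡ (x -ᵥ s ·ᵥ y) ⟩
    reflect₄ (x -ᵥ s ·ᵥ y)               ≡⟨ reflect₄-linear s x y ⟩
    reflect₄ x -ᵥ s ·ᵥ reflect₄ y        ≡⟨ cong₂ (λ u v → u -ᵥ s ·ᵥ v) (reflect₄≡ x) (reflect₄≡ y) ⟨
    reflect 4F x -ᵥ s ·ᵥ reflect 4F y    ∎
    where open ≡-Reasoning

  reflect-isometry : ∀ k x y → ⟨ reflect k x , reflect k y ⟩ ≡ ⟨ x , y ⟩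
  reflect-isometry 0F (t ∷ a ∷ b ∷ c ∷ d ∷ []) (t′ ∷ a′ ∷ b′ ∷ c′ ∷ d′ ∷ []) =
    cong (_+φ _) (neg*neg a a′)
  reflect-isometry 1F (t ∷ a ∷ b ∷ c ∷ d ∷ []) (t′ ∷ a′ ∷ b′ ∷ c′ ∷ d′ ∷ []) =
    +φ-swap (b *φ b′) (a *φ a′) (c *φ c′ +φ (d *φ d′ +φ -φ (φ⁻³ *φ (t *φ t′))))
  reflect-isometry 2F (t ∷ a ∷ b ∷ c ∷ d ∷ []) (t′ ∷ a′ ∷ b′ ∷ c′ ∷ d′ ∷ []) =
    cong (a *φ a′ +φ_) (+φ-swap (c *φ c′) (b *φ b′) (d *φ d′ +φ -φ (φ⁻³ *φ (t *φ t′))))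
  reflect-isometry 3F (t ∷ a ∷ b ∷ c ∷ d ∷ []) (t′ ∷ a′ ∷ b′ ∷ c′ ∷ d′ ∷ []) =
    cong (λ z → a *φ a′ +φ (b *φ b′ +φ z))
      (+φ-swap (d *φ d′) (c *φ c′) (-φ (φ⁻³ *φ (t *φ t′))))
  reflect-isometry 4F x@(t ∷ a ∷ b ∷ c ∷ d ∷ []) y@(t′ ∷ a′ ∷ b′ ∷ c′ ∷ d′ ∷ []) =
    trans (cong₂ ⟨_,_⟩ (reflect₄≡ x) (reflect₄≡ y))
      (cong (λ z → a *φ a′ +φ (b *φ b′ +φ (c *φ c′ +φ z))) (isometry-td t t′ d d′))

  reflect-involutive : ∀ k x → reflect k (reflect k x) ≡ x
  reflect-involutive 0F (t ∷ a ∷ b ∷ c ∷ d ∷ []) =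
    cong (λ z → t ∷ z ∷ b ∷ c ∷ d ∷ []) (neg-neg a)
  reflect-involutive 1F (t ∷ a ∷ b ∷ c ∷ d ∷ []) = refl
  reflect-involutive 2F (t ∷ a ∷ b ∷ c ∷ d ∷ []) = refl
  reflect-involutive 3F (t ∷ a ∷ b ∷ c ∷ d ∷ []) = refl
  reflect-involutive 4F x@(t ∷ a ∷ b ∷ c ∷ d ∷ []) =
    trans (cong (reflect 4F) (reflect₄≡ x)) (trans (reflect₄≡ (reflect₄ x))
      (cong₂ (λ t d → t ∷ a ∷ b ∷ c ∷ d ∷ []) (involutive-t t d) (involutive-d t d)))

  -- This is a reflection only if ⟨ a , a ⟩ = 1.

  mirror : Point → Point → Point
  mirror a x = x -ᵥ (2φ *φ ⟨ x , a ⟩) ·ᵥ a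

  ⟨mirror⟩ : ∀ a x y → ⟨ mirror a x , y ⟩ ≡ ⟨ x , y ⟩ -φ 2φ *φ ⟨ x , a ⟩ *φ ⟨ a , y ⟩
  ⟨mirror⟩ a x y = ⟨⟩-linear (2φ *φ ⟨ x , a ⟩) x a y

  -- Isometries conjugate mirrors into mirrors; this is how the stabiliser of a vertex acts on
  -- words.
  reflect-mirror : ∀ k a x → reflect k (mirror a x) ≡ mirror (reflect k a) (reflect k x)
  reflect-mirror k a x = trans (reflect-linear k (2φ *φ ⟨ x , a ⟩) x a)
    (cong (λ z → reflect k x -ᵥ (2φ *φ z) ·ᵥ reflect k a) (sym (reflect-isometry k x a)))

-- The 120 mirror normals as an orbit of H₄

module RootOrbit where
  open GoldenIntegers
  open import Data.Integer.Base using (+_)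
  open import Data.List.Base using (foldr)
  open import Data.List.Properties using (foldr-++)
  open import Data.List.Relation.Unary.Any using (any?)
  open import Data.List.Relation.Unary.AllPairs using (allPairs?)
  open import Relation.Nullary.Decidable using (toWitness; _→-dec_; _×-dec_; _⊎-dec_; ¬?)

  -- Words in the last four Coxeter generators, which fix the base vertex: the group H₄ of its
  -- vertex figure, the 600-cell.
  Stab : Set
  Stab = List (Fin 4)

  actH : Stab → Point → Point
  actH h x = foldr (λ k → reflect (suc k)) x h

  actH-++ : ∀ g h x → actH (g ++ h) x ≡ actH g (actH h x)
  actH-++ g h x = foldr-++ _ x g h

  invH : Stab → Stab
  invH []      = []
  invH (k ∷ h) = invH h ++ k ∷ []

  actH-invˡ : ∀ h x → actH (invH h) (actH h x) ≡ x
  actH-invˡ []      x = refl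
  actH-invˡ (k ∷ h) x = trans (actH-++ (invH h) (k ∷ []) _)
    (trans (cong (actH (invH h)) (reflect-involutive (suc k) (actH h x))) (actH-invˡ h x))

  actH-invʳ : ∀ h x → actH h (actH (invH h) x) ≡ x
  actH-invʳ []      x = refl
  actH-invʳ (k ∷ h) x = trans (cong (λ y → reflect (suc k) (actH h y)) (actH-++ (invH h) (k ∷ []) x))
    (trans (cong (reflect (suc k)) (actH-invʳ h _)) (reflect-involutive (suc k) x))

  actH-isometry : ∀ h x y → ⟨ actH h x , actH h y ⟩ ≡ ⟨ x , y ⟩
  actH-isometry []      x y = refl
  actH-isometry (k ∷ h) x y = trans (reflect-isometry (suc k) (actH h x) (actH h y)) (actH-isometry h x y)

  actH-mirror : ∀ h a x → actH h (mirror a x) ≡ mirror (actH h a) (actH h x)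
  actH-mirror []      a x = refl
  actH-mirror (k ∷ h) a x =
    trans (cong (reflect (suc k)) (actH-mirror h a x)) (reflect-mirror (suc k) (actH h a) (actH h x))

  -- A spanning tree of an orbit: k ▹ T continues with T from the image of the
  -- current point under the k-th generator.

  data Tree (X : Set) : Set where
    leaf : Tree X
    _▹_  : X → Tree X → Tree X
    fork : Tree X → Tree X → Tree X
  infixr 5 _▹_

  module _ {X : Set} (f : X → Fin 4) where

    below : Point → Tree X → List Point
    below x leaf       = []
    below x (k ▹ T)    = reflect (suc (f k)) x ∷ below (reflect (suc (f k)) x) T
    below x (fork S T) = below x S ++ below x T

    orbit : Point → Tree X → List Point
    orbit x T = x ∷ below x T

    orbit-reach : ∀ {y} x T → y ∈ orbit x T → ∃[ h ] actH (map f h) x ≡ y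
    below-reach : ∀ {y} x T → y ∈ below x T → ∃[ h ] actH (map f h) x ≡ y

    orbit-reach x T (here refl) = [] , refl
    orbit-reach x T (there m)   = below-reach x T m

    below-reach x (k ▹ T) m = let h , p = orbit-reach _ T m in
      h ++ k ∷ [] , trans (lemma h) p
      where
      lemma : ∀ h → actH (map f (h ++ k ∷ [])) x ≡ actH (map f h) (reflect (suc (f k)) x)
      lemma []      = refl
      lemma (l ∷ h) = cong (reflect (suc (f l))) (lemma h)
    below-reach x (fork S T) m with ∈-++⁻ (below x S) m
    ... | inj₁ n = below-reach x S n
    ... | inj₂ n = below-reach x T n

    actH-fix : ∀ {x} → (∀ k → reflect (suc (f k)) x ≡ x) → ∀ h → actH (map f h) x ≡ x
    actH-fix p []      = refl
    actH-fix p (k ∷ h) = trans (cong (reflect (suc (f k))) (actH-fix p h)) (p k)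

  e₁ e₂ e₃ e₄ : Point
  e₁ = 0φ ∷ 1φ ∷ 0φ ∷ 0φ ∷ 0φ ∷ []
  e₂ = 0φ ∷ 0φ ∷ 1φ ∷ 0φ ∷ 0φ ∷ []
  e₃ = 0φ ∷ 0φ ∷ 0φ ∷ 1φ ∷ 0φ ∷ []
  e₄ = 0φ ∷ 0φ ∷ 0φ ∷ 0φ ∷ 1φ ∷ []

  -- The four trees reach 120, 12, 5 and 2 roots: the vertices of the 600-cell, of its icosahedral
  -- vertex figure, of the pentagon around an edge, and the two tips over a triangle. The product
  -- 14400 is the number of flags and the order of H₄.
  tree₁ : Tree (Fin 4)
  tree₁ =
    0F ▹ 1F ▹ 2F ▹ 3F ▹ 2F ▹ fork (1F ▹ fork (0F ▹ 3F ▹ 2F ▹ fork (1F ▹ 3F ▹ 2F ▹ fork (1F ▹ fork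
    (0F ▹ 3F ▹ 2F ▹ fork (1F ▹ fork (0F ▹ 3F ▹ 2F ▹ fork (1F ▹ 3F ▹ 2F ▹ fork (1F ▹ fork (0F ▹ 3F
    ▹ 2F ▹ fork (1F ▹ fork (0F ▹ 3F ▹ 2F ▹ fork (1F ▹ 3F ▹ 2F ▹ fork (1F ▹ fork (0F ▹ 3F ▹ 2F ▹
    fork (1F ▹ 3F ▹ 2F ▹ 3F ▹ 2F ▹ 1F ▹ 0F ▹ leaf) (3F ▹ leaf)) (3F ▹ 2F ▹ 3F ▹ leaf)) (3F ▹
    leaf)) (3F ▹ 2F ▹ 1F ▹ 0F ▹ leaf)) (3F ▹ 2F ▹ 3F ▹ 2F ▹ 1F ▹ 0F ▹ leaf)) (3F ▹ leaf)) (3F ▹ 2F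
    ▹ fork (1F ▹ fork (0F ▹ 3F ▹ 2F ▹ 1F ▹ leaf) (3F ▹ 2F ▹ leaf)) (3F ▹ leaf))) (3F ▹ 2F ▹ 1F ▹
    0F ▹ leaf)) (3F ▹ 2F ▹ 1F ▹ 0F ▹ leaf)) (3F ▹ 2F ▹ 3F ▹ 2F ▹ 1F ▹ 0F ▹ leaf)) (3F ▹ leaf)) (3F
    ▹ 2F ▹ fork (1F ▹ fork (0F ▹ 3F ▹ 2F ▹ fork (1F ▹ 3F ▹ 2F ▹ 3F ▹ 2F ▹ 1F ▹ 0F ▹ leaf) (3F ▹
    leaf)) (3F ▹ 2F ▹ 3F ▹ leaf)) (3F ▹ leaf))) (3F ▹ 2F ▹ 1F ▹ 0F ▹ leaf)) (3F ▹ 2F ▹ 1F ▹ 0F ▹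
    leaf)) (3F ▹ 2F ▹ 3F ▹ 2F ▹ 1F ▹ 0F ▹ leaf)) (3F ▹ leaf)

  tree₂ : Tree (Fin 3)
  tree₂ =
    0F ▹ 1F ▹ 2F ▹ 1F ▹ fork (0F ▹ 2F ▹ 1F ▹ 2F ▹ 1F ▹ 0F ▹ leaf) (2F ▹ leaf)

  tree₃ : Tree (Fin 2)
  tree₃ =
    0F ▹ 1F ▹ 0F ▹ 1F ▹ leaf

  tree₄ : Tree (Fin 1)
  tree₄ =
    0F ▹ leaf

  suc² : Fin 2 → Fin 4
  suc² k = suc (suc k)

  suc³ : Fin 1 → Fin 4
  suc³ k = suc (suc (suc k))

  Cone : ℤ[φ] → Set
  Cone [ a , b ] = + 0 Int.≤ a × + 0 Int.≤ b

  -- This means x ≤ -1.  The factor φ is needed for x = -φ, since φ - 1 does not lie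
  -- in ℕ + ℕφ.

  Far : ℤ[φ] → Set
  Far x = Cone (φ· (-φ x -φ 1φ))

  Cone? : ∀ x → Dec (Cone x)
  Cone? [ a , b ] = (+ 0 ℤₚ.≤? a) ×-dec (+ 0 ℤₚ.≤? b)

  Far? : ∀ x → Dec (Far x)
  Far? x = Cone? (φ· (-φ x -φ 1φ))

  opaque

    roots : List Point
    roots = orbit (λ k → k) e₁ tree₁

    roots-reach : ∀ {α} → α ∈ roots → ∃[ h ] actH h e₁ ≡ α
    roots-reach m = let h , p = orbit-reach (λ k → k) e₁ tree₁ m in
      map (λ k → k) h , p

    e₁∈roots : e₁ ∈ roots
    e₁∈roots = here refl

    roots-unique : Unique roots
    roots-unique = toWitness {a? = allPairs? (λ x y → ¬? (x ≟ₚ y)) roots} tt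

    roots-closed : ∀ k {α} → α ∈ roots → reflect (suc k) α ∈ roots
    roots-closed k m = All.lookup (lemma k) m
      where
      lemma : ∀ k → All (λ α → reflect (suc k) α ∈ roots) roots
      lemma 0F = toWitness {a? = all? (λ α → any? (reflect 1F α ≟ₚ_) roots) roots} tt
      lemma 1F = toWitness {a? = all? (λ α → any? (reflect 2F α ≟ₚ_) roots) roots} tt
      lemma 2F = toWitness {a? = all? (λ α → any? (reflect 3F α ≟ₚ_) roots) roots} tt
      lemma 3F = toWitness {a? = all? (λ α → any? (reflect 4F α ≟ₚ_) roots) roots} tt

    -- This makes the group right-angled: mirrors with orthogonal normals commute, and mirrors whose
    -- normals have product at most -1 do not meet in hyperbolic space.
    trichotomy₁ : ∀ {β} → β ∈ roots → β ≡ e₁ ⊎ ⟨ e₁ , β ⟩ ≡ 0φ ⊎ Far ⟨ e₁ , β ⟩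
    trichotomy₁ = All.lookup (toWitness
      {a? = all? (λ β → β ≟ₚ e₁ ⊎-dec ⟨ e₁ , β ⟩ ≟φ 0φ ⊎-dec Far? ⟨ e₁ , β ⟩) roots} tt)

    -- The neighbours of `e₁` in the 600-cell form one orbit under the generators that fix `e₁`.
    -- Together with the next two lemmas, this gives flag transitivity one vertex at a time.
    link₁ : ∀ {β} → β ∈ roots → ⟨ e₁ , β ⟩ ≡ 0φ → β ∈ orbit suc e₂ tree₂
    link₁ = All.lookup (toWitness
      {a? = all? (λ β → ⟨ e₁ , β ⟩ ≟φ 0φ →-dec any? (β ≟ₚ_) (orbit suc e₂ tree₂)) roots} tt)

    link₂ : ∀ {β} → β ∈ roots → ⟨ e₁ , β ⟩ ≡ 0φ → ⟨ e₂ , β ⟩ ≡ 0φ → β ∈ orbit suc² e₃ tree₃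
    link₂ = All.lookup (toWitness
      {a? = all? (λ β → ⟨ e₁ , β ⟩ ≟φ 0φ →-dec ⟨ e₂ , β ⟩ ≟φ 0φ →-dec
                        any? (β ≟ₚ_) (orbit suc² e₃ tree₃)) roots} tt)

    link₃ : ∀ {β} → β ∈ roots → ⟨ e₁ , β ⟩ ≡ 0φ → ⟨ e₂ , β ⟩ ≡ 0φ → ⟨ e₃ , β ⟩ ≡ 0φ →
            β ∈ orbit suc³ e₄ tree₄
    link₃ = All.lookup (toWitness
      {a? = all? (λ β → ⟨ e₁ , β ⟩ ≟φ 0φ →-dec ⟨ e₂ , β ⟩ ≟φ 0φ →-dec ⟨ e₃ , β ⟩ ≟φ 0φ →-dec
                        any? (β ≟ₚ_) (orbit suc³ e₄ tree₄)) roots} tt)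

-- Nonnegative elements of ℤ[φ]

module Positivity where
  open GoldenIntegers
  open RootOrbit using (Cone; Far)
  open import Data.Integer.Base using (+_; -[1+_])
  open import Data.Integer.Tactic.RingSolver using (solve-∀)
  import Data.Nat.Base as ℕ

  φ^ : ℕ → ℤ[φ] → ℤ[φ]
  φ^ zero    x = x
  φ^ (suc n) x = φ· φ^ n x

  -- The real number x is nonnegative if and only if φⁿ x lies in ℕ + ℕφ for some
  -- n, because multiplication by φ⁻¹ contracts the conjugate.

  Nonneg : ℤ[φ] → Set
  Nonneg x = ∃[ n ] Cone (φ^ n x)

  φ·-+ : ∀ x y → φ· (x +φ y) ≡ φ· x +φ φ· y
  φ·-+ [ a , b ] [ c , d ] = cong [ b Int.+ d ,_] (lemma a b c d)
    where
    open Int using (_+_)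
    lemma : ∀ a b c d → a + c + (b + d) ≡ a + b + (c + d)
    lemma = solve-∀

  φ·-neg : ∀ x → φ· (-φ x) ≡ -φ (φ· x)
  φ·-neg [ a , b ] = cong [ Int.- b ,_] (sym (ℤₚ.neg-distrib-+ a b))

  φ·-* : ∀ x y → φ· (x *φ y) ≡ (φ· x) *φ y
  φ·-* [ a , b ] [ c , d ] = cong₂ [_,_] (l a b c d) (r a b c d)
    where
    open Int using (_+_; _*_)
    l : ∀ a b c d → a * d + b * c + b * d ≡ b * c + (a + b) * d
    l = solve-∀
    r : ∀ a b c d → a * c + b * d + (a * d + b * c + b * d) ≡ b * d + (a + b) * c + (a + b) * d
    r = solve-∀

  φ·-cancel : ∀ x → φ· x ≡ 0φ → x ≡ 0φ
  φ·-cancel [ a , b ] p = cong₂ [_,_] a≡0 (cong ℤ[φ].one-part p)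
    where
    a≡0 : a ≡ + 0
    a≡0 = trans (sym (ℤₚ.+-identityʳ a))
      (trans (cong (λ z → a Int.+ z) (sym (cong ℤ[φ].one-part p))) (cong ℤ[φ].φ-part p))

  φ^-+ : ∀ n x y → φ^ n (x +φ y) ≡ φ^ n x +φ φ^ n y
  φ^-+ zero    x y = refl
  φ^-+ (suc n) x y = trans (cong φ·_ (φ^-+ n x y)) (φ·-+ (φ^ n x) (φ^ n y))

  φ^-neg : ∀ n x → φ^ n (-φ x) ≡ -φ (φ^ n x)
  φ^-neg zero    x = refl
  φ^-neg (suc n) x = trans (cong φ·_ (φ^-neg n x)) (φ·-neg (φ^ n x))

  φ^-*ˡ : ∀ n x y → φ^ n (x *φ y) ≡ φ^ n x *φ y
  φ^-*ˡ zero    x y = refl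
  φ^-*ˡ (suc n) x y = trans (cong φ·_ (φ^-*ˡ n x y)) (φ·-* (φ^ n x) y)

  φ^-*ʳ : ∀ n x y → φ^ n (x *φ y) ≡ x *φ φ^ n y
  φ^-*ʳ n x y = trans (cong (φ^ n) (*φ-comm x y)) (trans (φ^-*ˡ n y x) (*φ-comm (φ^ n y) x))

  φ^-cancel : ∀ n x → φ^ n x ≡ 0φ → x ≡ 0φ
  φ^-cancel zero    x p = p
  φ^-cancel (suc n) x p = φ^-cancel n x (φ·-cancel (φ^ n x) p)

  φ^-add : ∀ m n x → φ^ (m ℕ.+ n) x ≡ φ^ m (φ^ n x)
  φ^-add zero    n x = refl
  φ^-add (suc m) n x = cong φ·_ (φ^-add m n x)

  cone-φ· : ∀ x → Cone x → Cone (φ· x)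
  cone-φ· [ a , b ] (p , q) = q , ℤₚ.+-mono-≤ p q

  cone-φ^ : ∀ n x → Cone x → Cone (φ^ n x)
  cone-φ^ zero    x p = p
  cone-φ^ (suc n) x p = cone-φ· (φ^ n x) (cone-φ^ n x p)

  cone-+ : ∀ x y → Cone x → Cone y → Cone (x +φ y)
  cone-+ [ a , b ] [ c , d ] (p , q) (r , s) = ℤₚ.+-mono-≤ p r , ℤₚ.+-mono-≤ q s

  cone-* : ∀ x y → Cone x → Cone y → Cone (x *φ y)
  cone-* [ + a , + b ] [ + c , + d ] (p , q) (r , s) =
    +-≥0 (*-≥0 a c) (*-≥0 b d) , +-≥0 (+-≥0 (*-≥0 a d) (*-≥0 b c)) (*-≥0 b d)
    where
    *-≥0 : ∀ a b → + 0 Int.≤ + a Int.* + b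
    *-≥0 a b = subst (+ 0 Int.≤_) (ℤₚ.pos-* a b) (Int.+≤+ ℕ.z≤n)
    +-≥0 : ∀ {a b} → + 0 Int.≤ a → + 0 Int.≤ b → + 0 Int.≤ a Int.+ b
    +-≥0 = ℤₚ.+-mono-≤
  cone-* [ -[1+ a ] , b ] y (() , _)
  cone-* [ + a , -[1+ b ] ] y (_ , ())
  cone-* [ + a , + b ] [ -[1+ c ] , d ] _ (() , _)
  cone-* [ + a , + b ] [ + c , -[1+ d ] ] _ (_ , ())

  cone-antisym : ∀ x → Cone x → Cone (-φ x) → x ≡ 0φ
  cone-antisym [ a , b ] (p , q) (r , s) = cong₂ [_,_] (zero-of p r) (zero-of q s)
    where
    zero-of : ∀ {a} → + 0 Int.≤ a → + 0 Int.≤ Int.- a → a ≡ + 0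
    zero-of {a} p q = ℤₚ.≤-antisym
      (subst (Int._≤ + 0) (ℤₚ.neg-involutive a) (ℤₚ.neg-mono-≤ q)) p

  nonneg-0 : Nonneg 0φ
  nonneg-0 = 0 , Int.+≤+ ℕ.z≤n , Int.+≤+ ℕ.z≤n

  nonneg-1 : Nonneg 1φ
  nonneg-1 = 0 , Int.+≤+ ℕ.z≤n , Int.+≤+ ℕ.z≤n

  nonneg-2 : Nonneg 2φ
  nonneg-2 = 0 , Int.+≤+ ℕ.z≤n , Int.+≤+ ℕ.z≤n

  -- The cone is stable under multiplication by φ, so both exponents can be raised to the common
  -- value `m + n`.
  nonneg-+ : ∀ {x y} → Nonneg x → Nonneg y → Nonneg (x +φ y)
  nonneg-+ {x} {y} (m , p) (n , q) = m ℕ.+ n , subst Cone (sym (φ^-+ (m ℕ.+ n) x y))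
    (cone-+ _ _ (subst Cone (sym (trans (cong (λ k → φ^ k x) (ℕₚ.+-comm m n)) (φ^-add n m x))) (cone-φ^ n _ p))
                (subst Cone (sym (φ^-add m n y)) (cone-φ^ m _ q)))

  nonneg-* : ∀ {x y} → Nonneg x → Nonneg y → Nonneg (x *φ y)
  nonneg-* {x} {y} (m , p) (n , q) = m ℕ.+ n , subst Cone
    (sym (trans (φ^-add m n (x *φ y)) (trans (cong (φ^ m) (φ^-*ʳ n x y)) (φ^-*ˡ m x (φ^ n y)))))
    (cone-* _ _ p q)

  -- At the common exponent `m + n` both signs of the element lie in the cone, and multiplication by
  -- φ is injective.
  nonneg-antisym : ∀ {x} → Nonneg x → Nonneg (-φ x) → x ≡ 0φ
  nonneg-antisym {x} (m , p) (n , q) = φ^-cancel (m ℕ.+ n) x (cone-antisym _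
    (subst Cone (sym (trans (cong (λ k → φ^ k x) (ℕₚ.+-comm m n)) (φ^-add n m x))) (cone-φ^ n _ p))
    (subst Cone (trans (sym (φ^-add m n (-φ x))) (φ^-neg (m ℕ.+ n) x)) (cone-φ^ m _ q)))

  far⇒ : ∀ {x} → Far x → Nonneg (-φ x -φ 1φ)
  far⇒ p = 1 , p

-- The mirrors around a vertex and the centres of the faces at it

module Mirrors where
  open GoldenIntegers
  open Positivity
  open RootOrbit
  open RightAngled
  import Data.Fin.Properties as Finₚ
  open import Data.List.Base using (lookup)
  open import Data.List.Membership.Propositional.Properties using (∈-lookup)
  open import Data.List.Properties using (foldr-++)
  open import Data.List.Relation.Unary.Any using (index)
  open import Data.List.Relation.Unary.Any.Properties using (lookup-index)
  open φ-Solver using (solve; con; _:+_; _:*_; _:-_; :-_; _:=_)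

  lookup-injective : ∀ {X : Set} {xs : List X} → Unique xs → ∀ i j → lookup xs i ≡ lookup xs j → i ≡ j
  lookup-injective (n ∷ u) zero    zero    p = refl
  lookup-injective (n ∷ u) zero    (suc j) p = ⊥-elim (All.lookup n (∈-lookup j) p)
  lookup-injective (n ∷ u) (suc i) zero    p = ⊥-elim (All.lookup n (∈-lookup i) (sym p))
  lookup-injective (n ∷ u) (suc i) (suc j) p = cong suc (lookup-injective u i j p)

  α : Fin (length roots) → Point
  α = lookup roots

  α∈roots : ∀ i → α i ∈ roots
  α∈roots i = ∈-lookup i

  α-injective : ∀ {i j} → α i ≡ α j → i ≡ j
  α-injective p = lookup-injective roots-unique _ _ p

  root-index : ∀ {β} → β ∈ roots → ∃[ i ] α i ≡ β
  root-index m = index m , sym (lookup-index m)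

  actH-closed : ∀ h {β} → β ∈ roots → actH h β ∈ roots
  actH-closed []      m = m
  actH-closed (k ∷ h) m = roots-closed k (actH-closed h m)

  p₀ : Point
  p₀ = baseCentre 0F

  actH-p₀ : ∀ h → actH h p₀ ≡ p₀
  actH-p₀ []      = refl
  actH-p₀ (k ∷ h) = trans (cong (reflect (suc k)) (actH-p₀ h)) (lemma k)
    where
    lemma : ∀ k → reflect (suc k) p₀ ≡ p₀
    lemma 0F = refl
    lemma 1F = refl
    lemma 2F = refl
    lemma 3F = refl

  to-e₁ : ∀ i → ∃[ h ] (∀ y → ⟨ α i , y ⟩ ≡ ⟨ e₁ , actH h y ⟩) × (∀ {y} → actH h y ≡ e₁ → α i ≡ y)
                      × actH h p₀ ≡ p₀ × actH h (α i) ≡ e₁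
  to-e₁ i = let h , p = roots-reach (α∈roots i) ; g = invH h
                q = trans (cong (actH g) (sym p)) (actH-invˡ h e₁) in
    g , (λ y → trans (sym (actH-isometry g (α i) y)) (cong ⟨_, actH g y ⟩ q))
      , (λ {y} r → trans (sym p) (trans (cong (actH h) (sym r)) (actH-invʳ h y)))
      , actH-p₀ g , q

  α-norm : ∀ i → ⟨ α i , α i ⟩ ≡ 1φ
  α-norm i = let g , p , _ , _ , q = to-e₁ i in trans (p (α i)) (cong ⟨ e₁ ,_⟩ q)

  p₀-α : ∀ i → ⟨ p₀ , α i ⟩ ≡ 1φ
  p₀-α i = let g , p , _ , q , _ = to-e₁ i in
    trans (⟨⟩-comm p₀ (α i)) (trans (p p₀) (cong ⟨ e₁ ,_⟩ q))

  trichotomy : ∀ i j → i ≡ j ⊎ ⟨ α i , α j ⟩ ≡ 0φ ⊎ Far ⟨ α i , α j ⟩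
  trichotomy i j with to-e₁ i
  ... | g , p , q , _ with trichotomy₁ (actH-closed g (α∈roots j))
  ...   | inj₁ r        = inj₁ (α-injective (q r))
  ...   | inj₂ (inj₁ r) = inj₂ (inj₁ (trans (p (α j)) r))
  ...   | inj₂ (inj₂ r) = inj₂ (inj₂ (subst Far (sym (p (α j))) r))

  Γ : Graph
  Γ = record
    { Gen      = Fin (length roots)
    ; _≟_      = Finₚ._≟_
    ; _~_      = λ i j → ⟨ α i , α j ⟩ ≡ 0φ
    ; _~?_     = λ i j → ⟨ α i , α j ⟩ ≟φ 0φ
    ; ~-sym    = λ {i} {j} p → trans (⟨⟩-comm (α j) (α i)) p
    ; ~-irrefl = λ {i} p → case trans (sym (α-norm i)) p of λ ()
    }

  open Graph Γ public
  open Words Γ public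

  act-mirror : ∀ g a x → act g (mirror a x) ≡ mirror (act g a) (act g x)
  act-mirror []      a x = refl
  act-mirror (k ∷ g) a x =
    trans (cong (reflect k) (act-mirror g a x)) (reflect-mirror k (act g a) (act g x))

  act-++ : ∀ g h x → act (g ++ h) x ≡ act g (act h x)
  act-++ g h x = foldr-++ reflect x g h

  actH≡act : ∀ h x → actH h x ≡ act (map suc h) x
  actH≡act []      x = refl
  actH≡act (k ∷ h) x = cong (reflect (suc k)) (actH≡act h x)

  mirror-e₁ : ∀ x → mirror e₁ x ≡ reflect 0F x
  mirror-e₁ (t ∷ a ∷ b ∷ c ∷ d ∷ []) =
    trans (cong (λ z → (t ∷ a ∷ b ∷ c ∷ d ∷ []) -ᵥ (2φ *φ z) ·ᵥ e₁) (coefficient a b c d t))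
      (trans (cong₂ (λ u v → u ∷ a -φ 2φ *φ a *φ 1φ ∷ v) (vanish a t)
        (cong₂ _∷_ (vanish a b) (cong₂ (λ u v → u ∷ v ∷ []) (vanish a c) (vanish a d))))
        (cong (λ z → t ∷ z ∷ b ∷ c ∷ d ∷ []) (negate a)))
    where
    coefficient : ∀ a b c d t →
      a *φ 1φ +φ (b *φ 0φ +φ (c *φ 0φ +φ (d *φ 0φ +φ -φ (φ⁻³ *φ (t *φ 0φ))))) ≡ a
    coefficient = solve 5 (λ a b c d t → a :* con 1φ :+ (b :* con 0φ :+ (c :* con 0φ :+ (d :* con 0φ
      :+ :- (con φ⁻³ :* (t :* con 0φ))))) := a) refl
    vanish : ∀ a t → t -φ 2φ *φ a *φ 0φ ≡ t
    vanish = solve 2 (λ a t → t :- con 2φ :* a :* con 0φ := t) refl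
    negate : ∀ a → a -φ 2φ *φ a *φ 1φ ≡ -φ a
    negate = solve 1 (λ a → a :- con 2φ :* a :* con 1φ := :- a) refl

  -- The mirror is the conjugate of the first Coxeter generator by an element of H₄ that carries
  -- `e₁` to `α i`.
  mirror-symmetry : ∀ i → ∃[ g ] ∀ x → act g x ≡ mirror (α i) x
  mirror-symmetry i = let h , p = roots-reach (α∈roots i) in
    map suc h ++ 0F ∷ map suc (invH h) , λ x → begin
      act (map suc h ++ 0F ∷ map suc (invH h)) x        ≡⟨ act-++ (map suc h) _ x ⟩
      act (map suc h) (reflect 0F (act (map suc (invH h)) x))
        ≡⟨ cong (λ y → act (map suc h) (reflect 0F y)) (actH≡act (invH h) x) ⟨
      act (map suc h) (reflect 0F (actH (invH h) x))    ≡⟨ actH≡act h _ ⟨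
      actH h (reflect 0F (actH (invH h) x))             ≡⟨ cong (actH h) (mirror-e₁ _) ⟨
      actH h (mirror e₁ (actH (invH h) x))              ≡⟨ actH-mirror h e₁ _ ⟩
      mirror (actH h e₁) (actH h (actH (invH h) x))     ≡⟨ cong₂ mirror p (actH-invʳ h x) ⟩
      mirror (α i) x                                    ∎
    where open ≡-Reasoning

  -ᵥ-zero : ∀ x a → x -ᵥ 0φ ·ᵥ a ≡ x
  -ᵥ-zero (t ∷ a ∷ b ∷ c ∷ d ∷ []) (t′ ∷ a′ ∷ b′ ∷ c′ ∷ d′ ∷ []) =
    cong₂ _∷_ (z t t′) (cong₂ _∷_ (z a a′) (cong₂ _∷_ (z b b′) (cong₂ _∷_ (z c c′) (cong₂ _∷_ (z d d′) refl))))
    where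
    z : ∀ a b → a -φ 0φ *φ b ≡ a
    z = solve 2 (λ a b → a :- con 0φ :* b := a) refl

  -ᵥ-swap : ∀ x a b → x -ᵥ 1φ ·ᵥ a -ᵥ 1φ ·ᵥ b ≡ x -ᵥ 1φ ·ᵥ b -ᵥ 1φ ·ᵥ a
  -ᵥ-swap (t ∷ a ∷ b ∷ c ∷ d ∷ []) (t′ ∷ a′ ∷ b′ ∷ c′ ∷ d′ ∷ []) (t″ ∷ a″ ∷ b″ ∷ c″ ∷ d″ ∷ []) =
    cong₂ _∷_ (z t t′ t″) (cong₂ _∷_ (z a a′ a″) (cong₂ _∷_ (z b b′ b″) (cong₂ _∷_ (z c c′ c″)
      (cong₂ _∷_ (z d d′ d″) refl))))
    where
    z : ∀ a b c → a -φ 1φ *φ b -φ 1φ *φ c ≡ a -φ 1φ *φ c -φ 1φ *φ b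
    z = solve 3 (λ a b c → a :- con 1φ :* b :- con 1φ :* c := a :- con 1φ :* c :- con 1φ :* b) refl

  mirror-fix : ∀ a x → ⟨ x , a ⟩ ≡ 0φ → mirror a x ≡ x
  mirror-fix a x p = trans (cong (λ z → x -ᵥ (2φ *φ z) ·ᵥ a) p) (-ᵥ-zero x a)

  mirror-involutive : ∀ i x → mirror (α i) (mirror (α i) x) ≡ x
  mirror-involutive i x = let h , p = roots-reach (α∈roots i) in
    subst (λ a → mirror a (mirror a x) ≡ x) p (begin
      mirror (actH h e₁) (mirror (actH h e₁) x)
        ≡⟨ cong (λ y → mirror (actH h e₁) (mirror (actH h e₁) y)) (actH-invʳ h x) ⟨
      mirror (actH h e₁) (mirror (actH h e₁) (actH h (actH (invH h) x)))
        ≡⟨ cong (mirror (actH h e₁)) (actH-mirror h e₁ _) ⟨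
      mirror (actH h e₁) (actH h (mirror e₁ (actH (invH h) x)))
        ≡⟨ actH-mirror h e₁ _ ⟨
      actH h (mirror e₁ (mirror e₁ (actH (invH h) x)))
        ≡⟨ cong (actH h) (trans (mirror-e₁ _) (cong (reflect 0F) (mirror-e₁ _))) ⟩
      actH h (reflect 0F (reflect 0F (actH (invH h) x)))
        ≡⟨ cong (actH h) (reflect-involutive 0F _) ⟩
      actH h (actH (invH h) x)
        ≡⟨ actH-invʳ h x ⟩
      x ∎)
    where open ≡-Reasoning

  -- The mirror of `i` is a symmetry that fixes the normal of `j`, so it conjugates the mirror of
  -- `j` to itself.
  mirror-commute : ∀ i j x → i ~ j → mirror (α i) (mirror (α j) x) ≡ mirror (α j) (mirror (α i) x)
  mirror-commute i j x p = let g , q = mirror-symmetry i in begin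
    mirror (α i) (mirror (α j) x)                  ≡⟨ q _ ⟨
    act g (mirror (α j) x)                         ≡⟨ act-mirror g (α j) x ⟩
    mirror (act g (α j)) (act g x)                 ≡⟨ cong₂ mirror (q (α j)) (q x) ⟩
    mirror (mirror (α i) (α j)) (mirror (α i) x)
      ≡⟨ cong (λ a → mirror a (mirror (α i) x)) (mirror-fix (α i) (α j) (~-sym {i} {j} p)) ⟩
    mirror (α j) (mirror (α i) x)                  ∎
    where open ≡-Reasoning

  -- In `ρ` the newest mirror acts first, so a further letter moves the vertex `ρ w p₀` along an
  -- edge. `L w` is the inverse of `ρ w`; there the newest mirror acts last, as the numbers game
  -- requires.
  ρ L : Word → Point → Point
  ρ []      x = x
  ρ (t ∷ w) x = ρ w (mirror (α t) x)
  L []      x = x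
  L (t ∷ w) x = mirror (α t) (L w x)

  L-ρ : ∀ w x → L w (ρ w x) ≡ x
  L-ρ []      x = refl
  L-ρ (t ∷ w) x = trans (cong (mirror (α t)) (L-ρ w (mirror (α t) x))) (mirror-involutive t x)

  ρ-L : ∀ w x → ρ w (L w x) ≡ x
  ρ-L []      x = refl
  ρ-L (t ∷ w) x = trans (cong (ρ w) (mirror-involutive t (L w x))) (ρ-L w x)

  ρ-≈ : ∀ {v w} → v ≈ w → ∀ x → ρ v x ≡ ρ w x
  ρ-≈ ≈-refl        x = refl
  ρ-≈ (≈-trans p q) x = trans (ρ-≈ p x) (ρ-≈ q x)
  ρ-≈ (prep t p)    x = ρ-≈ p (mirror (α t) x)
  ρ-≈ (swap {s} {t} w p) x = cong (ρ w) (mirror-commute t s x (~-sym {s} {t} p))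

  ρ-≃ : ∀ {v w} → v ≃ w → ∀ x → ρ v x ≡ ρ w x
  ρ-≃ (trace p)     x = ρ-≈ p x
  ρ-≃ (cancel t w)  x = cong (ρ w) (mirror-involutive t x)
  ρ-≃ (≃-sym p)     x = sym (ρ-≃ p x)
  ρ-≃ (≃-trans p q) x = trans (ρ-≃ p x) (ρ-≃ q x)
  ρ-≃ (≃-prep t p)  x = ρ-≃ p (mirror (α t) x)

  L-≃ : ∀ {v w} → v ≃ w → ∀ x → L v x ≡ L w x
  L-≃ {v} {w} p x = trans (sym (cong (L v) (ρ-L w x)))
    (trans (sym (cong (L v) (ρ-≃ p (L w x)))) (L-ρ v (L w x)))

  L-++ : ∀ v w x → L (v ++ w) x ≡ L v (L w x)
  L-++ []      w x = refl
  L-++ (t ∷ v) w x = cong (mirror (α t)) (L-++ v w x)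

  ρ-++ : ∀ v w x → ρ (v ++ w) x ≡ ρ w (ρ v x)
  ρ-++ []      w x = refl
  ρ-++ (t ∷ v) w x = ρ-++ v w (mirror (α t) x)

  inverse : Word → Word
  inverse []      = []
  inverse (t ∷ w) = inverse w ++ t ∷ []

  L-inverse : ∀ w x → L (inverse w) x ≡ ρ w x
  L-inverse []      x = refl
  L-inverse (t ∷ w) x = trans (L-++ (inverse w) (t ∷ []) x) (L-inverse w (mirror (α t) x))

  -- The normals of a clique are orthonormal and `p₀` has product 1 with each of them. So this is
  -- the orthogonal projection of `p₀` to the intersection of their mirrors, the centre of the face
  -- spanned by these edges.
  centre : List Gen → Point
  centre []      = p₀
  centre (i ∷ τ) = centre τ -ᵥ 1φ ·ᵥ α i

  ⟨centre⟩ : ∀ i τ y → ⟨ centre (i ∷ τ) , y ⟩ ≡ ⟨ centre τ , y ⟩ -φ 1φ *φ ⟨ α i , y ⟩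
  ⟨centre⟩ i τ y = ⟨⟩-linear 1φ (centre τ) (α i) y

  centre-~ : ∀ {i τ} → All (_~ i) τ → ⟨ centre τ , α i ⟩ ≡ 1φ
  centre-~ {i} []                = p₀-α i
  centre-~ {i} (_∷_ {a} {τ} p c) = trans (⟨centre⟩ a τ (α i))
    (cong₂ (λ x y → x -φ 1φ *φ y) (centre-~ c) p)

  centre-∈ : ∀ {i τ} → Clique τ → i ∈ τ → ⟨ centre τ , α i ⟩ ≡ 0φ
  centre-∈ {i} {a ∷ τ} (p ∷ c) (here refl) = trans (⟨centre⟩ i τ (α i))
    (cong₂ (λ x y → x -φ 1φ *φ y) (centre-~ (All.map (λ {j} → ~-sym {i} {j}) p)) (α-norm i))
  centre-∈ {i} {a ∷ τ} (p ∷ c) (there m) = trans (⟨centre⟩ a τ (α i))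
    (cong₂ (λ x y → x -φ 1φ *φ y) (centre-∈ c m) (All.lookup p m))

  -- A normal in `τ` that is orthogonal to `α i` leaves the initial value 1 unchanged; any other has
  -- product at most -1 with `α i`, so subtracting it increases the value.
  centre-∉ : ∀ {i τ} → i ∉ τ → ∃[ y ] Nonneg y × ⟨ centre τ , α i ⟩ ≡ 1φ +φ y
  centre-∉ {i} {[]} _ = 0φ , nonneg-0 , p₀-α i
  centre-∉ {i} {a ∷ τ} n with centre-∉ (λ m → n (there m)) | trichotomy a i
  ... | _             | inj₁ refl     = ⊥-elim (n (here refl))
  ... | y , ny , e | inj₂ (inj₁ p) = y , ny , trans (⟨centre⟩ a τ (α i))
    (trans (cong₂ (λ x z → x -φ 1φ *φ z) e p) (solve 1 (λ y → con 1φ :+ y :- con 1φ :* con 0φ := con 1φ :+ y) refl y))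
  ... | y , ny , e | inj₂ (inj₂ p) =
    y +φ (1φ +φ (-φ g -φ 1φ)) , nonneg-+ ny (nonneg-+ nonneg-1 (far⇒ {g} p)) , trans (⟨centre⟩ a τ (α i))
    (trans (cong (_-φ 1φ *φ g) e) (rearrange y g))
    where
    g = ⟨ α a , α i ⟩
    rearrange : ∀ y g → 1φ +φ y -φ 1φ *φ g ≡ 1φ +φ (y +φ (1φ +φ (-φ g -φ 1φ)))
    rearrange = solve 2 (λ y g → con 1φ :+ y :- con 1φ :* g
      := con 1φ :+ (y :+ (con 1φ :+ (:- g :- con 1φ)))) refl

  centre-nonneg : ∀ {τ} → Clique τ → ∀ i → Nonneg ⟨ centre τ , α i ⟩
  centre-nonneg {τ} c i with i ∈? τ
  ... | yes m = subst Nonneg (sym (centre-∈ c m)) nonneg-0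
  ... | no n  = let y , ny , e = centre-∉ n in subst Nonneg (sym e) (nonneg-+ nonneg-1 ny)

  centre-zero : ∀ {τ i} → ⟨ centre τ , α i ⟩ ≡ 0φ → i ∈ τ
  centre-zero {τ} {i} p with i ∈? τ
  ... | yes m = m
  ... | no n  = let y , ny , e = centre-∉ n in ⊥-elim (absurd y ny (trans (sym e) p))
    where
    absurd : ∀ y → Nonneg y → 1φ +φ y ≡ 0φ → ⊥
    absurd y ny q = case trans (sym q) (trans (cong (1φ +φ_) y≡0) refl) of λ ()
      where
      -y≡1 : 1φ ≡ -φ y
      -y≡1 = trans (solve 1 (λ y → con 1φ := con 1φ :+ y :- y) refl y) (trans (cong (_-φ y) q)
               (solve 1 (λ y → con 0φ :- y := :- y) refl y))
      y≡0 : y ≡ 0φ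
      y≡0 = nonneg-antisym ny (subst Nonneg -y≡1 nonneg-1)

  centre-absorb : ∀ {τ t} → Clique τ → t ∈ τ → mirror (α t) (centre τ) ≡ centre τ
  centre-absorb {τ} {t} c m = mirror-fix (α t) (centre τ) (centre-∈ c m)

-- The numbers game and the stabilisers of faces

module Faces where
  open GoldenIntegers
  open Positivity
  open Mirrors
  open import Data.List.Membership.Propositional.Properties.WithK using (unique∧set⇒bag)
  open import Data.List.Properties using (++-assoc; ++-identityʳ)
  open import Data.List.Relation.Binary.BagAndSetEquality using (∼bag⇒↭)
  open import Data.List.Relation.Binary.Permutation.Propositional as Perm using (_↭_)
  open import Function.Bundles using (mk⇔)
  open φ-Solver using (solve; con; _:+_; _:*_; _:-_; :-_; _:=_)

  infix 8 _∙_
  _∙_ : Point → Gen → ℤ[φ]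
  x ∙ i = ⟨ x , α i ⟩

  fire : ∀ t y i → mirror (α t) y ∙ i ≡ y ∙ i -φ 2φ *φ (y ∙ t) *φ ⟨ α t , α i ⟩
  fire t y i = ⟨mirror⟩ (α t) y (α i)

  fire-self : ∀ t y → mirror (α t) y ∙ t ≡ -φ (y ∙ t)
  fire-self t y = trans (fire t y t) (trans (cong (λ g → y ∙ t -φ 2φ *φ (y ∙ t) *φ g) (α-norm t))
    (solve 1 (λ a → a :- con 2φ :* a :* con 1φ := :- a) refl (y ∙ t)))

  fire-~ : ∀ {t i} y → t ~ i → mirror (α t) y ∙ i ≡ y ∙ i
  fire-~ {t} {i} y p = trans (fire t y i) (trans (cong (λ g → y ∙ i -φ 2φ *φ (y ∙ t) *φ g) p)
    (solve 2 (λ a b → b :- con 2φ :* a :* con 0φ := b) refl (y ∙ t) (y ∙ i)))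

  far-part : Gen → Gen → ℤ[φ]
  far-part t i = -φ ⟨ α t , α i ⟩ -φ 1φ

  fire-far : ∀ t y i → mirror (α t) y ∙ i ≡ y ∙ i +φ 2φ *φ (y ∙ t) *φ (1φ +φ far-part t i)
  fire-far t y i = trans (fire t y i)
    (solve 3 (λ a b g → b :- con 2φ :* a :* g := b :+ con 2φ :* a :* (con 1φ :+ (:- g :- con 1φ))) refl
      (y ∙ t) (y ∙ i) ⟨ α t , α i ⟩)

  -- The coordinates x ∙ i play the numbers game: the mirror of t negates x ∙ t and
  -- adds at least twice the old x ∙ t to all coordinates that do not commute with t.

  record Play (w : Word) (x : Point) : Set where
    field
      sum : ∀ i j → i ≢ j → ¬ i ~ j → Nonneg (x ∙ i +φ x ∙ j)
      pos : ∀ i → i ∉ desc w → Nonneg (x ∙ i)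
      neg : ∀ i → i ∈ desc w → Nonneg (-φ (x ∙ i))

  module _ {w : Word} {y : Point} (P : Play w y) (t : Gen) (t∉ : t ∉ desc w) where
    open Play P

    private
      yt : Nonneg (y ∙ t)
      yt = pos t t∉

      far⇒≢ : ∀ {i} → ¬ t ~ i → t ≢ i → Nonneg (far-part t i)
      far⇒≢ {i} n m with trichotomy t i
      ... | inj₁ p        = ⊥-elim (m p)
      ... | inj₂ (inj₁ p) = ⊥-elim (n p)
      ... | inj₂ (inj₂ p) = far⇒ {⟨ α t , α i ⟩} p

      gain : ∀ i → t ≢ i → ∃[ e ] Nonneg e × mirror (α t) y ∙ i ≡ y ∙ i +φ e
      gain i n with t ~? i
      ... | yes p = 0φ , nonneg-0 , trans (fire-~ y p) (solve 1 (λ a → a := a :+ con 0φ) refl (y ∙ i))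
      ... | no p  = _ , nonneg-* (nonneg-* nonneg-2 yt) (nonneg-+ nonneg-1 (far⇒≢ p n)) , fire-far t y i

      sum-t : ∀ i → t ≢ i → ¬ t ~ i → Nonneg (mirror (α t) y ∙ t +φ mirror (α t) y ∙ i)
      sum-t i n m = subst Nonneg
        (sym (trans (cong₂ _+φ_ (fire-self t y) (fire-far t y i))
          (solve 3 (λ a b f → :- a :+ (b :+ con 2φ :* a :* (con 1φ :+ f))
            := (a :+ b) :+ con 2φ :* a :* f) refl (y ∙ t) (y ∙ i) (far-part t i))))
        (nonneg-+ (sum t i n m) (nonneg-* (nonneg-* nonneg-2 yt) (far⇒≢ m n)))

    -- A letter `i` that does not commute with `t` may be a descent of `w` with a negative
    -- coordinate. The invariant `sum` says that the coordinate of `t` outweighs it, so firing `t`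
    -- makes it nonnegative. The coordinate of `t` drops by twice its value, and each such `i` gains
    -- at least as much, which preserves `sum`.
    play-step : Play (t ∷ w) (mirror (α t) y)
    play-step = record { sum = sum′ ; pos = pos′ ; neg = neg′ }
      where
      x = mirror (α t) y
      sum′ : ∀ i j → i ≢ j → ¬ i ~ j → Nonneg (x ∙ i +φ x ∙ j)
      sum′ i j n m with t ≟ i | t ≟ j
      ... | yes refl | _        = sum-t j n m
      ... | no p     | yes refl = subst Nonneg (+φ-comm (x ∙ t) (x ∙ i))
        (sum-t i (λ q → n (sym q)) (λ q → m (~-sym {t} {i} q)))
      ... | no p     | no q with gain i p | gain j q
      ...   | e , ne , r | f , nf , s = subst Nonneg
        (sym (trans (cong₂ _+φ_ r s)
          (solve 4 (λ a b e f → (a :+ e) :+ (b :+ f) := (a :+ b) :+ (e :+ f)) refl (y ∙ i) (y ∙ j) e f)))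
        (nonneg-+ (sum i j n m) (nonneg-+ ne nf))
      pos′ : ∀ i → i ∉ desc (t ∷ w) → Nonneg (x ∙ i)
      pos′ i n with t ~? i
      ... | yes p = subst Nonneg (sym (fire-~ y p)) (pos i (λ m → n (∈-desc⁺ w p m)))
      ... | no p  = subst Nonneg
        (sym (trans (fire-far t y i) (solve 3 (λ a b f → b :+ con 2φ :* a :* (con 1φ :+ f)
          := (a :+ b) :+ (a :+ con 2φ :* a :* f)) refl (y ∙ t) (y ∙ i) (far-part t i))))
        (nonneg-+ (sum t i t≢i p)
          (nonneg-+ yt (nonneg-* (nonneg-* nonneg-2 yt) (far⇒≢ p t≢i))))
        where
        t≢i : t ≢ i
        t≢i q = n (here (sym q))
      neg′ : ∀ i → i ∈ desc (t ∷ w) → Nonneg (-φ (x ∙ i))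
      neg′ i m with ∈-desc⁻ w m
      ... | inj₁ refl    = subst Nonneg
        (sym (trans (cong -φ_ (fire-self t y)) (solve 1 (λ a → :- (:- a) := a) refl (y ∙ t)))) yt
      ... | inj₂ (p , q) = subst (λ a → Nonneg (-φ a)) (sym (fire-~ y p)) (neg i q)

  play : ∀ {τ} → Clique τ → ∀ w → Red w → Play w (L w (centre τ))
  play c []      _       = record
    { sum = λ i j _ _ → nonneg-+ (centre-nonneg c i) (centre-nonneg c j)
    ; pos = λ i _ → centre-nonneg c i
    ; neg = λ i () }
  play c (t ∷ w) (n , r) = play-step (play c w r) t n

  -- The last mirror makes the coordinate of `t` nonpositive, but at a face centre it is
  -- nonnegative. So it is zero, the mirror of `t` fixes `centre τ′`, and it can be peeled off. Zero
  -- coordinates belong to letters of the face only.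
  stabiliser : ∀ {τ τ′} → Clique τ → Clique τ′ → ∀ w → Red w → L w (centre τ) ≡ centre τ′ →
               (∀ {t} → t ∈ w → t ∈ τ) × centre τ ≡ centre τ′
  stabiliser c c′ [] _ p = (λ ()) , p
  stabiliser {τ} {τ′} c c′ (t ∷ w) (n , r) p = letters , proj₂ rest
    where
    zero-t : centre τ′ ∙ t ≡ 0φ
    zero-t = nonneg-antisym (centre-nonneg c′ t)
      (subst (λ x → Nonneg (-φ (x ∙ t))) p (Play.neg (play c (t ∷ w) (n , r)) t (here refl)))
    rest : (∀ {t} → t ∈ w → t ∈ τ) × centre τ ≡ centre τ′
    rest = stabiliser c c′ w r (trans (sym (mirror-involutive t _))
      (trans (cong (mirror (α t)) p) (mirror-fix (α t) (centre τ′) zero-t)))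
    letters : ∀ {s} → s ∈ t ∷ w → s ∈ τ
    letters (here refl) = centre-zero (trans (cong (_∙ t) (proj₂ rest)) zero-t)
    letters (there m)   = proj₁ rest m

  inverse-cancel : ∀ w → inverse w ++ w ≃ []
  inverse-cancel []      = trace ≈-refl
  inverse-cancel (t ∷ w) = subst (_≃ []) (sym (++-assoc (inverse w) (t ∷ []) (t ∷ w)))
    (≃-trans (≃-++ˡ (inverse w) (cancel t w)) (inverse-cancel w))

  reduced-[] : ∀ {w} → Red w → w ≃ [] → w ≡ []
  reduced-[] {[]}    _ _ = refl
  reduced-[] {t ∷ w} r p = case proj₁ (stabiliser [] [] (t ∷ w) r (L-≃ p p₀)) (here refl) of λ ()

  -- The solution of the word problem: a reduced word is unique up to commutations. If `t` is a
  -- descent of `w`, it is cancelled on both sides; otherwise `t ∷ w` would be a reduced word for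
  -- the rest `v`, making `t` a descent of `v`.
  reduced-≈ : ∀ v w → Red v → Red w → v ≃ w → v ≈ w
  reduced-≈ [] w _ r p = subst ([] ≈_) (sym (reduced-[] r (≃-sym p))) ≈-refl
  reduced-≈ (t ∷ v) w (n , r) r′ p with append t w r′
  ... | inj₁ (_ , u , q , (_ , r″) , s) =
    ≈-trans (prep t (reduced-≈ v u r r″ (≃-trans (≃-sym (cancel t v)) (≃-trans (≃-prep t p) s)))) (≈-sym q)
  ... | inj₂ r″ = ⊥-elim (n (≈-desc (≈-sym (reduced-≈ v (t ∷ w) r r″
    (≃-trans (≃-sym (cancel t v)) (≃-prep t p)))) (here refl)))

  same-set : ∀ {τ τ′} → Clique τ → Clique τ′ → centre τ ≡ centre τ′ → ∀ {t} → t ∈ τ → t ∈ τ′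
  same-set c c′ p m = centre-zero (trans (cong (_∙ _) (sym p)) (centre-∈ c m))

  -- The element w′w⁻¹ carries one centre to the other, so by `stabiliser` its reduced form uses
  -- only letters of `τ`; this form is the witness `u`.
  ρ-centre : ∀ {τ τ′} → Clique τ → Clique τ′ → ∀ w w′ → ρ w (centre τ) ≡ ρ w′ (centre τ′) →
             (∃[ u ] (∀ {t} → t ∈ u → t ∈ τ) × u ++ w ≃ w′) × centre τ ≡ centre τ′
  ρ-centre {τ} {τ′} c c′ w w′ p =
    (R.word , proj₁ s , ≃-trans (≃-++ʳ w (≃-sym R.equal))
      (subst (_≃ w′) (sym (++-assoc w′ (inverse w) w))
        (subst (w′ ++ inverse w ++ w ≃_) (++-identityʳ w′) (≃-++ˡ w′ (inverse-cancel w)))))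
    , proj₂ s
    where
    module R = Reduction (reduce (w′ ++ inverse w))
    open ≡-Reasoning
    s : (∀ {t} → t ∈ R.word → t ∈ τ) × centre τ ≡ centre τ′
    s = stabiliser c c′ R.word R.reduced (begin
      L R.word (centre τ)               ≡⟨ L-≃ R.equal (centre τ) ⟨
      L (w′ ++ inverse w) (centre τ)    ≡⟨ L-++ w′ (inverse w) (centre τ) ⟩
      L w′ (L (inverse w) (centre τ))   ≡⟨ cong (L w′) (L-inverse w (centre τ)) ⟩
      L w′ (ρ w (centre τ))             ≡⟨ cong (L w′) p ⟩
      L w′ (ρ w′ (centre τ′))           ≡⟨ L-ρ w′ (centre τ′) ⟩
      centre τ′                         ∎)

  centre-↭ : ∀ {τ τ′} → τ ↭ τ′ → centre τ ≡ centre τ′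
  centre-↭ Perm.refl         = refl
  centre-↭ (Perm.prep i p)   = cong (_-ᵥ 1φ ·ᵥ α i) (centre-↭ p)
  centre-↭ {_ ∷ _ ∷ τ} (Perm.swap i j p) = trans (-ᵥ-swap (centre τ) (α j) (α i))
    (cong (λ x → x -ᵥ 1φ ·ᵥ α i -ᵥ 1φ ·ᵥ α j) (centre-↭ p))
  centre-↭ (Perm.trans p q)  = trans (centre-↭ p) (centre-↭ q)

  centre-set : ∀ {τ τ′} → Clique τ → Clique τ′ → (∀ {t} → t ∈ τ → t ∈ τ′) → (∀ {t} → t ∈ τ′ → t ∈ τ) →
               centre τ ≡ centre τ′
  centre-set c c′ f g =
    centre-↭ (∼bag⇒↭ (unique∧set⇒bag (clique-unique c) (clique-unique c′) (mk⇔ f g)))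

  ρ-absorb : ∀ {τ} → Clique τ → ∀ u w → (∀ {t} → t ∈ u → t ∈ τ) → ρ (u ++ w) (centre τ) ≡ ρ w (centre τ)
  ρ-absorb c []      w f = refl
  ρ-absorb c (t ∷ u) w f = trans (cong (ρ (u ++ w)) (centre-absorb c (f (here refl))))
    (ρ-absorb c u w (λ m → f (there m)))

-- Flag transitivity and the table of ascents

module Flags where
  open GoldenIntegers
  open RootOrbit
  open Mirrors
  open import Data.List.Base using (allFin)
  open import Data.List.Relation.Binary.Permutation.Propositional using (_↭_)
  open import Data.List.Membership.DecPropositional using () renaming (_∈?_ to decMember)
  import Data.Product.Properties as Productₚ
  import Data.Sum.Base as Sum
  open import Relation.Nullary.Decidable using (¬?; _×-dec_; _⊎-dec_)
  open import Relation.Unary using (Decidable)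

  -- The vertices above v in the cone, if ρ consists of the directions that are
  -- still missing at v and τ of the descents of v: each is encoded by the numbers
  -- of its missing directions and of its descents.

  module Ascents {X : Set} (_≟_ : (x y : X) → Dec (x ≡ y))
                 {_~_ : X → X → Set} (_~?_ : (x y : X) → Dec (x ~ y)) where

    Allowed : List X → List X → X → Set
    Allowed ρ τ t = t ∉ τ × All (λ a → t ≡ a ⊎ t ~ a) ρ

    allowed? : ∀ ρ τ t → Dec (Allowed ρ τ t)
    allowed? ρ τ t = ¬? (decMember _≟_ t τ) ×-dec all? (λ a → (t ≟ a) ⊎-dec (t ~? a)) ρ

    code : List X → List X → X → ℕ × ℕ
    code ρ τ t = length (filter (λ a → ¬? (t ≟ a)) ρ) , suc (length (filter (t ~?_) τ))

    ascents : List X → List X → List X → List (ℕ × ℕ)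
    ascents xs ρ τ = map (code ρ τ) (filter (allowed? ρ τ) xs)

  filter-map : ∀ {X Y : Set} {P : X → Set} {Q : Y → Set} (P? : Decidable P) (Q? : Decidable Q) (f : X → Y) →
               (∀ x → P x → Q (f x)) → (∀ x → Q (f x) → P x) →
               ∀ xs → filter Q? (map f xs) ≡ map f (filter P? xs)
  filter-map P? Q? f p q [] = refl
  filter-map P? Q? f p q (x ∷ xs) with P? x | Q? (f x)
  ... | yes a | yes b = cong (f x ∷_) (filter-map P? Q? f p q xs)
  ... | yes a | no b  = ⊥-elim (b (p x a))
  ... | no a  | yes b = ⊥-elim (a (q x b))
  ... | no a  | no b  = filter-map P? Q? f p q xs

  module _ {X Y : Set} (_≟x_ : (x y : X) → Dec (x ≡ y)) (_≟y_ : (x y : Y) → Dec (x ≡ y))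
           {_~x_ : X → X → Set} (_~x?_ : (x y : X) → Dec (x ~x y))
           {_~y_ : Y → Y → Set} (_~y?_ : (x y : Y) → Dec (x ~y y))
           (f : X → Y) (injective : ∀ {x y} → f x ≡ f y → x ≡ y)
           (preserve : ∀ {x y} → x ~x y → f x ~y f y) (reflects : ∀ {x y} → f x ~y f y → x ~x y) where

    private
      module X = Ascents _≟x_ _~x?_
      module Y = Ascents _≟y_ _~y?_

      ∈-map-reflect : ∀ {x} τ → f x ∈ map f τ → x ∈ τ
      ∈-map-reflect τ m = let y , k , p = ∈-map⁻ f m in subst (_∈ τ) (sym (injective p)) k

      code-map : ∀ ρ τ t → Y.code (map f ρ) (map f τ) (f t) ≡ X.code ρ τ t
      code-map ρ τ t = cong₂ (λ m n → m , suc n)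
        (trans (cong length (filter-map (λ a → ¬? (t ≟x a)) (λ a → ¬? (f t ≟y a)) f
          (λ _ n p → n (injective p)) (λ _ n p → n (cong f p)) ρ)) (Listₚ.length-map f (filter (λ a → ¬? (t ≟x a)) ρ)))
        (trans (cong length (filter-map (t ~x?_) (f t ~y?_) f (λ _ → preserve) (λ _ → reflects) τ))
          (Listₚ.length-map f (filter (t ~x?_) τ)))

    -- `Allowed` and `code` depend on equality and adjacency only, and the map preserves and
    -- reflects both.
    ascents-map : ∀ xs ρ τ → Y.ascents (map f xs) (map f ρ) (map f τ) ≡ X.ascents xs ρ τ
    ascents-map xs ρ τ = trans
      (cong (map (Y.code (map f ρ) (map f τ)))
        (filter-map (X.allowed? ρ τ) (Y.allowed? (map f ρ) (map f τ)) f
          (λ x (n , a) → (λ m → n (∈-map-reflect τ m)) , Allₚ.map⁺ (All.map (Sum.map (cong f) preserve) a))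
          (λ x (n , a) → (λ m → n (∈-map⁺ f m)) , All.map (Sum.map injective reflects) (Allₚ.map⁻ a))
          xs))
      (trans (sym (Listₚ.map-∘ (filter (X.allowed? ρ τ) xs)))
        (Listₚ.map-cong (code-map ρ τ) (filter (X.allowed? ρ τ) xs)))

  count : ℕ × ℕ → List (ℕ × ℕ) → ℕ
  count c l = length (filter (λ d → Productₚ.≡-dec ℕₚ._≟_ ℕₚ._≟_ d c) l)

  count-↭ : ∀ c {k l} → k ↭ l → count c k ≡ count c l
  count-↭ c p = Permₚ.↭-length (Permₚ.filter-↭ _ p)

  module Γ-ascents = Ascents _≟_ _~?_
  module P-ascents = Ascents _≟ₚ_ (λ x y → ⟨ x , y ⟩ ≟φ 0φ)

  gens : List Gen
  gens = allFin (length roots)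

  flagₚ : List Point
  flagₚ = e₁ ∷ e₂ ∷ e₃ ∷ e₄ ∷ []

  states : List (ℕ × ℕ)
  states = (4 , 0) ∷ (3 , 1) ∷ (2 , 1) ∷ (2 , 2) ∷ (1 , 1) ∷ (1 , 2) ∷ (1 , 3)
         ∷ (0 , 1) ∷ (0 , 2) ∷ (0 , 3) ∷ (0 , 4) ∷ []

  -- Rows and columns are ordered as `states`: the row of (m, d) counts the ascents from a vertex
  -- with m missing directions and d descents. Its sum is the degree minus d, where the degrees for
  -- m = 4, 3, 2, 1, 0 are 4, 5, 7, 13, 120.
  transitions : List (List ℕ)
  transitions =
      (0 ∷ 4 ∷ 0 ∷ 0 ∷ 0 ∷ 0 ∷ 0 ∷  0 ∷  0 ∷ 0 ∷ 0 ∷ [])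
    ∷ (0 ∷ 1 ∷ 0 ∷ 3 ∷ 0 ∷ 0 ∷ 0 ∷  0 ∷  0 ∷ 0 ∷ 0 ∷ [])
    ∷ (0 ∷ 0 ∷ 2 ∷ 2 ∷ 0 ∷ 2 ∷ 0 ∷  0 ∷  0 ∷ 0 ∷ 0 ∷ [])
    ∷ (0 ∷ 0 ∷ 1 ∷ 2 ∷ 0 ∷ 0 ∷ 2 ∷  0 ∷  0 ∷ 0 ∷ 0 ∷ [])
    ∷ (0 ∷ 0 ∷ 0 ∷ 0 ∷ 6 ∷ 5 ∷ 0 ∷  0 ∷  1 ∷ 0 ∷ 0 ∷ [])
    ∷ (0 ∷ 0 ∷ 0 ∷ 0 ∷ 4 ∷ 4 ∷ 2 ∷  0 ∷  0 ∷ 1 ∷ 0 ∷ [])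
    ∷ (0 ∷ 0 ∷ 0 ∷ 0 ∷ 3 ∷ 3 ∷ 3 ∷  0 ∷  0 ∷ 0 ∷ 1 ∷ [])
    ∷ (0 ∷ 0 ∷ 0 ∷ 0 ∷ 0 ∷ 0 ∷ 0 ∷ 107 ∷ 12 ∷ 0 ∷ 0 ∷ [])
    ∷ (0 ∷ 0 ∷ 0 ∷ 0 ∷ 0 ∷ 0 ∷ 0 ∷ 101 ∷ 12 ∷ 5 ∷ 0 ∷ [])
    ∷ (0 ∷ 0 ∷ 0 ∷ 0 ∷ 0 ∷ 0 ∷ 0 ∷  97 ∷ 12 ∷ 6 ∷ 2 ∷ [])
    ∷ (0 ∷ 0 ∷ 0 ∷ 0 ∷ 0 ∷ 0 ∷ 0 ∷  94 ∷ 12 ∷ 6 ∷ 4 ∷ [])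
    ∷ []

  opaque
    unfolding roots

    transitions-roots : map (λ (m , d) → map (λ c → count c (P-ascents.ascents roots (take m flagₚ)
                          (take d (drop m flagₚ)))) states) states ≡ transitions
    transitions-roots = refl

    degrees-roots : map (λ m → length (P-ascents.ascents roots (take m flagₚ) [])) (0 ∷ 1 ∷ 2 ∷ [])
                  ≡ 120 ∷ 13 ∷ 7 ∷ []
    degrees-roots = refl

  -- H₄ acts transitively on the flags of the 600-cell.

  e₂∈roots : e₂ ∈ roots
  e₂∈roots = roots-closed zero e₁∈roots

  e₃∈roots : e₃ ∈ roots
  e₃∈roots = roots-closed (suc zero) e₂∈roots

  e₄∈roots : e₄ ∈ roots
  e₄∈roots = roots-closed (suc (suc zero)) e₃∈roots

  private
    pull : ∀ h {x} a b → actH h x ≡ α a → a ~ b → ⟨ x , actH (invH h) (α b) ⟩ ≡ 0φ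
    pull h {x} a b p q = trans (sym (actH-isometry h x _))
      (trans (cong₂ ⟨_,_⟩ p (actH-invʳ h (α b))) q)

    module Extend {X : Set} (f : X → Fin 4) (h : Stab) (k : List X) where
      g : Stab
      g = h ++ map f k

      keeps : ∀ {x y} → (∀ k → reflect (suc (f k)) x ≡ x) → actH h x ≡ y → actH g x ≡ y
      keeps {x} p q = trans (actH-++ h (map f k) x) (trans (cong (actH h) (actH-fix f p k)) q)

      hits : ∀ {x y} → actH (map f k) x ≡ actH (invH h) y → actH g x ≡ y
      hits {x} {y} p = trans (actH-++ h (map f k) x) (trans (cong (actH h) p) (actH-invʳ h y))

    root′ : ∀ h a → actH (invH h) (α a) ∈ roots
    root′ h a = actH-closed (invH h) (α∈roots a)

  flag₁ : ∀ a → ∃[ h ] actH h e₁ ≡ α a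
  flag₁ a = roots-reach (α∈roots a)

  -- Pulled back by `h`, the new root is a neighbour of the base roots already placed. An element
  -- fixing those roots carries the next base root to it, and composing with `h` spoils nothing. The
  -- longer flags repeat this step.
  flag₂ : ∀ a b → a ~ b → ∃[ h ] actH h e₁ ≡ α a × actH h e₂ ≡ α b
  flag₂ a b ab =
    let h , p = flag₁ a
        k , q = orbit-reach suc e₂ tree₂ (link₁ (root′ h b) (pull h a b p ab))
        open Extend suc h k
    in g , keeps (λ { zero → refl ; (suc zero) → refl ; (suc (suc zero)) → refl }) p , hits q

  flag₃ : ∀ a b c → a ~ b → a ~ c → b ~ c →
          ∃[ h ] actH h e₁ ≡ α a × actH h e₂ ≡ α b × actH h e₃ ≡ α c
  flag₃ a b c ab ac bc =
    let h , p , q = flag₂ a b ab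
        k , r = orbit-reach suc² e₃ tree₃ (link₂ (root′ h c) (pull h a c p ac) (pull h b c q bc))
        open Extend suc² h k
    in g , keeps (λ { zero → refl ; (suc zero) → refl }) p
         , keeps (λ { zero → refl ; (suc zero) → refl }) q , hits r

  flag₄ : ∀ a b c d → a ~ b → a ~ c → b ~ c → a ~ d → b ~ d → c ~ d →
          ∃[ h ] actH h e₁ ≡ α a × actH h e₂ ≡ α b × actH h e₃ ≡ α c × actH h e₄ ≡ α d
  flag₄ a b c d ab ac bc ad bd cd =
    let h , p , q , r = flag₃ a b c ab ac bc
        k , s = orbit-reach suc³ e₄ tree₄
                  (link₃ (root′ h d) (pull h a d p ad) (pull h b d q bd) (pull h c d r cd))
        open Extend suc³ h k
    in g , keeps (λ { zero → refl }) p , keeps (λ { zero → refl }) q , keeps (λ { zero → refl }) r , hits s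

  clique-move : ∀ τ → Clique τ → length τ ≤ 4 →
                ∃[ h ] map (actH h) (take (length τ) flagₚ) ≡ map α τ
  clique-move [] _ _ = [] , refl
  clique-move (a ∷ []) _ _ = let h , p = flag₁ a in h , cong₂ _∷_ p refl
  clique-move (a ∷ b ∷ []) ((ab ∷ []) ∷ _) _ =
    let h , p , q = flag₂ a b ab in h , cong₂ _∷_ p (cong₂ _∷_ q refl)
  clique-move (a ∷ b ∷ c ∷ []) ((ab ∷ ac ∷ []) ∷ (bc ∷ []) ∷ _) _ =
    let h , p , q , r = flag₃ a b c ab ac bc in h , cong₂ _∷_ p (cong₂ _∷_ q (cong₂ _∷_ r refl))
  clique-move (a ∷ b ∷ c ∷ d ∷ []) ((ab ∷ ac ∷ ad ∷ []) ∷ (bc ∷ bd ∷ []) ∷ (cd ∷ []) ∷ _) _ =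
    let h , p , q , r , s = flag₄ a b c d ab ac bc ad bd cd in
    h , cong₂ _∷_ p (cong₂ _∷_ q (cong₂ _∷_ r (cong₂ _∷_ s refl)))
  clique-move (_ ∷ _ ∷ _ ∷ _ ∷ _ ∷ _) _ (s≤s (s≤s (s≤s (s≤s ()))))

  -- The cells of the 600-cell are tetrahedra: in base position a fifth root orthogonal to `e₁`,
  -- `e₂`, `e₃` is `e₄` or its image under the last generator, and neither is orthogonal to `e₄`.
  no-5-clique : ∀ a b c d t → Clique (a ∷ b ∷ c ∷ d ∷ t ∷ []) → ⊥
  no-5-clique a b c d t ((ab ∷ ac ∷ ad ∷ at ∷ []) ∷ (bc ∷ bd ∷ bt ∷ []) ∷ (cd ∷ ct ∷ []) ∷ (dt ∷ []) ∷ _) =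
    let h , p , q , r , s = flag₄ a b c d ab ac bc ad bd cd in
    absurd h s (link₃ (root′ h t) (pull h a t p at) (pull h b t q bt) (pull h c t r ct)) (pull h d t s dt)
    where
    absurd : ∀ h → actH h e₄ ≡ α d → ∀ {x} → x ∈ orbit suc³ e₄ tree₄ → ⟨ e₄ , x ⟩ ≡ 0φ → ⊥
    absurd h s (here refl) ()
    absurd h s (there (here refl)) ()

  clique≤4 : ∀ τ → Clique τ → length τ ≤ 4
  clique≤4 [] _ = z≤n
  clique≤4 (_ ∷ []) _ = s≤s z≤n
  clique≤4 (_ ∷ _ ∷ []) _ = s≤s (s≤s z≤n)
  clique≤4 (_ ∷ _ ∷ _ ∷ []) _ = s≤s (s≤s (s≤s z≤n))
  clique≤4 (_ ∷ _ ∷ _ ∷ _ ∷ []) _ = s≤s (s≤s (s≤s (s≤s z≤n)))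
  clique≤4 (a ∷ b ∷ c ∷ d ∷ t ∷ τ)
    ((ab ∷ ac ∷ ad ∷ at ∷ _) ∷ (bc ∷ bd ∷ bt ∷ _) ∷ (cd ∷ ct ∷ _) ∷ (dt ∷ _) ∷ _) =
    ⊥-elim (no-5-clique a b c d t
      ((ab ∷ ac ∷ ad ∷ at ∷ []) ∷ (bc ∷ bd ∷ bt ∷ []) ∷ (cd ∷ ct ∷ []) ∷ (dt ∷ []) ∷ [] ∷ []))

-- Faces of the mosaic as words with cliques

module Incidence where
  open GoldenIntegers
  open RootOrbit
  open Mirrors
  open Faces
  open Flags
  open import Data.List.Membership.Propositional.Properties.WithK using (unique∧set⇒bag)
  open import Data.List.Relation.Binary.BagAndSetEquality using (∼bag⇒↭)
  open import Data.List.Relation.Binary.Permutation.Propositional as Perm using (_↭_)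
  open import Data.Nat.Base using (_+_)
  open import Function.Bundles using (mk⇔)

  actH-injective : ∀ h {x y} → actH h x ≡ actH h y → x ≡ y
  actH-injective h {x} {y} p = trans (sym (actH-invˡ h x)) (trans (cong (actH (invH h)) p) (actH-invˡ h y))

  roots-permuted : ∀ h → roots ↭ map (actH h) roots
  roots-permuted h = ∼bag⇒↭ (unique∧set⇒bag roots-unique
    (Uniqueₚ.map⁺ (actH-injective h) roots-unique)
    (λ {x} → mk⇔ (λ m → subst (_∈ map (actH h) roots) (actH-invʳ h x) (∈-map⁺ (actH h) (actH-closed (invH h) m)))
         (λ m → let y , n , p = ∈-map⁻ (actH h) m in subst (_∈ roots) (sym p) (actH-closed h n))))

  map-α-gens : map α gens ≡ roots
  map-α-gens = trans (Listₚ.map-tabulate (λ i → i) α) (Listₚ.tabulate-lookup roots)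

  lift-roots : ∀ xs → All (_∈ roots) xs → ∃[ τ ] map α τ ≡ xs
  lift-roots []       []      = [] , refl
  lift-roots (x ∷ xs) (m ∷ a) = let i , p = root-index m ; τ , q = lift-roots xs a in i ∷ τ , cong₂ _∷_ p q

  flagₚ⊆roots : All (_∈ roots) flagₚ
  flagₚ⊆roots = e₁∈roots ∷ e₂∈roots ∷ e₃∈roots ∷ e₄∈roots ∷ []

  lift-flag : ∀ h → ∃[ τ ] map α τ ≡ map (actH h) flagₚ
  lift-flag h = lift-roots _ (Allₚ.map⁺ (All.map (actH-closed h) flagₚ⊆roots))

  lift-clique : ∀ h xs {τ} → map α τ ≡ map (actH h) xs → AllPairs (λ x y → ⟨ x , y ⟩ ≡ 0φ) xs → Clique τ
  lift-clique h xs {τ} p c = AllPairsₚ.map⁻ (subst (AllPairs (λ x y → ⟨ x , y ⟩ ≡ 0φ)) (sym p)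
    (AllPairsₚ.map⁺ (AllPairs.map (λ {x} {y} q → trans (actH-isometry h x y) q) c)))

  flagₚ-orthogonal : AllPairs (λ x y → ⟨ x , y ⟩ ≡ 0φ) flagₚ
  flagₚ-orthogonal = (refl ∷ refl ∷ refl ∷ []) ∷ (refl ∷ refl ∷ []) ∷ (refl ∷ []) ∷ [] ∷ []

  Flag : List Gen → Set
  Flag τ = Clique τ × length τ ≡ 4

  -- By flag transitivity only the sizes of ρ and τ matter.

  ascents-↭ : ∀ ρ τ → Clique (ρ ++ τ) → Γ-ascents.ascents gens ρ τ
    ↭ P-ascents.ascents roots (take (length ρ) flagₚ) (take (length τ) (drop (length ρ) flagₚ))
  ascents-↭ ρ τ cl with clique-move (ρ ++ τ) cl (clique≤4 (ρ ++ τ) cl)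
  ... | h , p = begin
    Γ-ascents.ascents gens ρ τ
      ≡⟨ ascents-map _≟_ _≟ₚ_ _~?_ (λ x y → ⟨ x , y ⟩ ≟φ 0φ) α α-injective (λ q → q) (λ q → q) gens ρ τ ⟨
    P-ascents.ascents (map α gens) (map α ρ) (map α τ)
      ≡⟨ cong₂ (λ x y → P-ascents.ascents x (map α ρ) y) map-α-gens second ⟩
    P-ascents.ascents roots (map α ρ) (map (actH h) τ₀)
      ≡⟨ cong (λ x → P-ascents.ascents roots x (map (actH h) τ₀)) first ⟩
    P-ascents.ascents roots (map (actH h) ρ₀) (map (actH h) τ₀)
      ↭⟨ Permₚ.map⁺ _ (Permₚ.filter-↭ _ (roots-permuted h)) ⟩
    P-ascents.ascents (map (actH h) roots) (map (actH h) ρ₀) (map (actH h) τ₀)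
      ≡⟨ ascents-map _≟ₚ_ _≟ₚ_ (λ x y → ⟨ x , y ⟩ ≟φ 0φ) (λ x y → ⟨ x , y ⟩ ≟φ 0φ) (actH h)
           (actH-injective h) (λ {x} {y} q → trans (actH-isometry h x y) q)
           (λ {x} {y} q → trans (sym (actH-isometry h x y)) q) roots ρ₀ τ₀ ⟩
    P-ascents.ascents roots ρ₀ τ₀ ∎
    where
    open Perm.PermutationReasoning
    ρ₀ = take (length ρ) flagₚ
    τ₀ = take (length τ) (drop (length ρ) flagₚ)
    split : ∀ m n (xs : List Point) → take m (take (m + n) xs) ≡ take m xs × drop m (take (m + n) xs) ≡ take n (drop m xs)
    split zero    n xs       = refl , refl
    split (suc m) zero    [] = refl , refl
    split (suc m) (suc n) [] = refl , refl
    split (suc m) n (x ∷ xs) = cong (x ∷_) (proj₁ (split m n xs)) , proj₂ (split m n xs)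
    p′ : map α ρ ++ map α τ ≡ map (actH h) (take (length ρ + length τ) flagₚ)
    p′ = trans (sym (Listₚ.map-++ α ρ τ)) (trans (sym p)
      (cong (λ n → map (actH h) (take n flagₚ)) (Listₚ.length-++ ρ)))
    take-len : ∀ xs (ys : List Point) → take (length xs) (map α xs ++ ys) ≡ map α xs × drop (length xs) (map α xs ++ ys) ≡ ys
    take-len []       ys = refl , refl
    take-len (x ∷ xs) ys = cong (α x ∷_) (proj₁ (take-len xs ys)) , proj₂ (take-len xs ys)
    first : map α ρ ≡ map (actH h) ρ₀
    first = trans (sym (proj₁ (take-len ρ (map α τ)))) (trans (cong (take (length ρ)) p′)
      (trans (Listₚ.take-map (length ρ) _) (cong (map (actH h)) (proj₁ (split (length ρ) (length τ) flagₚ)))))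
    second : map α τ ≡ map (actH h) τ₀
    second = trans (sym (proj₂ (take-len ρ (map α τ)))) (trans (cong (drop (length ρ)) p′)
      (trans (Listₚ.drop-map (length ρ) _) (cong (map (actH h)) (proj₂ (split (length ρ) (length τ) flagₚ)))))

  extend-clique : ∀ τ → Clique τ → ∃[ τ′ ] Flag (τ ++ τ′)
  extend-clique τ c with clique-move τ c (clique≤4 τ c)
  ... | h , p with lift-roots (map (actH h) (drop (length τ) flagₚ))
                    (Allₚ.map⁺ (All.map (actH-closed h) (Allₚ.drop⁺ (length τ) flagₚ⊆roots)))
  ...   | τ′ , q = τ′ , lift-clique h flagₚ eq flagₚ-orthogonal
                      , trans (sym (Listₚ.length-map α (τ ++ τ′))) (cong length eq)
    where
    eq : map α (τ ++ τ′) ≡ map (actH h) flagₚ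
    eq = trans (Listₚ.map-++ α τ τ′) (trans (cong₂ _++_ (sym p) q)
      (trans (sym (Listₚ.map-++ (actH h) (take (length τ) flagₚ) _))
        (cong (map (actH h)) (Listₚ.take++drop≡id (length τ) flagₚ))))

  -- Each triangle of the 600-cell lies in two tetrahedra; in base position the last generator
  -- exchanges them and fixes `e₁`, `e₂`, `e₃`.
  second-completion : ∀ a b c d → Clique (a ∷ b ∷ c ∷ d ∷ []) →
                      ∃[ d′ ] Clique (a ∷ b ∷ c ∷ d′ ∷ []) × d ≢ d′
  second-completion a b c d ((ab ∷ ac ∷ ad ∷ []) ∷ (bc ∷ bd ∷ []) ∷ (cd ∷ []) ∷ _) =
    move (flag₄ a b c d ab ac bc ad bd cd)
    where
    move : ∃[ h ] actH h e₁ ≡ α a × actH h e₂ ≡ α b × actH h e₃ ≡ α c × actH h e₄ ≡ α d →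
           ∃[ d′ ] Clique (a ∷ b ∷ c ∷ d′ ∷ []) × d ≢ d′
    move (h , p , q , r , s) =
      let d′ , t = root-index (actH-closed h (roots-closed 3F e₄∈roots)) in
      d′ , lift-clique h (e₁ ∷ e₂ ∷ e₃ ∷ reflect 4F e₄ ∷ [])
             (cong₂ _∷_ (sym p) (cong₂ _∷_ (sym q) (cong₂ _∷_ (sym r) (cong₂ _∷_ t refl))))
             ((refl ∷ refl ∷ refl ∷ []) ∷ (refl ∷ refl ∷ []) ∷ (refl ∷ []) ∷ [] ∷ [])
         , λ e → case actH-injective h (trans s (trans (cong α e) t)) of λ ()

  -- The tetrahedron `σ` of the 600-cell is replaced by its neighbour across the triangle without
  -- `b`; reordering the clique puts `b` last.
  recomplete : ∀ {σ b} → Flag σ → b ∈ σ →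
               ∃[ σ′ ] Flag σ′ × (∀ {t} → t ∈ σ → t ≢ b → t ∈ σ′) × b ∉ σ′
  recomplete {a ∷ b ∷ c ∷ d ∷ []} (cl@((ab ∷ ac ∷ ad ∷ []) ∷ (bc ∷ bd ∷ []) ∷ (cd ∷ []) ∷ _) , _) m = cases m
    where
    Goal : Gen → Set
    Goal x = ∃[ σ′ ] Flag σ′ × (∀ {t} → t ∈ a ∷ b ∷ c ∷ d ∷ [] → t ≢ x → t ∈ σ′) × x ∉ σ′
    fresh : ∀ {x y z u u′} → Clique (x ∷ y ∷ z ∷ u ∷ []) → u ≢ u′ → u ∉ x ∷ y ∷ z ∷ u′ ∷ []
    fresh ((_ ∷ _ ∷ xu ∷ []) ∷ _) n (here refl) = ~⇒≢ xu refl
    fresh (_ ∷ (_ ∷ yu ∷ []) ∷ _) n (there (here refl)) = ~⇒≢ yu refl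
    fresh (_ ∷ _ ∷ (zu ∷ []) ∷ _) n (there (there (here refl))) = ~⇒≢ zu refl
    fresh _ n (there (there (there (here p)))) = n p
    pattern 1st = here refl
    pattern 2nd = there (here refl)
    pattern 3rd = there (there (here refl))
    pattern 4th = there (there (there (here refl)))
    cases : ∀ {x} → x ∈ a ∷ b ∷ c ∷ d ∷ [] → Goal x
    cases 4th = let d′ , k , n = second-completion a b c d cl in
      a ∷ b ∷ c ∷ d′ ∷ [] , (k , refl) ,
      (λ { 1st _ → 1st ; 2nd _ → 2nd ; 3rd _ → 3rd ; 4th n → ⊥-elim (n refl) }) , fresh cl n
    cases 3rd = let k₀ = (ab ∷ ad ∷ ac ∷ []) ∷ (bd ∷ bc ∷ []) ∷ (~-sym {c} {d} cd ∷ []) ∷ [] ∷ []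
                    c′ , k , n = second-completion a b d c k₀ in
      a ∷ b ∷ d ∷ c′ ∷ [] , (k , refl) ,
      (λ { 1st _ → 1st ; 2nd _ → 2nd ; 3rd n → ⊥-elim (n refl) ; 4th _ → 3rd }) , fresh k₀ n
    cases 2nd = let k₀ = (ac ∷ ad ∷ ab ∷ []) ∷ (cd ∷ ~-sym {b} {c} bc ∷ []) ∷ (~-sym {b} {d} bd ∷ []) ∷ [] ∷ []
                    b′ , k , n = second-completion a c d b k₀ in
      a ∷ c ∷ d ∷ b′ ∷ [] , (k , refl) ,
      (λ { 1st _ → 1st ; 2nd n → ⊥-elim (n refl) ; 3rd _ → 2nd ; 4th _ → 3rd }) , fresh k₀ n
    cases 1st = let k₀ = (bc ∷ bd ∷ ~-sym {a} {b} ab ∷ []) ∷ (cd ∷ ~-sym {a} {c} ac ∷ []) ∷ (~-sym {a} {d} ad ∷ []) ∷ [] ∷ []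
                    a′ , k , n = second-completion b c d a k₀ in
      b ∷ c ∷ d ∷ a′ ∷ [] , (k , refl) ,
      (λ { 1st n → ⊥-elim (n refl) ; 2nd _ → 1st ; 3rd _ → 2nd ; 4th _ → 3rd }) , fresh k₀ n

  actH-linear : ∀ h s x a → actH h (x -ᵥ s ·ᵥ a) ≡ actH h x -ᵥ s ·ᵥ actH h a
  actH-linear []      s x a = refl
  actH-linear (k ∷ h) s x a = trans (cong (reflect (suc k)) (actH-linear h s x a))
    (reflect-linear (suc k) s (actH h x) (actH h a))

  centreₚ : List Point → Point
  centreₚ []       = p₀
  centreₚ (a ∷ as) = centreₚ as -ᵥ 1φ ·ᵥ a

  actH-centreₚ : ∀ h xs → actH h (centreₚ xs) ≡ centreₚ (map (actH h) xs)
  actH-centreₚ h []       = actH-p₀ h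
  actH-centreₚ h (x ∷ xs) = trans (actH-linear h 1φ (centreₚ xs) x)
    (cong (_-ᵥ 1φ ·ᵥ actH h x) (actH-centreₚ h xs))

  centre-map : ∀ τ → centre τ ≡ centreₚ (map α τ)
  centre-map []      = refl
  centre-map (i ∷ τ) = cong (_-ᵥ 1φ ·ᵥ α i) (centre-map τ)

  baseCentre≡ : ∀ j → baseCentre j ≡ centreₚ (take (toℕ j) flagₚ)
  baseCentre≡ 0F = refl
  baseCentre≡ 1F = refl
  baseCentre≡ 2F = refl
  baseCentre≡ 3F = refl
  baseCentre≡ 4F = refl

  actH-baseCentre : ∀ h τ j → map α τ ≡ map (actH h) flagₚ → actH h (baseCentre j) ≡ centre (take (toℕ j) τ)
  actH-baseCentre h τ j p = begin
    actH h (baseCentre j)                       ≡⟨ cong (actH h) (baseCentre≡ j) ⟩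
    actH h (centreₚ (take (toℕ j) flagₚ))       ≡⟨ actH-centreₚ h (take (toℕ j) flagₚ) ⟩
    centreₚ (map (actH h) (take (toℕ j) flagₚ)) ≡⟨ cong centreₚ (Listₚ.take-map (toℕ j) flagₚ) ⟨
    centreₚ (take (toℕ j) (map (actH h) flagₚ)) ≡⟨ cong (λ x → centreₚ (take (toℕ j) x)) p ⟨
    centreₚ (take (toℕ j) (map α τ))            ≡⟨ cong centreₚ (Listₚ.take-map (toℕ j) τ) ⟩
    centreₚ (map α (take (toℕ j) τ))            ≡⟨ centre-map (take (toℕ j) τ) ⟨
    centre (take (toℕ j) τ)                     ∎
    where open ≡-Reasoning

  ρ-inverse : ∀ w x → ρ (inverse w) x ≡ L w x
  ρ-inverse []      x = refl
  ρ-inverse (t ∷ w) x = trans (ρ-++ (inverse w) (t ∷ []) x) (cong (mirror (α t)) (ρ-inverse w x))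

  reflect-L : ∀ k l → ∃[ l′ ] ∀ x → reflect (suc k) (L l x) ≡ L l′ (reflect (suc k) x)
  reflect-L k []      = [] , λ x → refl
  reflect-L k (t ∷ l) =
    let l′ , p = reflect-L k l ; t′ , q = root-index (roots-closed k (α∈roots t)) in
    t′ ∷ l′ , λ x → trans (reflect-mirror (suc k) (α t) (L l x)) (cong₂ mirror (sym q) (p x))

  -- Conjugation by H₄ permutes the mirrors (`reflect-L`), so the generators of H₄ can be gathered
  -- next to the point. The remaining generator is the mirror of `e₁`, so what stands in front is a
  -- product of mirrors.
  decompose : ∀ g → ∃[ w ] ∃[ h ] ∀ x → act g x ≡ ρ w (actH h x)
  decompose g = let l , h , p = go g in inverse l , h , λ x → trans (p x) (sym (ρ-inverse l (actH h x)))
    where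
    go : ∀ g → ∃[ l ] ∃[ h ] ∀ x → act g x ≡ L l (actH h x)
    go []      = [] , [] , λ x → refl
    go (zero ∷ g) = let l , h , p = go g ; t , q = root-index e₁∈roots in
      t ∷ l , h , λ x → trans (sym (mirror-e₁ (act g x))) (cong₂ mirror (sym q) (p x))
    go (suc k ∷ g) = let l , h , p = go g ; l′ , q = reflect-L k l in
      l′ , k ∷ h , λ x → trans (cong (reflect (suc k)) (p x)) (q (actH h x))

  ρ-symmetry : ∀ w → ∃[ g ] ∀ x → act g x ≡ ρ w x
  ρ-symmetry []      = [] , λ x → refl
  ρ-symmetry (t ∷ w) = let g , p = ρ-symmetry w ; k , q = mirror-symmetry t in
    g ++ k , λ x → trans (act-++ g k x) (trans (cong (act g) (q x)) (p (mirror (α t) x)))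

  inv : Symmetry → Symmetry
  inv []      = []
  inv (k ∷ g) = inv g ++ k ∷ []

  act-invˡ : ∀ g x → act (inv g) (act g x) ≡ x
  act-invˡ []      x = refl
  act-invˡ (k ∷ g) x = trans (act-++ (inv g) (k ∷ []) _)
    (trans (cong (act (inv g)) (reflect-involutive k (act g x))) (act-invˡ g x))

  act-invʳ : ∀ g x → act g (act (inv g) x) ≡ x
  act-invʳ []      x = refl
  act-invʳ (k ∷ g) x = trans (cong (λ y → reflect k (act g y)) (act-++ (inv g) (k ∷ []) x))
    (trans (cong (reflect k) (act-invʳ g _)) (reflect-involutive k x))

  act-injective : ∀ g {x y} → act g x ≡ act g y → x ≡ y
  act-injective g {x} {y} p = trans (sym (act-invˡ g x)) (trans (cong (act (inv g)) p) (act-invˡ g y))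

  -- g₀ moves the base flag to the given V₀ and C₀.  The face w τ is the one whose
  -- edges at the vertex w are the letters of τ.

  module Mosaic (g₀ : Symmetry) where

    opaque
      face : Word → List Gen → Point
      face w τ = act g₀ (ρ w (centre τ))

      face-≃ : ∀ {v w} τ → v ≃ w → face v τ ≡ face w τ
      face-≃ τ p = cong (act g₀) (ρ-≃ p (centre τ))

      face-absorb : ∀ {τ} → Clique τ → ∀ u w → (∀ {t} → t ∈ u → t ∈ τ) → face (u ++ w) τ ≡ face w τ
      face-absorb c u w f = cong (act g₀) (ρ-absorb c u w f)

      face-set : ∀ {τ τ′} → Clique τ → Clique τ′ → ∀ w →
                 (∀ {t} → t ∈ τ → t ∈ τ′) → (∀ {t} → t ∈ τ′ → t ∈ τ) → face w τ ≡ face w τ′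
      face-set c c′ w f g = cong (λ x → act g₀ (ρ w x)) (centre-set c c′ f g)

      -- The clique is recovered from the zero coordinates of the centre, and the word up to the
      -- subgroup that the clique generates.
      face-injective : ∀ {τ τ′ w w′} → Clique τ → Clique τ′ → face w τ ≡ face w′ τ′ →
        (∃[ u ] (∀ {t} → t ∈ u → t ∈ τ) × u ++ w ≃ w′) × (∀ {t} → t ∈ τ → t ∈ τ′) × (∀ {t} → t ∈ τ′ → t ∈ τ)
      face-injective {w = w} {w′} c c′ p =
        let u , q = ρ-centre c c′ w w′ (act-injective g₀ p) in
        u , same-set c c′ q , same-set c′ c (sym q)

      incident⇒ : ∀ {i j x y} → Incident i j x y →
        ∃[ w ] ∃[ τ ] Flag τ × x ≡ face w (take (toℕ i) τ) × y ≡ face w (take (toℕ j) τ)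
      incident⇒ {i} {j} (g , p , q) =
        -- Relative to the chosen base flag, the symmetry `g` becomes g₀⁻¹g; its word part gives the
        -- vertex and its H₄ part the flag at that vertex.
        let w , h , r = decompose (inv g₀ ++ g) ; τ , s = lift-flag h
            eq : ∀ k → act g (baseCentre k) ≡ act g₀ (ρ w (centre (take (toℕ k) τ)))
            eq k = trans (sym (act-invʳ g₀ _)) (cong (act g₀)
              (trans (sym (act-++ (inv g₀) g _)) (trans (r (baseCentre k)) (cong (ρ w) (actH-baseCentre h τ k s)))))
        in w , τ , (lift-clique h flagₚ s flagₚ-orthogonal
                   , trans (sym (Listₚ.length-map α τ)) (cong length s))
             , trans (sym p) (eq i) , trans (sym q) (eq j)

      incident⇐ : ∀ i j w τ → Flag τ → Incident i j (face w (take (toℕ i) τ)) (face w (take (toℕ j) τ))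
      incident⇐ i j w τ (c , n) =
        let h , p = clique-move τ c (ℕₚ.≤-reflexive n) ; g , q = ρ-symmetry w
            s : map α τ ≡ map (actH h) flagₚ
            s = trans (sym p) (cong (λ k → map (actH h) (take k flagₚ)) n)
            eq : ∀ k → act (g₀ ++ g ++ map suc h) (baseCentre k) ≡ act g₀ (ρ w (centre (take (toℕ k) τ)))
            eq k = trans (act-++ g₀ (g ++ map suc h) _) (cong (act g₀) (trans (act-++ g (map suc h) _)
              (trans (cong (act g) (trans (sym (actH≡act h _)) (actH-baseCentre h τ k s))) (q _))))
        in g₀ ++ g ++ map suc h , eq i , eq j

    base-flag : ∃[ σ ] Flag σ × face [] [] ≡ act g₀ (baseCentre 0F) × face [] σ ≡ act g₀ (baseCentre 4F)
    base-flag = let σ , p = lift-flag [] in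
      σ , (lift-clique [] flagₚ p flagₚ-orthogonal , trans (sym (Listₚ.length-map α σ)) (cong length p))
        , go σ p
      where
      opaque
        unfolding face
        go : ∀ σ → map α σ ≡ map (actH []) flagₚ → face [] [] ≡ act g₀ (baseCentre 0F) × face [] σ ≡ act g₀ (baseCentre 4F)
        go σ p = refl , cong (act g₀) (sym (trans (actH-baseCentre [] σ 4F p)
          (cong centre (trans (cong (λ n → take n σ) (sym n)) (Listₚ.take-all (length σ) σ ℕₚ.≤-refl)))))
          where
          n : length σ ≡ 4
          n = trans (sym (Listₚ.length-map α σ)) (cong length p)

-- Counting finite sets

module Counting where
  open import Data.List.Membership.Propositional.Properties using (∈-∃++)
  open import Data.List.Relation.Binary.Disjoint.Propositional using (Disjoint)
  open import Data.Nat.Base using (_+_)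
  open import Data.Nat.ListAction using (sum)
  open import Function.Base using (id)
  open import Function.Bundles using (mk⇔; Equivalence)
  open import Relation.Unary using (Decidable)

  open Equivalence using (to; from) public

  unique-⊆-length : ∀ {X : Set} {xs ys : List X} → Unique xs → (∀ {x} → x ∈ xs → x ∈ ys) → length xs ≤ length ys
  unique-⊆-length {xs = []} [] _ = z≤n
  unique-⊆-length {xs = x ∷ xs} (n ∷ u) f with ∈-∃++ (f (here refl))
  ... | as , bs , refl = subst (suc (length xs) ≤_) (sym eq) (s≤s (unique-⊆-length u g))
    where
    eq : length (as ++ x ∷ bs) ≡ suc (length (as ++ bs))
    eq = trans (Listₚ.length-++ as) (trans (ℕₚ.+-suc (length as) (length bs)) (cong suc (sym (Listₚ.length-++ as))))
    g : ∀ {y} → y ∈ xs → y ∈ as ++ bs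
    g m with ∈-++⁻ as (f (there m))
    ... | inj₁ k           = ∈-++⁺ˡ k
    ... | inj₂ (here refl) = ⊥-elim (All.lookup n m refl)
    ... | inj₂ (there k)   = ∈-++⁺ʳ as k

  module _ {X : Set} where

    count-≤ : ∀ {P Q : X → Set} {m n} → (∀ x → P x → Q x) → HasCount P m → HasCount Q n → m ≤ n
    count-≤ f (xs , u , p , refl) (ys , _ , q , refl) =
      unique-⊆-length u (λ {x} m → from (q x) (f x (to (p x) m)))

    count-cong : ∀ {P Q : X → Set} {m n} → (∀ x → P x → Q x) → (∀ x → Q x → P x) →
                 HasCount P m → HasCount Q n → m ≡ n
    count-cong f g a b = ℕₚ.≤-antisym (count-≤ f a b) (count-≤ g b a)

    count-unique : ∀ {P : X → Set} {m n} → HasCount P m → HasCount P n → m ≡ n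
    count-unique = count-cong (λ _ p → p) (λ _ p → p)

    count-⊥ : ∀ {P : X → Set} → (∀ x → ¬ P x) → HasCount P 0
    count-⊥ n = [] , [] , (λ x → mk⇔ (λ ()) (⊥-elim ∘ n x)) , refl

    count-list : ∀ {xs : List X} → Unique xs → HasCount (_∈ xs) (length xs)
    count-list u = _ , u , (λ x → mk⇔ id id) , refl

    count-filter : ∀ {P Q : X → Set} (Q? : Decidable Q) {n} (c : HasCount P n) →
                   HasCount (λ x → P x × Q x) (length (filter Q? (proj₁ c)))
    count-filter Q? (xs , u , p , _) = filter Q? xs , Uniqueₚ.filter⁺ Q? u ,
      (λ x → mk⇔ (λ m → let a , b = ∈-filter⁻ Q? m in to (p x) a , b)
                 (λ (a , b) → ∈-filter⁺ Q? (from (p x) a) b)) , refl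

  unique-map : ∀ {X Y : Set} (f : X → Y) {xs} → (∀ {x y} → x ∈ xs → y ∈ xs → f x ≡ f y → x ≡ y) →
               Unique xs → Unique (map f xs)
  unique-map f inj [] = []
  unique-map f {x ∷ xs} inj (n ∷ u) =
    Allₚ.map⁺ (All.tabulate (λ m e → All.lookup n m (inj (here refl) (there m) e)))
    ∷ unique-map f (λ a b → inj (there a) (there b)) u

  count-image : ∀ {X Y : Set} {P : X → Set} {Q : Y → Set} (f : X → Y) {n} →
                (∀ {x y} → P x → P y → f x ≡ f y → x ≡ y) →
                (∀ x → P x → Q (f x)) → (∀ y → Q y → ∃[ x ] P x × f x ≡ y) →
                HasCount P n → HasCount Q n
  count-image {Q = Q} f inj p q (xs , u , e , l) =
    map f xs , unique-map f (λ {x} {y} a b → inj (to (e x) a) (to (e y) b)) u ,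
    (λ y → mk⇔ (λ m → let x , k , r = ∈-map⁻ f m in subst Q (sym r) (p x (to (e x) k)))
               (λ k → let x , a , r = q y k in subst (_∈ map f xs) r (∈-map⁺ f (from (e x) a)))) ,
    trans (Listₚ.length-map f xs) l

  count-Σ : ∀ {X Y : Set} {P : X → Set} {R : X → Y → Set} {n} (k : X → ℕ) (c : HasCount P n) →
            (∀ x → P x → HasCount (R x) (k x)) →
            HasCount (λ ((x , y) : X × Y) → P x × R x y) (sum (map k (proj₁ c)))
  count-Σ {X} {Y} {P} {R} k (xs , u , e , _) r =
    let ys , v , f , l = go xs u (λ x m → r x (to (e x) m)) in
    ys , v , (λ (x , y) → mk⇔ (λ m → let a , b = to (f (x , y)) m in to (e x) a , b)
                              (λ (a , b) → from (f (x , y)) (from (e x) a , b))) , l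
    where
    go : ∀ xs → Unique xs → (∀ x → x ∈ xs → HasCount (R x) (k x)) →
         HasCount (λ ((x , y) : X × Y) → x ∈ xs × R x y) (sum (map k xs))
    go [] _ _ = [] , [] , (λ _ → mk⇔ (λ ()) (λ { (() , _) })) , refl
    go (x ∷ xs) (n ∷ u) r with r x (here refl) | go xs u (λ y m → r y (there m))
    ... | ys , v , f , l | zs , w , g , l′ = map (x ,_) ys ++ zs ,
      Uniqueₚ.++⁺ (Uniqueₚ.map⁺ (cong proj₂) v) w disjoint ,
      (λ (x′ , y) → mk⇔ (forward x′ y) (backward x′ y)) ,
      trans (Listₚ.length-++ (map (x ,_) ys)) (cong₂ _+_ (trans (Listₚ.length-map (x ,_) ys) l) l′)
      where
      disjoint : Disjoint (map (x ,_) ys) zs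
      disjoint (a , b) with ∈-map⁻ (x ,_) a
      ... | y , _ , refl = All.lookup n (proj₁ (to (g (x , y)) b)) refl
      forward : ∀ x′ y → (x′ , y) ∈ map (x ,_) ys ++ zs → x′ ∈ x ∷ xs × R x′ y
      forward x′ y m with ∈-++⁻ (map (x ,_) ys) m
      ... | inj₂ b = let c , d = to (g (x′ , y)) b in there c , d
      ... | inj₁ a with ∈-map⁻ (x ,_) a
      ...   | y′ , c , refl = here refl , to (f y′) c
      backward : ∀ x′ y → x′ ∈ x ∷ xs × R x′ y → (x′ , y) ∈ map (x ,_) ys ++ zs
      backward x′ y (here refl , b) = ∈-++⁺ˡ (∈-map⁺ (x ,_) (from (f y) b))
      backward x′ y (there a , b)   = ∈-++⁺ʳ (map (x ,_) ys) (from (g (x′ , y)) (a , b))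

  module _ {X : Set} {xs : List X} (u : Unique xs) (full : ∀ x → x ∈ xs) where

    count-words : ∀ n → ∃[ k ] HasCount (λ (w : List X) → length w ≡ n) k
    count-words zero = 1 , [] ∷ [] , [] ∷ [] , (λ { [] → mk⇔ (λ _ → refl) (λ _ → here refl)
                                               ; (x ∷ w) → mk⇔ (λ { (here ()) ; (there ()) }) (λ ()) }) , refl
    count-words (suc n) = let k , c = count-words n in _ ,
      count-image {P = λ (x , w) → x ∈ xs × length w ≡ n} (λ (x , w) → x ∷ w)
        (λ _ _ e → cong₂ _,_ (Listₚ.∷-injectiveˡ e) (Listₚ.∷-injectiveʳ e))
        (λ (x , w) (_ , p) → cong suc p)
        (λ { [] () ; (x ∷ w) p → (x , w) , (full x , ℕₚ.suc-injective p) , refl })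
        (count-Σ (λ _ → k) (count-list u) (λ _ _ → c))

  representatives : ∀ {X Y : Set} (_≟_ : (x y : Y) → Dec (x ≡ y)) (f : X → Y) {P : X → Set} {n} → HasCount P n →
    ∃[ xs ] Unique (map f xs) × (∀ {x} → x ∈ xs → P x) × (∀ x → P x → f x ∈ map f xs)
  representatives {X} {Y} _≟_ f {P} (xs , _ , e , _) =
    let ys , u , p , q = go xs in ys , u , (λ {x} m → to (e x) (p m)) , λ x a → q (from (e x) a)
    where
    open import Data.List.Membership.DecPropositional _≟_ using (_∈?_)
    go : ∀ xs → ∃[ ys ] Unique (map f ys) × (∀ {x} → x ∈ ys → x ∈ xs) × (∀ {x} → x ∈ xs → f x ∈ map f ys)
    go [] = [] , [] , (λ ()) , (λ ())
    go (x ∷ xs) with go xs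
    ... | ys , u , p , q with f x ∈? map f ys
    ...   | yes m = ys , u , there ∘ p , λ { (here refl) → m ; (there k) → q k }
    ...   | no n  = x ∷ ys , All.tabulate (λ { m refl → n m }) ∷ u ,
                    (λ { (here e) → here e ; (there m) → there (p m) }) ,
                    λ { (here refl) → here refl ; (there k) → there (q k) }

-- Distances and values in the graph of the mosaic

module VertexGraph where
  open GoldenIntegers using (_≟ₚ_)
  open Mirrors
  open Faces
  open Flags
  open Incidence
  open Counting
  open import Data.List.Base using (reverse; _ʳ++_)
  open import Data.List.Membership.Propositional.Properties using (∈-allFin)
  open import Data.Nat.Base using (_+_)

  cancel-inverse : ∀ w → w ++ inverse w ≃ []
  cancel-inverse []      = trace ≈-refl
  cancel-inverse (t ∷ w) = ≃-trans (≃-prep t (subst (_≃ t ∷ []) (Listₚ.++-assoc w (inverse w) (t ∷ []))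
    (≃-++ʳ (t ∷ []) (cancel-inverse w)))) (cancel t [])

  ≃-cancelʳ : ∀ u v w → u ++ w ≃ v ++ w → u ≃ v
  ≃-cancelʳ u v w p = ≃-trans (≃-sym (lemma u)) (≃-trans (≃-++ʳ (inverse w) p) (lemma v))
    where
    lemma : ∀ u → (u ++ w) ++ inverse w ≃ u
    lemma u = subst (_≃ u) (sym (Listₚ.++-assoc u w (inverse w)))
      (subst (u ++ w ++ inverse w ≃_) (Listₚ.++-identityʳ u) (≃-++ˡ u (cancel-inverse w)))

  -- After cancelling `w`, two one-letter reduced words are equal in the group, hence equal.
  letter-injective : ∀ {s t} w → s ∷ w ≃ t ∷ w → s ≡ t
  letter-injective {s} {t} w p = single (≈-desc (reduced-≈ (s ∷ []) (t ∷ []) ((λ ()) , tt) ((λ ()) , tt)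
    (≃-cancelʳ (s ∷ []) (t ∷ []) w p)) (here refl))
    where
    single : s ∈ t ∷ [] → s ≡ t
    single (here q) = q

  letter-moves : ∀ {t} w → ¬ t ∷ w ≃ w
  letter-moves {t} w p = case reduced-[] {t ∷ []} ((λ ()) , tt) (≃-cancelʳ (t ∷ []) [] w p) of λ ()

  clique-Red : ∀ w → Clique w → Red w
  clique-Red []      _       = tt
  clique-Red (t ∷ w) (a ∷ c) = (λ m → ~⇒≢ (All.lookup a (∈-desc⇒∈ w m)) refl) , clique-Red w c

  take-4 : ∀ {τ} → Flag τ → take 4 τ ≡ τ
  take-4 {τ} (_ , n) = trans (cong (λ k → take k τ) (sym n)) (Listₚ.take-all (length τ) τ ℕₚ.≤-refl)

  module Vertices (g₀ : Symmetry) where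
    open Mosaic g₀ public

    V : Word → Point
    V w = face w []

    V-injective : ∀ {v w} → V v ≡ V w → v ≃ w
    V-injective {v} {w} p with face-injective {w = v} {w} [] [] p
    ... | ([] , _ , q) , _    = q
    ... | (t ∷ u , f , _) , _ with f (here refl)
    ...   | ()

    V-reduce : ∀ w → V w ≡ V (Reduction.word (reduce w))
    V-reduce w = face-≃ [] (Reduction.equal (reduce w))

    V-≈ : ∀ {v w} → Red v → Red w → V v ≡ V w → v ≈ w
    V-≈ {v} {w} r r′ p = reduced-≈ v w r r′ (V-injective p)

    incident-01⇒ : ∀ {u e} → Incident 0F 1F u e → ∃[ w ] ∃[ t ] u ≡ V w × e ≡ face w (t ∷ [])
    incident-01⇒ {u} {e} i with incident⇒ {0F} {1F} {u} {e} i
    ... | w , t ∷ τ , _ , p , q = w , t , p , q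

    incident-01⇐ : ∀ w t → Incident 0F 1F (V w) (face w (t ∷ []))
    incident-01⇐ w t = let τ , f = extend-clique (t ∷ []) ([] ∷ []) in incident⇐ 0F 1F w (t ∷ τ) f

    incident-01⇐′ : ∀ w t → Incident 0F 1F (V (t ∷ w)) (face w (t ∷ []))
    incident-01⇐′ w t = subst (Incident 0F 1F (V (t ∷ w)))
      (face-absorb ([] ∷ []) (t ∷ []) w (λ m → m)) (incident-01⇐ (t ∷ w) t)

    private
      powers : ∀ {t} u w → (∀ {s} → s ∈ u → s ∈ t ∷ []) → u ++ w ≃ w ⊎ u ++ w ≃ t ∷ w
      powers []      w f = inj₁ (trace ≈-refl)
      powers {t} (s ∷ u) w f with f (here refl) | powers u w (f ∘ there)
      ... | here refl | inj₁ p = inj₂ (≃-prep t p)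
      ... | here refl | inj₂ p = inj₁ (≃-trans (≃-prep t p) (cancel t w))

    -- The subgroup generated by one letter has just two elements, so an edge has no ends besides
    -- `w` and `t ∷ w`.
    edge-ends : ∀ {w t v} → V w ≢ v → Incident 0F 1F v (face w (t ∷ [])) → v ≡ V (t ∷ w)
    edge-ends {w} {t} n i with incident-01⇒ i
    ... | w′ , t′ , refl , q with face-injective {w = w} {w′} ([] ∷ []) ([] ∷ []) q
    ...   | (u , f , p) , _ with powers u w f
    ...     | inj₁ k = ⊥-elim (n (face-≃ [] (≃-trans (≃-sym k) p)))
    ...     | inj₂ k = face-≃ [] (≃-trans (≃-sym p) k)

    adjacent⇒ : ∀ {w v} → Adjacent (V w) v → ∃[ t ] v ≡ V (t ∷ w)
    adjacent⇒ {w} (n , e , i , j) with incident-01⇒ i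
    ... | w′ , t , p , refl = t , trans (edge-ends (λ q → n (trans p q)) j) (face-≃ [] (≃-prep t (≃-sym (V-injective p))))

    V-moves : ∀ w t → V w ≢ V (t ∷ w)
    V-moves w t p = letter-moves w (≃-sym (V-injective p))

    adjacent⇐ : ∀ w t → Adjacent (V w) (V (t ∷ w))
    adjacent⇐ w t = V-moves w t , face w (t ∷ []) , incident-01⇐ w t , incident-01⇐′ w t

    -- Unlike words, l lists its letters in the order of the walk.

    path : Word → List Gen → List Point
    path w []      = []
    path w (t ∷ l) = V (t ∷ w) ∷ path (t ∷ w) l

    length-path : ∀ w l → length (path w l) ≡ length l
    length-path w []      = refl
    length-path w (t ∷ l) = cong suc (length-path (t ∷ w) l)

    path-++ : ∀ w k l → path w (k ++ l) ≡ path w k ++ path (k ʳ++ w) l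
    path-++ w []      l = refl
    path-++ w (t ∷ k) l = cong (V (t ∷ w) ∷_) (path-++ (t ∷ w) k l)

    path-injective : ∀ w k l → path w k ≡ path w l → k ≡ l
    path-injective w []      []      p = refl
    path-injective w (s ∷ k) (t ∷ l) p
      with letter-injective w (V-injective (Listₚ.∷-injectiveˡ p))
    ... | refl = cong (s ∷_) (path-injective (s ∷ w) k l (Listₚ.∷-injectiveʳ p))

    Steps : (R : Point → Point → Set) → Set
    Steps R = ∀ {w v} → R (V w) v → ∃[ t ] v ≡ V (t ∷ w)

    walk⇒ : ∀ {R} → Steps R → ∀ w {v p} → Walk R (V w) v p → ∃[ l ] p ≡ path w l × v ≡ V (l ʳ++ w)
    walk⇒ a w stop = [] , refl , refl
    walk⇒ {R} a w (step {w = x} {v} {p} r k) with a r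
    ... | t , refl with walk⇒ a (t ∷ w) k
    ...   | l , refl , q = t ∷ l , refl , q

    walk⇐ : ∀ w l → Walk Adjacent (V w) (V (l ʳ++ w)) (path w l)
    walk⇐ w []      = stop
    walk⇐ w (t ∷ l) = step (adjacent⇐ w t) (walk⇐ (t ∷ w) l)

    -- The walk spells a word for the vertex, reduction does not lengthen it, and reduced words for
    -- the same vertex have equal length. Leaving `R` open covers both the mosaic and the edges of
    -- the simplex.
    walk-length : ∀ {R} → Steps R → ∀ {w} → Red w → ∀ q → Walk R (V []) (V w) q → length w ≤ length q
    walk-length a {w} r q k with walk⇒ a [] k
    ... | l , refl , p =
      ℕₚ.≤-trans (ℕₚ.≤-reflexive (≈-length (V-≈ r R.reduced (trans p (V-reduce (l ʳ++ []))))))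
        (ℕₚ.≤-trans R.shorter (ℕₚ.≤-reflexive (trans (Listₚ.length-ʳ++ l)
          (trans (ℕₚ.+-identityʳ (length l)) (sym (length-path [] l))))))
      where module R = Reduction (reduce (l ʳ++ []))

    reverse-ʳ++ : ∀ (w : Word) → reverse w ʳ++ [] ≡ w
    reverse-ʳ++ w = Listₚ.reverse-involutive w

    geodesic : ∀ w → Red w → ShortestWalk Adjacent (V []) (V w) (path [] (reverse w))
    geodesic w r =
      subst (λ x → Walk Adjacent (V []) (V x) (path [] (reverse w))) (reverse-ʳ++ w) (walk⇐ [] (reverse w))
      , λ q k → subst (_≤ length q) (sym (trans (length-path [] (reverse w)) (Listₚ.length-reverse w)))
                      (walk-length adjacent⇒ r q k)

    distance-unique : ∀ {R : Point → Point → Set} {u v m n} → Distance R u v m → Distance R u v n → m ≡ n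
    distance-unique (p , (k , f) , refl) (q , (l , g) , refl) = ℕₚ.≤-antisym (f q l) (g p k)

    distance : ∀ w → Red w → Distance Adjacent (V []) (V w) (length w)
    distance w r = path [] (reverse w) , geodesic w r ,
      trans (length-path [] (reverse w)) (Listₚ.length-reverse w)

    shortest⇒ : ∀ {w p} → Red w → ShortestWalk Adjacent (V []) (V w) p →
                ∃[ l ] p ≡ path [] l × V w ≡ V (l ʳ++ []) × length l ≡ length w
    shortest⇒ {w} {p} r (k , f) with walk⇒ adjacent⇒ [] k
    ... | l , refl , q = l , refl , q ,
      trans (sym (length-path [] l)) (distance-unique (path [] l , (k , f) , refl) (distance w r))

    shortest⇐ : ∀ {w l} → Red w → V w ≡ V (l ʳ++ []) → length l ≡ length w →
                ShortestWalk Adjacent (V []) (V w) (path [] l)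
    shortest⇐ {w} {l} r p n = subst (λ x → Walk Adjacent (V []) x (path [] l)) (sym p) (walk⇐ [] l)
      , λ q k → subst (_≤ length q) (sym (trans (length-path [] l) n)) (walk-length adjacent⇒ r q k)

    gens-unique : Unique gens
    gens-unique = Uniqueₚ.allFin⁺ _

    gens-full : ∀ t → t ∈ gens
    gens-full t = ∈-allFin t

    -- A shortest walk is determined by the word it spells, so it suffices to filter the finitely
    -- many words of length `length w`.
    value : ∀ w → Red w → ∃[ k ] HasCount (ShortestWalk Adjacent (V []) (V w)) k
    value w r = _ , count-image (path []) (λ _ _ → path-injective [] _ _)
      (λ l (n , p) → shortest⇐ r (sym p) n)
      (λ p s → let l , e , q , n = shortest⇒ r s in l , (n , sym q) , sym e)
      (count-filter (λ l → V (l ʳ++ []) ≟ₚ V w) (proj₂ (count-words gens-unique gens-full (length w))))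

    -- Letters that are not yet descents are appended one by one; descents gained earlier survive
    -- because all these letters lie in one clique.
    climb : ∀ {σ} → Clique σ → ∀ ts → (∀ {t} → t ∈ ts → t ∈ σ) → ∀ w → Red w →
            ∃[ e ] Red (e ++ w) × (∀ {t} → t ∈ e → t ∈ σ) × (∀ {t} → t ∈ ts → t ∈ desc (e ++ w))
    climb c [] f w r = [] , r , (λ ()) , λ ()
    climb c (t ∷ ts) f w r with climb c ts (f ∘ there) w r
    ... | e , r′ , g , h with t ∈? desc (e ++ w)
    ...   | yes m = e , r′ , g , λ { (here refl) → m ; (there k) → h k }
    ...   | no n  = t ∷ e , (n , r′) , (λ { (here refl) → f (here refl) ; (there k) → g k })
                  , λ { (here refl) → here refl
                      ; (there k) → ∈-desc⁺ (e ++ w) (clique-~ c (f (here refl)) (f (there k)) (λ { refl → n (h k) })) (h k) }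

    walk-end : ∀ {R : Point → Point → Set} {u v v′ p} → Walk R u v p → Walk R u v′ p → v ≡ v′
    walk-end stop       stop       = refl
    walk-end (step _ k) (step _ l) = walk-end k l

    path-end : ∀ w k l → path w k ≡ path w l → V (k ʳ++ w) ≡ V (l ʳ++ w)
    path-end w k l p = walk-end (walk⇐ w k) (subst (Walk Adjacent (V w) (V (l ʳ++ w))) (sym p) (walk⇐ w l))

    private
      other : ∀ {σ} → Flag σ → ∀ t → ∃[ s ] s ∈ σ × s ≢ t
      other {a ∷ b ∷ _} ((ab ∷ _) ∷ _ , _) t with a ≟ t
      ... | yes refl = b , there (here refl) , λ p → ~⇒≢ ab (sym p)
      ... | no n     = a , here refl , n

    -- The vertex of a hypercube that has all incoming edges inside is reached from
    -- every shortest walk to another vertex of the hypercube, and by at least one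
    -- walk more.

    value-< : ∀ {σ w j k} e → Flag σ → Red w → Red (e ++ w) → (∀ {t} → t ∈ σ → t ∈ desc (e ++ w)) → e ≢ [] →
              HasCount (ShortestWalk Adjacent (V []) (V w)) j →
              HasCount (ShortestWalk Adjacent (V []) (V (e ++ w))) k → j < k
    value-< [] _ _ _ _ n _ _ = ⊥-elim (n refl)
    value-< {σ} {w} (t ∷ e) f r r′ top _ (xs , u , p , refl) (ys , _ , q , refl) =
      subst (_< length ys) (Listₚ.length-map lift xs) (unique-⊆-length {xs = extra ∷ map lift xs}
        (All.tabulate (λ {y} m eq → fresh y (∈-map⁻ lift m) eq)
          ∷ Uniqueₚ.map⁺ (Listₚ.++-cancelʳ (path w (reverse (t ∷ e))) _ _) u)
        (λ { (here refl) → from (q _) extra-shortest ; (there m) → included m }))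
      where
      z = t ∷ e ++ w
      lift : List Point → List Point
      lift x = x ++ path w (reverse (t ∷ e))
      -- Every lifted walk ends with the letter `t`. The top vertex also has another descent `s`,
      -- and `extra` is a shortest walk that ends with `s`.
      s = proj₁ (other f t)
      v = proj₁ (exchange z (top (proj₁ (proj₂ (other f t)))))
      z≈ : z ≈ s ∷ v
      z≈ = proj₂ (exchange z (top (proj₁ (proj₂ (other f t)))))
      extra : List Point
      extra = path [] (reverse (s ∷ v))
      extra-shortest : ShortestWalk Adjacent (V []) (V z) extra
      extra-shortest = subst (λ x → ShortestWalk Adjacent (V []) x extra) (face-≃ [] (trace (≈-sym z≈)))
        (geodesic (s ∷ v) (≈-Red z≈ r′))
      lift-path : ∀ l → V w ≡ V (l ʳ++ []) → lift (path [] l) ≡ path [] (l ++ reverse (t ∷ e))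
      lift-path l p = trans (cong (path [] l ++_) (same (reverse (t ∷ e)) (V-injective p)))
        (sym (path-++ [] l (reverse (t ∷ e))))
        where
        same : ∀ k {w w′} → w ≃ w′ → path w k ≡ path w′ k
        same []      p = refl
        same (a ∷ k) p = cong₂ _∷_ (face-≃ [] (≃-prep a p)) (same k (≃-prep a p))
      end : ∀ l (k : Word) → V w ≡ V (l ʳ++ []) → V (k ++ w) ≡ V ((l ++ reverse k) ʳ++ [])
      end l k p = trans (face-≃ [] (≃-++ˡ k (V-injective p))) (cong V (trans
        (sym (trans (Listₚ.ʳ++-defn (reverse k)) (cong (_++ l ʳ++ []) (Listₚ.reverse-involutive k))))
        (sym (Listₚ.++-ʳ++ l))))
      included : ∀ {y} → y ∈ map lift xs → y ∈ ys
      included m with ∈-map⁻ lift m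
      ... | x , k , refl with shortest⇒ r (to (p x) k)
      ...   | l , refl , eq , n = from (q _) (subst (ShortestWalk Adjacent (V []) (V z)) (sym (lift-path l eq))
        (shortest⇐ r′ (end l (t ∷ e) eq) (trans (Listₚ.length-++ l)
          (trans (cong₂ _+_ n (Listₚ.length-reverse (t ∷ e)))
            (trans (ℕₚ.+-comm (length w) (length (t ∷ e))) (sym (Listₚ.length-++ (t ∷ e))))))))
      fresh : ∀ y → (∃[ x ] x ∈ xs × y ≡ lift x) → extra ≢ y
      fresh y (x , k , refl) eq with shortest⇒ r (to (p x) k)
      ... | l , refl , eq′ , n = proj₂ (proj₂ (other f t)) (letter-injective v
        (≃-trans (trace (≈-sym z≈)) (≃-prep t (≃-sym (V-injective
          (trans (cong V (sym (reverse-ʳ++ v))) (trans (path-end [] (reverse v) (l ++ reverse e) lists) (sym (end l e eq′)))))))))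
        where
        letters : reverse v ++ s ∷ [] ≡ (l ++ reverse e) ++ t ∷ []
        letters = trans (sym (Listₚ.unfold-reverse s v)) (trans
          (path-injective [] (reverse (s ∷ v)) (l ++ reverse (t ∷ e)) (trans eq (lift-path l eq′)))
          (trans (cong (l ++_) (Listₚ.unfold-reverse t e)) (sym (Listₚ.++-assoc l (reverse e) (t ∷ [])))))
        lists : path [] (reverse v) ≡ path [] (l ++ reverse e)
        lists = cong (path []) (Listₚ.∷ʳ-injectiveˡ (reverse v) (l ++ reverse e) letters)

-- The hypercubes of the cone

module ConeCells where
  open Mirrors
  open Faces
  open Incidence
  open Counting
  open VertexGraph

  -- The position of the vertex w with respect to the direction a: out if w
  -- commutes with a, inn if w lies beyond the mirror of a in the cone, and bad if w
  -- lies outside the cone.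

  data Status : Set where
    out inn bad : Status

  _≟ₛ_ : (p q : Status) → Dec (p ≡ q)
  out ≟ₛ out = yes refl
  out ≟ₛ inn = no λ ()
  out ≟ₛ bad = no λ ()
  inn ≟ₛ out = no λ ()
  inn ≟ₛ inn = yes refl
  inn ≟ₛ bad = no λ ()
  bad ≟ₛ out = no λ ()
  bad ≟ₛ inn = no λ ()
  bad ≟ₛ bad = yes refl

  -- An automaton that reads a word from its first letter, at the end of the list. Both `inn` and
  -- `bad` are final: in a reduced word a first letter stays first whatever follows, and a letter
  -- that does not commute with `a` keeps any later `a` from reaching the front.
  δ : Gen → Gen → Status → Status
  δ a t inn = inn
  δ a t bad = bad
  δ a t out with a ≟ t | a ~? t
  ... | yes _ | _     = inn
  ... | no _  | yes _ = out
  ... | no _  | no _  = bad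

  status : Gen → Word → Status
  status a []      = out
  status a (t ∷ w) = δ a t (status a w)

  δ-self : ∀ a → δ a a out ≡ inn
  δ-self a with a ≟ a | a ~? a
  ... | yes _ | _ = refl
  ... | no n  | _ = ⊥-elim (n refl)

  δ-~ : ∀ {a t} → a ~ t → δ a t out ≡ out
  δ-~ {a} {t} p with a ≟ t | a ~? t
  ... | yes refl | _     = ⊥-elim (~-irrefl p)
  ... | no _     | yes _ = refl
  ... | no _     | no n  = ⊥-elim (n p)

  δ-out : ∀ a t q → δ a t q ≡ out → q ≡ out × a ~ t
  δ-out a t out p with a ≟ t | a ~? t
  δ-out a t out () | yes _ | _
  δ-out a t out p  | no _ | yes q = refl , q
  δ-out a t out () | no _ | no _
  δ-out a t inn ()
  δ-out a t bad ()

  δ-inn : ∀ a t → δ a t out ≡ inn → a ≡ t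
  δ-inn a t p with a ≟ t | a ~? t
  δ-inn a t p  | yes q | _     = q
  δ-inn a t () | no _  | yes _
  δ-inn a t () | no _  | no _

  δ-good : ∀ a t q → q ≢ bad → (q ≡ out → t ≡ a ⊎ t ~ a) → δ a t q ≢ bad
  δ-good a t bad n _ _ = n refl
  δ-good a t inn _ _ ()
  δ-good a t out _ f p with a ≟ t | a ~? t
  δ-good a t out _ f () | yes _ | _
  δ-good a t out _ f () | no _  | yes _
  δ-good a t out _ f p  | no n  | no m with f refl
  ... | inj₁ q = n (sym q)
  ... | inj₂ q = m (~-sym {t} {a} q)

  δ-good⁻ : ∀ a t → δ a t out ≢ bad → t ≡ a ⊎ t ~ a
  δ-good⁻ a t n with a ≟ t | a ~? t
  ... | yes p | _     = inj₁ (sym p)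
  ... | no _  | yes q = inj₂ (~-sym {a} {t} q)
  ... | no _  | no _  = ⊥-elim (n refl)

  δ-swap : ∀ a s t q → s ~ t → δ a s (δ a t q) ≡ δ a t (δ a s q)
  δ-swap a s t inn p = refl
  δ-swap a s t bad p = refl
  δ-swap a s t out p = by-cases (a ≟ s) (a ≟ t) (a ~? s) (a ~? t)
    where
    δ-bad : ∀ {t} → a ≢ t → ¬ a ~ t → δ a t out ≡ bad
    δ-bad {t} n m with a ≟ t | a ~? t
    ... | yes p | _     = ⊥-elim (n p)
    ... | no _  | yes q = ⊥-elim (m q)
    ... | no _  | no _  = refl
    by-cases : Dec (a ≡ s) → Dec (a ≡ t) → Dec (a ~ s) → Dec (a ~ t) →
               δ a s (δ a t out) ≡ δ a t (δ a s out)
    by-cases (yes refl) _ _ _ rewrite δ-~ p | δ-self a = refl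
    by-cases (no _) (yes refl) _ _ rewrite δ-~ (~-sym {s} {a} p) | δ-self a = refl
    by-cases (no _) (no _) (yes k) (yes l) rewrite δ-~ k | δ-~ l | δ-~ k = refl
    by-cases (no _) (no n) (yes k) (no l) rewrite δ-~ k | δ-bad n l = refl
    by-cases (no m) (no _) (no k) (yes l) rewrite δ-~ l | δ-bad m k = refl
    by-cases (no m) (no n) (no k) (no l) rewrite δ-bad n l | δ-bad m k = refl

  status-≈ : ∀ a {v w} → v ≈ w → status a v ≡ status a w
  status-≈ a ≈-refl        = refl
  status-≈ a (≈-trans p q) = trans (status-≈ a p) (status-≈ a q)
  status-≈ a (prep t p)    = cong (δ a t) (status-≈ a p)
  status-≈ a (swap {s} {t} w p) = δ-swap a s t (status a w) p

  status-out : ∀ a w → status a w ≡ out → All (a ~_) w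
  status-out a []      _ = []
  status-out a (t ∷ w) p = let q , r = δ-out a t (status a w) p in r ∷ status-out a w q

  out∉ : ∀ {a} w → status a w ≡ out → a ∉ w
  out∉ w p m = ~-irrefl (All.lookup (status-out _ w p) m)

  all-~⇒out : ∀ {a w} → All (a ~_) w → status a w ≡ out
  all-~⇒out []      = refl
  all-~⇒out {a} (_∷_ {t} p c) = trans (cong (δ a t) (all-~⇒out c)) (δ-~ p)

  status-++ : ∀ a v w → status a w ≡ out → status a (v ++ w) ≡ status a v
  status-++ a []      w p = p
  status-++ a (t ∷ v) w p = cong (δ a t) (status-++ a v w p)

  module Cone (g₀ : Symmetry) (σ₀ : List Gen) (σ₀-flag : Flag σ₀) where
    open Vertices g₀ public

    C₀ : Point
    C₀ = face [] σ₀

    open Simplex (V []) C₀ public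

    Good Inner : Word → Set
    Good w  = ∀ a → a ∈ σ₀ → status a w ≢ bad
    Inner w = ∀ a → a ∈ σ₀ → status a w ≡ inn

    missing : Word → List Gen
    missing w = filter (λ a → status a w ≟ₛ out) σ₀

    ∈-missing⁻ : ∀ {a} w → a ∈ missing w → a ∈ σ₀ × status a w ≡ out
    ∈-missing⁻ w = ∈-filter⁻ (λ a → status a w ≟ₛ out)

    ∈-missing⁺ : ∀ {a} w → a ∈ σ₀ → status a w ≡ out → a ∈ missing w
    ∈-missing⁺ w = ∈-filter⁺ (λ a → status a w ≟ₛ out)

    missing-clique : ∀ w → Clique (missing w)
    missing-clique w = AllPairsₚ.filter⁺ (λ a → status a w ≟ₛ out) (proj₁ σ₀-flag)

    missing-≈ : ∀ {v w} → v ≈ w → missing v ≡ missing w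
    missing-≈ {v} {w} p = go σ₀
      where
      go : ∀ xs → filter (λ a → status a v ≟ₛ out) xs ≡ filter (λ a → status a w ≟ₛ out) xs
      go xs = Listₚ.filter-≐ _ _ ((λ {a} q → trans (sym (status-≈ a p)) q) , (λ {a} q → trans (status-≈ a p) q)) xs

    good-≈ : ∀ {v w} → v ≈ w → Good v → Good w
    good-≈ p g a m q = g a m (trans (status-≈ a p) q)

    good-tail : ∀ {t w} → Good (t ∷ w) → Good w
    good-tail {t} g a m q = g a m (cong (δ a t) q)

    good-step : ∀ {t} w → Good w → (∀ {a} → a ∈ missing w → t ≡ a ⊎ t ~ a) → Good (t ∷ w)
    good-step {t} w g f a m = δ-good a t (status a w) (g a m) (f ∘ ∈-missing⁺ w m)

    good-step⁻ : ∀ {t} w → Good (t ∷ w) → ∀ {a} → a ∈ missing w → t ≡ a ⊎ t ~ a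
    good-step⁻ {t} w g {a} m = let k , p = ∈-missing⁻ w m in
      δ-good⁻ a t (λ q → g a k (trans (cong (δ a t) p) q))

    missing-tail : ∀ {t a} w → a ∈ missing (t ∷ w) → a ∈ missing w × a ~ t
    missing-tail {t} {a} w m = let k , p = ∈-missing⁻ (t ∷ w) m ; q , r = δ-out a t (status a w) p in
      ∈-missing⁺ w k q , r

    missing-step : ∀ {t a} w → a ∈ missing w → a ∈ missing (t ∷ w) ⊎ a ≡ t ⊎ ¬ a ~ t
    missing-step {t} {a} w m with a ~? t
    ... | no n  = inj₂ (inj₂ n)
    ... | yes p = let k , q = ∈-missing⁻ w m in inj₁ (∈-missing⁺ (t ∷ w) k (trans (cong (δ a t) q) (δ-~ p)))

    missing-~desc : ∀ {a t} w → a ∈ missing w → t ∈ desc w → a ~ t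
    missing-~desc w m k = All.lookup (status-out _ w (proj₂ (∈-missing⁻ w m))) (∈-desc⇒∈ w k)

    good-[] : Good []
    good-[] a m ()

    inner⇒good : ∀ w → Inner w → Good w
    inner⇒good w i a m p = case trans (sym (i a m)) p of λ ()

    -- Whether the hypercube face w σ belongs to the cone can be read off at each of
    -- its vertices.

    Covers : Word → List Gen → Set
    Covers w σ = Good w × (∀ {a} → a ∈ missing w → a ∈ σ)

    -- If `t` is appended, each missing direction lies in `σ`, hence equals `t` or commutes with it,
    -- and the word stays in the cone. If `t` is cancelled, only `t` itself can become missing, and
    -- it lies in `σ`.
    covers-step : ∀ {σ t w} → Clique σ → Red w → t ∈ σ → Covers w σ →
                  ∃[ y ] Red y × t ∷ w ≃ y × Covers y σ
    covers-step {σ} {t} {w} c r m (g , f) with append t w r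
    ... | inj₁ (_ , v , p , (_ , r′) , q) = v , r′ , q , good-tail {t} {v} (good-≈ p g) , missing-v
      where
      missing-v : ∀ {a} → a ∈ missing v → a ∈ σ
      missing-v {a} k with missing-step {t} v k
      ... | inj₁ l           = f (subst (a ∈_) (sym (missing-≈ p)) l)
      ... | inj₂ (inj₁ refl) = m
      ... | inj₂ (inj₂ n)    = case good-step⁻ v (good-≈ p g) k of λ
        { (inj₁ refl) → m ; (inj₂ l) → ⊥-elim (n (~-sym {t} {a} l)) }
    ... | inj₂ r′ = t ∷ w , r′ , trace ≈-refl , good-step w g near , f ∘ proj₁ ∘ missing-tail w
      where
      near : ∀ {a} → a ∈ missing w → t ≡ a ⊎ t ~ a
      near {a} k with t ≟ a
      ... | yes p = inj₁ p
      ... | no n  = inj₂ (clique-~ c m (f k) n)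

    covers-coset : ∀ {σ w v} u → Clique σ → Red w → Red v → (∀ {t} → t ∈ u → t ∈ σ) → u ++ w ≃ v →
                   Covers w σ → Covers v σ
    covers-coset {σ} {w} {v} u c r r′ f p k =
      let y , ry , q , g , h = go u f in
      let e = reduced-≈ y v ry r′ (≃-trans (≃-sym q) p) in
      good-≈ e g , λ {a} m → h (subst (a ∈_) (sym (missing-≈ e)) m)
      where
      go : ∀ u → (∀ {t} → t ∈ u → t ∈ σ) → ∃[ y ] Red y × u ++ w ≃ y × Covers y σ
      go []      f = w , r , trace ≈-refl , k
      go (t ∷ u) f = let y , ry , q , h = go u (f ∘ there)
                         z , rz , s , l = covers-step c ry (f (here refl)) h in
        z , rz , ≃-trans (≃-prep t q) s , l

    covers-set : ∀ {w σ τ} → (∀ {t} → t ∈ σ → t ∈ τ) → Covers w σ → Covers w τ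
    covers-set f (g , h) = g , f ∘ h

    -- Two words for the same face differ by letters of `τ`, hence of `σ`, and `covers-step` moves
    -- along each of them.
    covers-face : ∀ {w v τ τ′ σ} → Clique τ → Clique τ′ → face w τ ≡ face v τ′ → Red w → Red v →
                  Clique σ → (∀ {t} → t ∈ τ → t ∈ σ) → Covers w σ → Covers v σ
    covers-face c c′ p r r′ cσ f k =
      let (u , g , q) , _ = face-injective c c′ p in covers-coset u cσ r r′ (f ∘ g) q k

    InCone : Point → Set
    InCone y = ∃[ w ] ∃[ σ ] Red w × Flag σ × Covers w σ × y ≡ face w σ

    incident-04⇒ : ∀ {v cell} → Incident 0F 4F v cell →
                   ∃[ w ] ∃[ σ ] Red w × Flag σ × v ≡ V w × cell ≡ face w σ
    incident-04⇒ {v} {cell} i = let w , σ , f , p , q = incident⇒ {0F} {4F} {v} {cell} i in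
      R.word w , σ , R.reduced w , f , trans p (V-reduce w) ,
      trans q (trans (cong (face w) (take-4 f)) (face-≃ σ (R.equal w)))
      where module R w = Reduction (reduce w)

    incident-04⇐ : ∀ w {σ} → Flag σ → Incident 0F 4F (V w) (face w σ)
    incident-04⇐ w {σ} f = subst (λ τ → Incident 0F 4F (V w) (face w τ)) (take-4 f) (incident⇐ 0F 4F w σ f)

    -- Were some letter of `σ` not a descent, climbing would reach a vertex of the same hypercube
    -- with a larger value.
    largest⇒top : ∀ {w σ} → Red w → Flag σ → HasLargestValue (face w σ) (V w) → ∀ {t} → t ∈ σ → t ∈ desc w
    largest⇒top {w} {σ} r f (_ , k , hk , max) with climb (proj₁ f) σ (λ m → m) w r
    ... | [] , _ , _ , top = top
    ... | e@(_ ∷ _) , r′ , g , top =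
      let j , hj = value (e ++ w) r′ in
      ⊥-elim (ℕₚ.<⇒≱ (value-< e f r r′ top (λ ()) hk hj)
        (max (V (e ++ w)) j (subst (Incident 0F 4F (V (e ++ w))) (face-absorb (proj₁ f) e w g) (incident-04⇐ (e ++ w) f)) hj))

    -- A missing direction commutes with all letters of the word and so does not occur in it; but it
    -- lies in `σ`, whose letters are all descents here.
    covers-top : ∀ {w σ} → Covers w σ → (∀ {t} → t ∈ σ → t ∈ desc w) → Inner w
    covers-top {w} (g , f) top a m with status a w in eq
    ... | inn = refl
    ... | bad = ⊥-elim (g a m eq)
    ... | out = ⊥-elim (out∉ w eq (∈-desc⇒∈ w (top (f (∈-missing⁺ w m eq)))))

    inner-covers : ∀ w σ → Inner w → Covers w σ
    inner-covers w σ i = inner⇒good w i , λ {a} m → let k , p = ∈-missing⁻ w m in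
      case trans (sym p) (i a k) of λ ()

    inner-step : ∀ {w} t → Inner w → Inner (t ∷ w)
    inner-step t i a m = cong (δ a t) (i a m)

    HubWord : Point → Set
    HubWord v = ∃[ w ] Red w × Inner w × v ≡ V w

    leads-away⇒ : ∀ {w v} → Red w → LeadsAway (V w) v → ∃[ t ] t ∉ desc w × v ≡ V (t ∷ w)
    leads-away⇒ {w} {v} r (adj , m , dw , dv) with adjacent⇒ {w} {v} adj
    ... | t , refl with append t w r
    ...   | inj₂ (n , _) = t , n , refl
    -- A descent would bring `v` one step nearer to the apex instead of farther away.
    ...   | inj₁ (_ , u , p , (_ , r′) , q) =
      ⊥-elim (ℕₚ.<⇒≢ (ℕₚ.<-trans (ℕₚ.n<1+n (length u)) (ℕₚ.n<1+n (suc (length u))))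
        (trans (distance-unique (distance u r′) (subst (λ x → Distance Adjacent (V []) x (suc m)) (face-≃ [] q) dv))
          (cong suc (trans (distance-unique dw (distance w r)) (≈-length p)))))

    mutual

      InP⇒ : ∀ {y} → InP y → InCone y
      InP⇒ start = [] , σ₀ , tt , σ₀-flag , (good-[] , proj₁ ∘ ∈-missing⁻ []) , refl
      InP⇒ (around h i) with Hub⇒ h | incident-04⇒ i
      ... | w , r , inner , p | w′ , σ , r′ , f , q , refl =
        w′ , σ , r′ , f , covers-face [] [] (trans (sym p) q) r r′ (proj₁ f) (λ ()) (inner-covers w σ inner) , refl

      Hub⇒ : ∀ {v} → Hub v → HubWord v
      Hub⇒ (largest {v} {cell} c l@(i , _)) with InP⇒ c | incident-04⇒ {v} {cell} i
      ... | w , σ , r , f , k , p | w′ , τ , r′ , f′ , refl , refl =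
        let _ , g , g′ = face-injective (proj₁ f) (proj₁ f′) (sym p)
            k′ = covers-set {w′} g (covers-face (proj₁ f) (proj₁ f′) (sym p) r r′ (proj₁ f) (λ m → m) k)
        in w′ , r′ , covers-top {w′} k′ (largest⇒top r′ f′ l) , refl
      Hub⇒ (beyond {u} {v} h a) with Hub⇒ h
      ... | w , r , inner , refl with leads-away⇒ {w} {v} r a
      ...   | t , n , refl = t ∷ w , (n , r) , inner-step {w} t inner , refl

    σ₀-Red : Red σ₀
    σ₀-Red = clique-Red σ₀ (proj₁ σ₀-flag)

    private
      split-clique : ∀ ts w → Clique ts → (∀ {t} → t ∈ ts → t ∈ desc w) → ∃[ v ] w ≈ ts ++ v
      split-clique []       w _       f = w , ≈-refl
      split-clique (t ∷ ts) w (a ∷ c) f =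
        let v , p = exchange w (f (here refl))
            u , q = split-clique ts v c (λ {s} m → drop-t m v (∈-desc⁻ v (≈-desc p (f (there m)))))
        in u , ≈-trans p (prep t q)
        where
        drop-t : ∀ {s} → s ∈ ts → ∀ v → s ≡ t ⊎ (t ~ s × s ∈ desc v) → s ∈ desc v
        drop-t m v (inj₁ refl)    = ⊥-elim (~-irrefl (All.lookup a m))
        drop-t m v (inj₂ (_ , k)) = k

      repeated : ∀ ts {s z} → Clique ts → s ∈ ts → s ∈ desc z → ¬ Red (ts ++ z)
      repeated (a ∷ ts) {z = z} (p ∷ c) (here refl) k (n , _) = n (lift ts p)
        where
        lift : ∀ us → All (a ~_) us → a ∈ desc (us ++ z)
        lift []       _       = k
        lift (u ∷ us) (q ∷ b) = ∈-desc⁺ (us ++ z) (~-sym {a} {u} q) (lift us b)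
      repeated (a ∷ ts) (p ∷ c) (there m) k (_ , r) = repeated ts c m k r

    -- Splitting the descents `σ` off `w` leaves a word that again uses letters of `σ` only. Any
    -- such letter would repeat one of the clique and contradict reducedness.
    top-unique : ∀ {σ w} u → Clique σ → Red w → (∀ {t} → t ∈ σ → t ∈ desc w) →
                 (∀ {t} → t ∈ u → t ∈ σ) → w ≃ u → w ≈ σ
    top-unique {σ} {w} u c r top f p with split-clique σ w c top
    ... | [] , q = subst (w ≈_) (Listₚ.++-identityʳ σ) q
    ... | s ∷ z , q = ⊥-elim (repeated σ c (f (R.letters (≈-∈ w≈u (≈-∈ (≈-sym q) (∈-++⁺ʳ σ (here refl))))))
                                (here refl) (≈-Red q r))
      where
      module R = Reduction (reduce u)
      w≈u : w ≈ R.word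
      w≈u = reduced-≈ w R.word r R.reduced (≃-trans p R.equal)

    -- Every vertex of `C₀` climbs inside `C₀` to a vertex with all four descents. By `top-unique`
    -- this is `V σ₀`, and climbing never lowers the value.
    V₁-largest : HasLargestValue C₀ (V σ₀)
    V₁-largest = subst (Incident 0F 4F (V σ₀)) absorb (incident-04⇐ σ₀ σ₀-flag) ,
      let k , hk = value σ₀ σ₀-Red in k , hk , λ u j i hj → compare hk hj (incident-04⇒ {u} {C₀} i)
      where
      absorb : face σ₀ σ₀ ≡ C₀
      absorb = trans (cong (λ w → face w σ₀) (sym (Listₚ.++-identityʳ σ₀)))
        (face-absorb (proj₁ σ₀-flag) σ₀ [] (λ m → m))
      compare : ∀ {u j k} → Value (V σ₀) k → Value u j →
                (∃[ w ] ∃[ σ ] Red w × Flag σ × u ≡ V w × C₀ ≡ face w σ) → j ≤ k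
      compare {j = j} {k} hk hj (w , σ , r , f , refl , p) with climb (proj₁ f) σ (λ m → m) w r
                                                        | face-injective {w = []} {w} (proj₁ σ₀-flag) (proj₁ f) p
      ... | e , r′ , g , top | (u , h , q) , to₀ , from₀ = finish e refl
        where
        same : e ++ w ≈ σ₀
        same = top-unique (e ++ u) (proj₁ σ₀-flag) r′ (top ∘ to₀) letters
          (≃-++ˡ e (subst (w ≃_) (Listₚ.++-identityʳ u) (≃-sym q)))
          where
          letters : ∀ {t} → t ∈ e ++ u → t ∈ σ₀
          letters m with ∈-++⁻ e m
          ... | inj₁ l = from₀ (g l)
          ... | inj₂ l = h l
        hk′ : Value (V (e ++ w)) k
        hk′ = subst (λ x → Value x k) (face-≃ [] (trace (≈-sym same))) hk
        finish : ∀ e′ → e′ ≡ e → j ≤ k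
        finish [] refl = ℕₚ.≤-reflexive (count-unique hj hk′)
        finish (_ ∷ _) refl = ℕₚ.<⇒≤ (value-< e f r r′ top (λ ()) hj hk′)

    private
      extract : ∀ a w → status a w ≡ inn → ∃[ v ] w ≈ v ++ a ∷ []
      extract a (t ∷ w) p with status a w in eq
      ... | inn = let v , q = extract a w eq in t ∷ v , prep t q
      ... | out with δ-inn a t p
      ...   | refl = w , move w (status-out a w eq)
        where
        move : ∀ w → All (a ~_) w → a ∷ w ≈ w ++ a ∷ []
        move []      _       = ≈-refl
        move (s ∷ w) (p ∷ c) = ≈-trans (swap w p) (prep s (move w c))

      factor : ∀ ts w → Clique ts → (∀ {a} → a ∈ ts → status a w ≡ inn) → ∃[ v ] w ≈ v ++ ts
      factor []       w _       _ = w , subst (w ≈_) (sym (Listₚ.++-identityʳ w)) ≈-refl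
      factor (a ∷ ts) w (p ∷ c) f =
        let v , q = factor ts w c (f ∘ there)
            -- The letters of `ts` commute with `a`, so `a` has the same status in `v` as in the
            -- whole word.
            u , r = extract a v (trans (sym (status-++ a v ts (all-~⇒out p)))
                      (trans (sym (status-≈ a q)) (f (here refl))))
        in u , ≈-trans q (subst (v ++ ts ≈_) (Listₚ.++-assoc u (a ∷ []) ts) (≈-++ʳ ts r))

    -- With the four directions moved to the front, the word starts at the largest vertex of `C₀`,
    -- and each further letter leads away from a hub.
    Hub⇐ : ∀ w → Red w → Inner w → Hub (V w)
    Hub⇐ w r i = let v , p = factor σ₀ w (proj₁ σ₀-flag) (i _) in
      subst Hub (face-≃ [] (trace (≈-sym p))) (go v (≈-Red p r))
      where
      go : ∀ v → Red (v ++ σ₀) → Hub (V (v ++ σ₀))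
      go []      _       = largest start V₁-largest
      go (t ∷ v) (n , r) = beyond (go v r)
        (adjacent⇐ (v ++ σ₀) t , length (v ++ σ₀) , distance (v ++ σ₀) r , distance (t ∷ v ++ σ₀) (n , r))

    -- Climbing inside the hypercube reaches its top vertex, where no direction is missing any more;
    -- that vertex is a hub.
    InP⇐ : ∀ w σ → Red w → Flag σ → Covers w σ → InP (face w σ)
    InP⇐ w σ r f k =
      let e , r′ , g , top = climb (proj₁ f) σ (λ m → m) w r
          inner = covers-top {e ++ w} (covers-coset e (proj₁ f) r r′ g (trace ≈-refl) k) top
      in subst InP (face-absorb (proj₁ f) e w g) (around (Hub⇐ (e ++ w) r′ inner) (incident-04⇐ (e ++ w) f))

-- Levels, degrees and boundary faces of the cone

module ConeLevels where
  open Mirrors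
  open Flags
  open Incidence
  open Counting
  open VertexGraph
  open ConeCells
  import Data.Fin.Properties as Finₚ
  open import Data.Nat.Base using (_+_; _∸_)
  open import Function.Bundles using (mk⇔)
  open import Relation.Nullary.Decidable using (¬?)

  flag-unique : ∀ {σ} → Flag σ → Unique σ
  flag-unique (c , _) = clique-unique c

  flags-⊆ : ∀ {σ τ} → Flag σ → Flag τ → (∀ {t} → t ∈ σ → t ∈ τ) → ∀ {t} → t ∈ τ → t ∈ σ
  flags-⊆ {σ} {τ} f g h {t} m with t ∈? σ
  ... | yes k = k
  ... | no n  = ⊥-elim (ℕₚ.<-irrefl (trans (proj₂ f) (sym (proj₂ g)))
    (unique-⊆-length {xs = t ∷ σ} (All.tabulate (λ { k refl → n k }) ∷ flag-unique f)
      λ { (here refl) → m ; (there k) → h k }))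

  reorder : ∀ {σ τ} → Flag σ → Clique τ → (∀ {t} → t ∈ τ → t ∈ σ) →
            ∃[ υ ] Flag (τ ++ υ) × (∀ {t} → t ∈ τ ++ υ → t ∈ σ) × (∀ {t} → t ∈ σ → t ∈ τ ++ υ)
  reorder {σ} {τ} f c g = υ , (clique , length-υ) , to-σ , from-σ
    where
    new? = λ t → ¬? (t ∈? τ)
    υ = filter new? σ
    to-σ : ∀ {t} → t ∈ τ ++ υ → t ∈ σ
    to-σ m with ∈-++⁻ τ m
    ... | inj₁ k = g k
    ... | inj₂ k = proj₁ (∈-filter⁻ new? k)
    from-σ : ∀ {t} → t ∈ σ → t ∈ τ ++ υ
    from-σ {t} m with t ∈? τ
    ... | yes k = ∈-++⁺ˡ k
    ... | no n  = ∈-++⁺ʳ τ (∈-filter⁺ new? m n)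
    clique : Clique (τ ++ υ)
    clique = AllPairsₚ.++⁺ c (AllPairsₚ.filter⁺ new? (proj₁ f))
      (All.tabulate λ k → All.tabulate λ l → let m , n = ∈-filter⁻ new? {xs = σ} l in
        clique-~ (proj₁ f) (g k) m (λ { refl → n k }))
    length-υ : length (τ ++ υ) ≡ 4
    length-υ = trans (ℕₚ.≤-antisym (unique-⊆-length (clique-unique clique) to-σ)
      (unique-⊆-length (flag-unique f) from-σ)) (proj₂ f)

  missed : ∀ {σ ys : List Gen} → Unique σ → length ys < length σ → ∃[ b ] b ∈ σ × b ∉ ys
  missed {σ} {ys} u l with all? (_∈? ys) σ
  ... | yes a = ⊥-elim (ℕₚ.<⇒≱ l (unique-⊆-length u (All.lookup a)))
  ... | no n  = let b , m , k = find (Allₚ.¬All⇒Any¬ (_∈? ys) σ n) in b , m , k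
    where open import Data.List.Membership.Propositional using (find)

  take-length-++ : ∀ (xs ys : List Gen) → take (length xs) (xs ++ ys) ≡ xs
  take-length-++ []       ys = refl
  take-length-++ (x ∷ xs) ys = cong (x ∷_) (take-length-++ xs ys)

  take-⊆ : ∀ n (xs : List Gen) {t} → t ∈ take n xs → t ∈ xs
  take-⊆ n xs m = subst (_ ∈_) (Listₚ.take++drop≡id n xs) (∈-++⁺ˡ m)

  module Levels (g₀ : Symmetry) (σ₀ : List Gen) (σ₀-flag : Flag σ₀) where
    open Cone g₀ σ₀ σ₀-flag public

    missing-extend : ∀ w → ∃[ τ ] Flag (missing w ++ τ)
    missing-extend w = extend-clique (missing w) (missing-clique w)

    opaque
      vertex⇒ : ∀ {v} → Vertex v → ∃[ w ] Red w × Good w × v ≡ V w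
      vertex⇒ {v} (cell , c , i) =
        let w , σ , r , f , k , p = InP⇒ c
            w′ , σ′ , r′ , f′ , q , q′ = incident-04⇒ {v} {cell} i
        in w′ , r′ , proj₁ (covers-face (proj₁ f) (proj₁ f′) (trans (sym p) q′) r r′ (proj₁ f) (λ m → m) k) , q

    opaque
      vertex⇐ : ∀ w → Red w → Good w → Vertex (V w)
      vertex⇐ w r g = let τ , f = missing-extend w in
        face w (missing w ++ τ) , InP⇐ w _ r f (g , ∈-++⁺ˡ) , incident-04⇐ w f

    opaque
      incident-j4⇐ : ∀ {j w τ σ} → Clique τ → length τ ≡ toℕ j → Flag σ → (∀ {t} → t ∈ τ → t ∈ σ) →
                     Incident j 4F (face w τ) (face w σ)
      incident-j4⇐ {j} {w} {τ} {σ} c n f g with reorder f c g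
      ... | υ , f′ , to-σ , from-σ = subst₂ (Incident j 4F)
        (cong (face w) (trans (cong (λ k → take k (τ ++ υ)) (sym n)) (take-length-++ τ υ)))
        (trans (cong (face w) (take-4 f′)) (face-set (proj₁ f′) (proj₁ f) w to-σ from-σ))
        (incident⇐ j 4F w (τ ++ υ) f′)

    opaque
      incident-0j⇐ : ∀ {j w τ} → Clique τ → length τ ≡ toℕ j → Incident 0F j (V w) (face w τ)
      incident-0j⇐ {j} {w} {τ} c n = let υ , f = extend-clique τ c in
        subst (Incident 0F j (V w))
          (cong (face w) (trans (cong (λ k → take k (τ ++ υ)) (sym n)) (take-length-++ τ υ)))
          (incident⇐ 0F j w (τ ++ υ) f)

    opaque
      -- Rewrites each hypercube of the simplex around the face with `w` as its base vertex, so that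
      -- `Covers` can be read off there.
      cells-around : ∀ {j w τ cell} → Clique τ → Red w → InP cell → Incident j 4F (face w τ) cell →
                     ∃[ σ ] Flag σ × Covers w σ × (∀ {t} → t ∈ τ → t ∈ σ) × cell ≡ face w σ
      cells-around {j} {w} {τ} {cell} c r k i with InP⇒ k | incident⇒ {j} {4F} {face w τ} {cell} i
      ... | w₀ , σ₁ , r₀ , f₁ , cov , p | w₁ , σ , f , q , q′ =
        let q″ = trans q′ (trans (cong (face w₁) (take-4 f)) (face-≃ σ R.equal))
            x≡ = trans q (face-≃ _ R.equal)
            c′ = AllPairsₚ.take⁺ (toℕ j) (proj₁ f)
            cov₁ = covers-face (proj₁ f₁) (proj₁ f) (trans (sym p) q″) r₀ R.reduced (proj₁ f₁) (λ m → m) cov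
            (_ , _) , same = face-injective (proj₁ f₁) (proj₁ f) (trans (sym p) q″)
            cov₂ = covers-set {R.word} (proj₁ same) cov₁
            cov₃ = covers-face c′ c (sym x≡) R.reduced r (proj₁ f) (take-⊆ (toℕ j) σ) cov₂
            (u , g , e) , to-τ , from-τ = face-injective c′ c (sym x≡)
        in σ , f , cov₃ , take-⊆ (toℕ j) σ ∘ from-τ ,
           trans q″ (trans (sym (face-absorb (proj₁ f) u R.word (take-⊆ (toℕ j) σ ∘ g))) (face-≃ σ e))
        where module R = Reduction (reduce w₁)

    -- The condition for the edge `t` at `w` to belong to the simplex: `t` and the missing
    -- directions must fit into one flag, whose hypercube then lies in the cone.
    Near : Word → Gen → Set
    Near w t = ∀ {a} → a ∈ missing w → t ≡ a ⊎ t ~ a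

    opaque
      edge⇒ : ∀ {w v} → Red w → Edge (V w) v → ∃[ t ] v ≡ V (t ∷ w) × Near w t
      edge⇒ {w} {v} r (n , e , i , j , cell , c , k) = step₁ (incident-01⇒ i)
        where
        Goal : Set
        Goal = ∃[ t ] v ≡ V (t ∷ w) × Near w t
        step₂ : ∀ {w′ t} → V w ≡ V w′ → e ≡ face w′ (t ∷ []) →
                ∃[ σ ] Flag σ × Covers w σ × (∀ {s} → s ∈ t ∷ [] → s ∈ σ) × cell ≡ face w σ → Goal
        step₂ {w′} {t} p refl (σ , f , (_ , cov) , g , _) =
          t , trans (edge-ends (λ q → n (trans p q)) j) (face-≃ [] (≃-prep t (≃-sym (V-injective p)))) , near
          where
          near : Near w t
          near {a} m with t ≟ a
          ... | yes q = inj₁ q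
          ... | no q  = inj₂ (clique-~ (proj₁ f) (g (here refl)) (cov m) (λ x → q x))
        step₁ : ∃[ w′ ] ∃[ t ] V w ≡ V w′ × e ≡ face w′ (t ∷ []) → Goal
        step₁ (w′ , t , p , q) = step₂ {w′} {t} p q (cells-around {1F} {w} {t ∷ []} {cell} ([] ∷ []) r c
          (subst (λ x → Incident 1F 4F x cell) (trans q (face-≃ (t ∷ []) (≃-sym (V-injective p)))) k))

    opaque
      star-flag : ∀ {w t} → Near w t → ∃[ σ ] Flag σ × t ∈ σ × (∀ {a} → a ∈ missing w → a ∈ σ)
      star-flag {w} {t} near = finish (extend-clique κ κ-clique)
        where
        other? : ∀ a → Dec (¬ t ≡ a)
        other? a = ¬? (t ≟ a)
        κ : List Gen
        κ = t ∷ filter other? (missing w)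
        κ-clique : Clique κ
        κ-clique = All.tabulate (λ m → let k , n = ∈-filter⁻ other? {xs = missing w} m in
                     case near k of λ { (inj₁ p) → ⊥-elim (n p) ; (inj₂ p) → p })
                 ∷ AllPairsₚ.filter⁺ other? (missing-clique w)
        covered : ∀ {a} υ → a ∈ missing w → a ∈ κ ++ υ
        covered {a} υ m with t ≟ a
        ... | yes refl = here refl
        ... | no n     = ∈-++⁺ˡ (there (∈-filter⁺ other? m (λ p → n p)))
        finish : ∃[ υ ] Flag (κ ++ υ) → ∃[ σ ] Flag σ × t ∈ σ × (∀ {a} → a ∈ missing w → a ∈ σ)
        finish (υ , f) = κ ++ υ , f , here refl , covered υ

    opaque
      edge⇐ : ∀ {w t} → Red w → Good w → Near w t → Edge (V w) (V (t ∷ w))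
      edge⇐ {w} {t} r g near = finish (star-flag {w} {t} near)
        where
        finish : ∃[ σ ] Flag σ × t ∈ σ × (∀ {a} → a ∈ missing w → a ∈ σ) → Edge (V w) (V (t ∷ w))
        finish (σ , f , m , c) = V-moves w t , face w (t ∷ []) , incident-01⇐ w t , incident-01⇐′ w t ,
          face w σ , InP⇐ w σ r f (g , c) , incident-j4⇐ ([] ∷ []) refl f (λ { (here refl) → m })

    edge-sym : ∀ {u v} → Edge u v → Edge v u
    edge-sym (n , e , i , j , k) = n ∘ sym , e , j , i , k

    edge-steps : Steps Edge
    edge-steps {w} {v} (n , e , i , j , _) = adjacent⇒ {w} {v} (n , e , i , j)

    walk-snoc : ∀ {R : Point → Point → Set} {u v x p} → Walk R u v p → R v x → Walk R u x (p ++ x ∷ [])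
    walk-snoc stop       r = step r stop
    walk-snoc (step s k) r = step s (walk-snoc k r)

    -- Removing last letters never leaves the cone, so a geodesic of the mosaic stays in the simplex
    -- and the two distances from the apex agree.
    edge-walk : ∀ w → Red w → Good w → ∃[ p ] Walk Edge (V []) (V w) p × length p ≡ length w
    edge-walk []      _       _ = [] , stop , refl
    edge-walk (t ∷ w) (_ , r) g =
      let g′ = good-tail {t} {w} g ; p , k , n = edge-walk w r g′ in
      p ++ V (t ∷ w) ∷ [] , walk-snoc k (edge⇐ r g′ (good-step⁻ w g)) ,
      trans (Listₚ.length-++ p) (trans (ℕₚ.+-comm (length p) 1) (cong suc n))

    edge-distance : ∀ w → Red w → Good w → Distance Edge (V []) (V w) (length w)
    edge-distance w r g = let p , k , n = edge-walk w r g in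
      p , (k , λ q l → subst (_≤ length q) (sym n) (walk-length edge-steps r q l)) , n

    onlevel⇐ : ∀ w → Red w → Good w → OnLevel (length w) (V w)
    onlevel⇐ w r g = vertex⇐ w r g , edge-distance w r g

    opaque
      onlevel⇒ : ∀ {n v} → OnLevel n v → ∃[ w ] Red w × Good w × v ≡ V w × length w ≡ n
      onlevel⇒ (x , d) with vertex⇒ x
      ... | w , r , g , refl = w , r , g , refl , distance-unique (edge-distance w r g) d

    opaque
      degree : ∀ w → Red w → Good w → Degree (V w) (length (Γ-ascents.ascents gens (missing w) []))
      degree w r g = subst (Degree (V w)) (sym (Listₚ.length-map _ (filter (Γ-ascents.allowed? (missing w) []) gens)))
        (count-image (λ t → V (t ∷ w)) (λ _ _ p → letter-injective w (V-injective p))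
          (λ t (_ , (_ , a)) → edge⇐ r g (All.lookup a))
          (λ v e → let t , p , near = edge⇒ {w} {v} r e in t , (gens-full t , (λ ()) , All.tabulate near) , sym p)
          (count-filter (Γ-ascents.allowed? (missing w) []) (count-list gens-unique)))

    opaque
      down : ∀ {w t} → Red w → Good w → t ∈ desc w →
             ∃[ v ] w ≈ t ∷ v × Red v × Good v × V (t ∷ w) ≡ V v × t ∉ desc v
      down {w} {t} r g m = let v , p = exchange w m ; n , r′ = ≈-Red p r in
        v , p , r′ , good-tail {t} {v} (good-≈ p g) , face-≃ [] (≃-trans (≃-prep t (trace p)) (cancel t v)) , n

    opaque
      incoming⇐ : ∀ {w t} → Red w → Good w → t ∈ desc w → Incoming (V w) (V (t ∷ w))
      incoming⇐ {w} {t} r g m with down r g m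
      ... | v , p , r′ , g′ , q , _ =
        edge-sym (edge⇐ r g (λ {a} k → inj₂ (~-sym {a} {t} (missing-~desc w k m)))) , length v ,
        subst (OnLevel (length v)) (sym q) (onlevel⇐ v r′ g′) ,
        subst (λ n → OnLevel n (V w)) (≈-length p) (onlevel⇐ w r g)

    level-unique : ∀ {w n} → Red w → Good w → OnLevel n (V w) → length w ≡ n
    level-unique r g (_ , d) = distance-unique (edge-distance _ r g) d

    opaque
      incoming⇒ : ∀ {w u} → Red w → Good w → Incoming (V w) u → ∃[ t ] t ∈ desc w × u ≡ V (t ∷ w)
      incoming⇒ {w} {u} r g (e , m , lu , lv) with edge⇒ {w} {u} r (edge-sym {u} e)
      ... | t , refl , near with t ∈? desc w
      ...   | yes k = t , k , refl
      ...   | no n  = ⊥-elim (ℕₚ.<⇒≢ (ℕₚ.<-trans (ℕₚ.n<1+n m) (ℕₚ.n<1+n (suc m)))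
        (sym (trans (cong suc (sym (level-unique r g lv)))
          (level-unique {t ∷ w} (n , r) (good-step {t} w g near) lu))))

    opaque
      indegree : ∀ w → Red w → Good w → Indegree (V w) (length (desc w))
      indegree w r g = count-image (λ t → V (t ∷ w)) (λ _ _ p → letter-injective w (V-injective p))
        (λ t m → incoming⇐ r g m)
        (λ u i → let t , m , p = incoming⇒ {w} {u} r g i in t , m , sym p)
        (count-list (clique-unique (desc-clique w)))

    opaque
      -- Omitting `4 - j` missing directions from a flag leaves a face with `j` edges. A hypercube
      -- of the simplex at `w` must contain all missing directions, so only that of the flag
      -- surrounds this face.
      onface⇐ : ∀ j {w} → Red w → Good w → 4 ≤ toℕ j + length (missing w) → OnFace j (V w)
      onface⇐ j {w} r g le = face w τ , incident-0j⇐ τ-clique τ-length ,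
        face w σ ∷ [] , [] ∷ [] ,
        (λ cell → mk⇔ (λ { (here refl) → InP⇐ w σ r f (g , ∈-++⁺ˡ) , incident-j4⇐ τ-clique τ-length f τ⊆σ })
                      (λ (c , i) → here (unique-cell cell c i))) , refl
        where
        k : ℕ
        -- The flag `σ` starts with the missing directions, of which there are at least `k`; so only
        -- missing directions are dropped.
        k = 4 ∸ toℕ j
        ms υ σ τ : List Gen
        ms = missing w
        υ = proj₁ (missing-extend w)
        σ = ms ++ υ
        τ = drop k σ
        f : Flag σ
        f = proj₂ (missing-extend w)
        τ-clique : Clique τ
        τ-clique = AllPairsₚ.drop⁺ k (proj₁ f)
        τ-length : length τ ≡ toℕ j
        τ-length = trans (Listₚ.length-drop k σ) (trans (cong (_∸ k) (proj₂ f))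
          (ℕₚ.m∸[m∸n]≡n (ℕₚ.≤-pred (Finₚ.toℕ<n j))))
        τ⊆σ : ∀ {t} → t ∈ τ → t ∈ σ
        τ⊆σ m = subst (_ ∈_) (Listₚ.take++drop≡id k σ) (∈-++⁺ʳ (take k σ) m)
        prefix : ∀ k (xs ys : List Gen) → k ≤ length xs → ∀ {t} → t ∈ take k (xs ++ ys) → t ∈ xs
        prefix (suc k) (x ∷ xs) ys (s≤s l) (here p)  = here p
        prefix (suc k) (x ∷ xs) ys (s≤s l) (there m) = there (prefix k xs ys l m)
        unique-cell : ∀ cell → InP cell → Incident j 4F (face w τ) cell → cell ≡ face w σ
        unique-cell cell c i with cells-around {j} {w} {τ} {cell} τ-clique r c i
        ... | σ₁ , f₁ , (_ , cov) , h , p = trans p (face-set (proj₁ f₁) (proj₁ f) w (flags-⊆ f f₁ σ⊆σ₁) σ⊆σ₁)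
          where
          σ⊆σ₁ : ∀ {t} → t ∈ σ → t ∈ σ₁
          σ⊆σ₁ m with ∈-++⁻ (take k σ) (subst (_ ∈_) (sym (Listₚ.take++drop≡id k σ)) m)
          ... | inj₁ l = cov (prefix k ms υ (ℕₚ.m≤n+o⇒m∸n≤o 4 (toℕ j) le) l)
          ... | inj₂ l = h l

    opaque
      -- Otherwise some letter `b` of the hypercube is neither in the face nor missing, and
      -- exchanging it by `recomplete` gives a second hypercube of the simplex around the same face.
      onface⇒ : ∀ j {w} → Red w → Good w → OnFace j (V w) → 4 ≤ toℕ j + length (missing w)
      onface⇒ j {w} r g (x , i , cells) with incident⇒ {0F} {j} {V w} {x} i
      ... | w₀ , σ′ , f′ , p , refl = ℕₚ.≮⇒≥ λ lt → absurd lt cells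
        where
        τ : List Gen
        τ = take (toℕ j) σ′
        τ-clique : Clique τ
        τ-clique = AllPairsₚ.take⁺ (toℕ j) (proj₁ f′)
        τ-length : length τ ≡ toℕ j
        τ-length = trans (Listₚ.length-take (toℕ j) σ′) (ℕₚ.m≤n⇒m⊓n≡m
          (subst (toℕ j ≤_) (sym (proj₂ f′)) (ℕₚ.≤-pred (Finₚ.toℕ<n j))))
        x≡ : face w₀ τ ≡ face w τ
        x≡ = face-≃ τ (≃-sym (V-injective p))
        two : ∀ {a b : Point} {xs} → length xs ≡ 1 → a ∈ xs → b ∈ xs → a ≡ b
        two {xs = _ ∷ []} _ (here refl) (here refl) = refl
        absurd : toℕ j + length (missing w) < 4 →
                 HasCount (λ cell → InP cell × Incident j 4F (face w₀ τ) cell) 1 → ⊥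
        absurd lt ([] , _ , _ , ())
        absurd lt (cell ∷ rest , _ , e , n) with to (e cell) (here refl)
        ... | c , i′ with cells-around {j} {w} {τ} {cell} τ-clique r c (subst (λ y → Incident j 4F y cell) x≡ i′)
        ...   | σ , f , (_ , cov) , h , refl with missed {σ} {τ ++ missing w} (flag-unique f)
                  (subst₂ _<_ (sym (trans (Listₚ.length-++ τ) (cong (_+ length (missing w)) τ-length))) (sym (proj₂ f)) lt)
        ...     | b , mb , nb with recomplete f mb
        ...       | σ₂ , f₂ , keep , nb₂ = nb₂ (proj₁ (proj₂ (face-injective (proj₁ f) (proj₁ f₂)
                    (two n (here refl) (from (e (face w σ₂))
                      (InP⇐ w σ₂ r f₂ (g , λ m → keep (cov m) (λ { refl → nb (∈-++⁺ʳ τ m) })) ,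
                       subst (λ y → Incident j 4F y (face w σ₂)) (sym x≡)
                         (incident-j4⇐ τ-clique τ-length f₂ (λ m → keep (h m) (λ { refl → nb (∈-++⁺ˡ m) })))))))) mb)

-- Vertex types as states, and the double count of edges

module ConeCounts where
  open GoldenIntegers using (_≟ₚ_)
  open RootOrbit using (roots)
  open Mirrors
  open Flags
  open Incidence
  open Counting
  open VertexGraph
  open ConeCells
  open ConeLevels
  import Data.List.Membership.DecPropositional as DecMembership
  open import Data.List.Relation.Unary.AllPairs using (allPairs?)
  open import Data.Nat.Base using (_+_; _*_)
  open import Data.Nat.ListAction using (sum)
  import Data.Product.Properties as Productₚ
  open import Function.Bundles using (mk⇔)
  open import Relation.Nullary.Decidable using (¬?; _×-dec_; toWitness)
  open import Relation.Unary using (Decidable)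

  -- (m , d) stands for m missing directions and d descents: the vertex lies in the
  -- interior of a (4 - m)-dimensional face of the cone and has d incoming edges.

  State : Set
  State = ℕ × ℕ

  _≟ˢ_ : (c d : State) → Dec (c ≡ d)
  _≟ˢ_ = Productₚ.≡-dec ℕₚ._≟_ ℕₚ._≟_

  kind : VertexType → State
  kind A = 2 , 2
  kind B = 2 , 1
  kind C = 1 , 3
  kind D = 1 , 2
  kind E = 1 , 1
  kind F = 0 , 4
  kind G = 0 , 3
  kind H = 0 , 2
  kind K = 0 , 1

  step-count : State → State → ℕ
  step-count (m , d) c = count c (P-ascents.ascents roots (take m flagₚ) (take d (drop m flagₚ)))

  filter-filter : ∀ {X : Set} {P Q R : X → Set} (P? : Decidable P) (Q? : Decidable Q) (R? : Decidable R) xs →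
                  (∀ {x} → x ∈ xs → P x → Q x × R x) → (∀ {x} → x ∈ xs → Q x → R x → P x) →
                  filter P? xs ≡ filter Q? (filter R? xs)
  filter-filter P? Q? R? [] f g = refl
  filter-filter P? Q? R? (x ∷ xs) f g with R? x
  ... | no n with P? x
  ...   | yes p = ⊥-elim (n (proj₂ (f (here refl) p)))
  ...   | no _  = filter-filter P? Q? R? xs (f ∘ there) (g ∘ there)
  filter-filter P? Q? R? (x ∷ xs) f g | yes r with P? x | Q? x
  ... | yes p | yes q = cong (x ∷_) (filter-filter P? Q? R? xs (f ∘ there) (g ∘ there))
  ... | yes p | no n  = ⊥-elim (n (proj₁ (f (here refl) p)))
  ... | no n  | yes q = ⊥-elim (n (g (here refl) q r))
  ... | no _  | no _  = filter-filter P? Q? R? xs (f ∘ there) (g ∘ there)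

  sum-const : ∀ {X : Set} (k : ℕ) (xs : List X) → sum (map (λ _ → k) xs) ≡ length xs * k
  sum-const k []       = refl
  sum-const k (x ∷ xs) = cong (k +_) (sum-const k xs)

  sum-classes : ∀ {X : Set} (f : X → State) (k : State → ℕ) (xs : List X) {cs} → Unique cs →
                (∀ {x} → x ∈ xs → f x ∈ cs) →
                sum (map (k ∘ f) xs) ≡ sum (map (λ c → length (filter (λ x → f x ≟ˢ c) xs) * k c) cs)
  sum-classes f k [] {cs} u g = sym (trans (sum-const 0 cs) (ℕₚ.*-zeroʳ (length cs)))
  sum-classes {X} f k (x ∷ xs) {cs} u g = trans (cong (k (f x) +_) (sum-classes f k xs u (g ∘ there)))
    (insert cs u (g (here refl)))
    where
    size : List X → State → ℕ
    size ys c = length (filter (λ x → f x ≟ˢ c) ys)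
    size-≡ : ∀ c → f x ≡ c → size (x ∷ xs) c ≡ suc (size xs c)
    size-≡ c p with f x ≟ˢ c
    ... | yes _ = refl
    ... | no n  = ⊥-elim (n p)
    size-≢ : ∀ c → f x ≢ c → size (x ∷ xs) c ≡ size xs c
    size-≢ c n with f x ≟ˢ c
    ... | yes p = ⊥-elim (n p)
    ... | no _  = refl
    term : List X → State → ℕ
    term ys c = size ys c * k c
    same : ∀ cs → All (f x ≢_) cs → sum (map (term xs) cs) ≡ sum (map (term (x ∷ xs)) cs)
    same []       _       = refl
    same (c ∷ cs) (n ∷ a) = cong₂ _+_ (cong (_* k c) (sym (size-≢ c n))) (same cs a)
    insert : ∀ cs → Unique cs → f x ∈ cs → k (f x) + sum (map (term xs) cs) ≡ sum (map (term (x ∷ xs)) cs)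
    insert (c ∷ cs) (n ∷ u) (here refl) = trans (sym (ℕₚ.+-assoc (k (f x)) _ _))
      (cong₂ _+_ (cong (_* k (f x)) (sym (size-≡ (f x) refl))) (same cs n))
    insert (c ∷ cs) (n ∷ u) (there m) = begin
      k (f x) + (term xs c + sum (map (term xs) cs))  ≡⟨ ℕₚ.+-assoc (k (f x)) _ _ ⟨
      k (f x) + term xs c + sum (map (term xs) cs)    ≡⟨ cong (_+ sum (map (term xs) cs)) (ℕₚ.+-comm (k (f x)) _) ⟩
      term xs c + k (f x) + sum (map (term xs) cs)    ≡⟨ ℕₚ.+-assoc (term xs c) _ _ ⟩
      term xs c + (k (f x) + sum (map (term xs) cs))
        ≡⟨ cong₂ _+_ (cong (_* k c) (sym (size-≢ c (λ p → All.lookup n m (sym p))))) (insert cs u m) ⟩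
      term (x ∷ xs) c + sum (map (term (x ∷ xs)) cs)  ∎
      where open ≡-Reasoning

  states-unique : Unique states
  states-unique = toWitness {a? = allPairs? (λ c d → ¬? (c ≟ˢ d)) states} tt

  module Count (g₀ : Symmetry) (σ₀ : List Gen) (σ₀-flag : Flag σ₀) where
    open Levels g₀ σ₀ σ₀-flag public

    state : Word → State
    state w = length (missing w) , length (desc w)

    Regular : Word → Set
    Regular w = Red w × Good w

    desc-≈-length : ∀ {v w} → v ≈ w → length (desc v) ≡ length (desc w)
    desc-≈-length p = ℕₚ.≤-antisym
      (unique-⊆-length (clique-unique (desc-clique _)) (≈-desc p))
      (unique-⊆-length (clique-unique (desc-clique _)) (≈-desc (≈-sym p)))

    state-≈ : ∀ {v w} → v ≈ w → state v ≡ state w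
    state-≈ p = cong₂ _,_ (cong length (missing-≈ p)) (desc-≈-length p)

    -- Every missing direction other than `t` commutes with `t` by `near` and stays missing; `t`
    -- itself is now passed.
    state-step : ∀ {t w} → Near w t → state (t ∷ w) ≡ Γ-ascents.code (missing w) (desc w) t
    state-step {t} {w} near = cong (λ l → length l , length (desc (t ∷ w)))
      (filter-filter _ _ _ σ₀
        (λ {a} m p → let q , r = δ-out a t (status a w) p in (λ { refl → ~-irrefl r }) , q)
        (λ {a} m n p → trans (cong (δ a t) p) (δ-~ (~-sym {t} {a} (other a m n p)))))
      where
      other : ∀ a → a ∈ σ₀ → ¬ t ≡ a → status a w ≡ out → t ~ a
      other a m n p with near (∈-missing⁺ w m p)
      ... | inj₁ q = ⊥-elim (n q)
      ... | inj₂ q = q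

    state-clique : ∀ w → Clique (missing w ++ desc w)
    state-clique w = AllPairsₚ.++⁺ (missing-clique w) (desc-clique w)
      (All.tabulate λ m → All.tabulate λ k → missing-~desc w m k)

    length-missing-[] : length (missing []) ≡ 4
    length-missing-[] = trans (cong length (Listₚ.filter-all (λ a → status a [] ≟ₛ out) {σ₀} (All.tabulate (λ _ → refl))))
      (proj₂ σ₀-flag)

    opaque
      -- Missing directions commute with all letters, so together with the descents they form a
      -- clique of at most four. A nonempty word has a descent.
      state∈states : ∀ w → state w ∈ states
      state∈states [] = subst (λ m → (m , 0) ∈ states) (sym length-missing-[]) (here refl)
      state∈states w@(t ∷ v) = go (length (missing w)) (length (filter (t ~?_) (desc v)))
        (subst (_≤ 4) (trans (Listₚ.length-++ (missing w)) (ℕₚ.+-suc _ _)) (clique≤4 _ (state-clique w)))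
        where
        open DecMembership _≟ˢ_ using () renaming (_∈?_ to _∈ˢ?_)
        go : ∀ m d → suc (m + d) ≤ 4 → (m , suc d) ∈ states
        go 0 0 _ = toWitness {a? = (0 , 1) ∈ˢ? states} tt
        go 0 1 _ = toWitness {a? = (0 , 2) ∈ˢ? states} tt
        go 0 2 _ = toWitness {a? = (0 , 3) ∈ˢ? states} tt
        go 0 3 _ = toWitness {a? = (0 , 4) ∈ˢ? states} tt
        go 0 (suc (suc (suc (suc _)))) (s≤s (s≤s (s≤s (s≤s ()))))
        go 1 0 _ = toWitness {a? = (1 , 1) ∈ˢ? states} tt
        go 1 1 _ = toWitness {a? = (1 , 2) ∈ˢ? states} tt
        go 1 2 _ = toWitness {a? = (1 , 3) ∈ˢ? states} tt
        go 1 (suc (suc (suc _))) (s≤s (s≤s (s≤s (s≤s ()))))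
        go 2 0 _ = toWitness {a? = (2 , 1) ∈ˢ? states} tt
        go 2 1 _ = toWitness {a? = (2 , 2) ∈ˢ? states} tt
        go 2 (suc (suc _)) (s≤s (s≤s (s≤s (s≤s ()))))
        go 3 0 _ = toWitness {a? = (3 , 1) ∈ˢ? states} tt
        go 3 (suc _) (s≤s (s≤s (s≤s (s≤s ()))))
        go (suc (suc (suc (suc _)))) _ (s≤s (s≤s (s≤s (s≤s ()))))

      degree-state : ∀ w → Red w → Good w → ∀ {m} → length (missing w) ≡ m →
                     Degree (V w) (length (P-ascents.ascents roots (take m flagₚ) []))
      degree-state w r g refl = subst (Degree (V w))
        (Permₚ.↭-length (ascents-↭ (missing w) [] (subst Clique (sym (Listₚ.++-identityʳ (missing w))) (missing-clique w))))
        (degree w r g)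

      degree-120 : ∀ w → Red w → Good w → length (missing w) ≡ 0 → Degree (V w) 120
      degree-120 w r g p = subst (Degree (V w)) (Listₚ.∷-injectiveˡ degrees-roots) (degree-state w r g p)

      degree-13 : ∀ w → Red w → Good w → length (missing w) ≡ 1 → Degree (V w) 13
      degree-13 w r g p = subst (Degree (V w)) (Listₚ.∷-injectiveˡ (Listₚ.∷-injectiveʳ degrees-roots)) (degree-state w r g p)

      degree-7 : ∀ w → Red w → Good w → length (missing w) ≡ 2 → Degree (V w) 7
      degree-7 w r g p = subst (Degree (V w))
        (Listₚ.∷-injectiveˡ (Listₚ.∷-injectiveʳ (Listₚ.∷-injectiveʳ degrees-roots))) (degree-state w r g p)

      inside₂⇒ : ∀ {w} → Red w → Good w → Inside2Face (V w) → length (missing w) ≡ 2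
      inside₂⇒ r g (f , n) = ℕₚ.≤-antisym (ℕₚ.≮⇒≥ λ l → n (onface⇐ 1F r g (s≤s l)))
        (ℕₚ.≤-pred (ℕₚ.≤-pred (onface⇒ 2F r g f)))

      inside₂⇐ : ∀ {w} → Red w → Good w → length (missing w) ≡ 2 → Inside2Face (V w)
      inside₂⇐ r g p = onface⇐ 2F r g (subst (λ m → 4 ≤ 2 + m) (sym p) ℕₚ.≤-refl) ,
        λ f → ℕₚ.<-irrefl refl (subst (λ m → 4 ≤ 1 + m) p (onface⇒ 1F r g f))

      inside₃⇒ : ∀ {w} → Red w → Good w → Inside3Face (V w) → length (missing w) ≡ 1
      inside₃⇒ r g (f , n) = ℕₚ.≤-antisym (ℕₚ.≮⇒≥ λ l → n (onface⇐ 2F r g (s≤s (s≤s l))))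
        (ℕₚ.≤-pred (ℕₚ.≤-pred (ℕₚ.≤-pred (onface⇒ 3F r g f))))

      inside₃⇐ : ∀ {w} → Red w → Good w → length (missing w) ≡ 1 → Inside3Face (V w)
      inside₃⇐ r g p = onface⇐ 3F r g (subst (λ m → 4 ≤ 3 + m) (sym p) ℕₚ.≤-refl) ,
        λ f → ℕₚ.<-irrefl refl (subst (λ m → 4 ≤ 2 + m) p (onface⇒ 2F r g f))

      insideP⇒ : ∀ {w} → Red w → Good w → InsideP (V w) → length (missing w) ≡ 0
      insideP⇒ r g (_ , n) = ℕₚ.n≤0⇒n≡0 (ℕₚ.≮⇒≥ λ l → n (onface⇐ 3F r g (s≤s (s≤s (s≤s l)))))

      insideP⇐ : ∀ {w} → Red w → Good w → length (missing w) ≡ 0 → InsideP (V w)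
      insideP⇐ {w} r g p = vertex⇐ w r g ,
        λ f → ℕₚ.<-irrefl refl (subst (λ m → 4 ≤ 3 + m) p (onface⇒ 3F r g f))

      type⇒ : ∀ τ {w} → Red w → Good w → HasType τ (V w) → state w ≡ kind τ
      type⇒ A {w} r g (i , _ , n) = cong₂ _,_ (inside₂⇒ r g i) (count-unique (indegree w r g) n)
      type⇒ B {w} r g (i , _ , n) = cong₂ _,_ (inside₂⇒ r g i) (count-unique (indegree w r g) n)
      type⇒ C {w} r g (i , _ , n) = cong₂ _,_ (inside₃⇒ r g i) (count-unique (indegree w r g) n)
      type⇒ D {w} r g (i , _ , n) = cong₂ _,_ (inside₃⇒ r g i) (count-unique (indegree w r g) n)
      type⇒ E {w} r g (i , _ , n) = cong₂ _,_ (inside₃⇒ r g i) (count-unique (indegree w r g) n)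
      type⇒ F {w} r g (i , _ , n) = cong₂ _,_ (insideP⇒ r g i) (count-unique (indegree w r g) n)
      type⇒ G {w} r g (i , _ , n) = cong₂ _,_ (insideP⇒ r g i) (count-unique (indegree w r g) n)
      type⇒ H {w} r g (i , _ , n) = cong₂ _,_ (insideP⇒ r g i) (count-unique (indegree w r g) n)
      type⇒ K {w} r g (i , _ , n) = cong₂ _,_ (insideP⇒ r g i) (count-unique (indegree w r g) n)

      indegree-state : ∀ {w m d} → Red w → Good w → state w ≡ (m , d) → Indegree (V w) d
      indegree-state {w} r g p = subst (Indegree (V w)) (cong proj₂ p) (indegree w r g)

      type⇐ : ∀ τ {w} → Red w → Good w → state w ≡ kind τ → HasType τ (V w)
      type⇐ A {w} r g p = inside₂⇐ r g (cong proj₁ p) , degree-7 w r g (cong proj₁ p) , indegree-state r g p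
      type⇐ B {w} r g p = inside₂⇐ r g (cong proj₁ p) , degree-7 w r g (cong proj₁ p) , indegree-state r g p
      type⇐ C {w} r g p = inside₃⇐ r g (cong proj₁ p) , degree-13 w r g (cong proj₁ p) , indegree-state r g p
      type⇐ D {w} r g p = inside₃⇐ r g (cong proj₁ p) , degree-13 w r g (cong proj₁ p) , indegree-state r g p
      type⇐ E {w} r g p = inside₃⇐ r g (cong proj₁ p) , degree-13 w r g (cong proj₁ p) , indegree-state r g p
      type⇐ F {w} r g p = insideP⇐ r g (cong proj₁ p) , degree-120 w r g (cong proj₁ p) , indegree-state r g p
      type⇐ G {w} r g p = insideP⇐ r g (cong proj₁ p) , degree-120 w r g (cong proj₁ p) , indegree-state r g p
      type⇐ H {w} r g p = insideP⇐ r g (cong proj₁ p) , degree-120 w r g (cong proj₁ p) , indegree-state r g p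
      type⇐ K {w} r g p = insideP⇐ r g (cong proj₁ p) , degree-120 w r g (cong proj₁ p) , indegree-state r g p

    red? : ∀ w → Dec (Red w)
    red? []      = yes tt
    red? (t ∷ w) = ¬? (t ∈? desc w) ×-dec red? w

    regular? : ∀ w → Dec (Regular w)
    regular? w with red? w | all? (λ a → ¬? (status a w ≟ₛ bad)) σ₀
    ... | yes r | yes g = yes (r , λ a → All.lookup g)
    ... | no n  | _     = no (n ∘ proj₁)
    ... | yes _ | no n  = no λ (_ , g) → n (All.tabulate (g _))

    opaque
      -- A vertex can have several reduced words, which differ by commutations; one is kept for each
      -- vertex.
      level-words : ∀ n → ∃[ xs ] Unique (map V xs) × (∀ {w} → w ∈ xs → length w ≡ n × Regular w) ×
                          (∀ w → length w ≡ n × Regular w → V w ∈ map V xs)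
      level-words n = representatives _≟ₚ_ V
        (count-filter regular? (proj₂ (count-words gens-unique gens-full n)))

      level : ℕ → List Word
      level n = proj₁ (level-words n)

      level-unique-V : ∀ n → Unique (map V (level n))
      level-unique-V n = proj₁ (proj₂ (level-words n))

      level-∈ : ∀ {n w} → w ∈ level n → length w ≡ n × Red w × Good w
      level-∈ {n} = proj₁ (proj₂ (proj₂ (level-words n)))

      level-full : ∀ n w → length w ≡ n × Regular w → V w ∈ map V (level n)
      level-full n = proj₂ (proj₂ (proj₂ (level-words n)))

    opaque
      level-complete : ∀ {n} w → length w ≡ n → Red w → Good w → ∃[ v ] v ∈ level n × V w ≡ V v × w ≈ v
      level-complete {n} w e r g =
        let v , m , p = ∈-map⁻ V (level-full n w (e , r , g))
        in v , m , p , V-≈ r (proj₁ (proj₂ (level-∈ m))) p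

      level-unique-words : ∀ n → Unique (level n)
      level-unique-words n = AllPairs.map (λ p q → p (cong V q)) (AllPairsₚ.map⁻ (level-unique-V n))

      level-V-injective : ∀ {n v w} → v ∈ level n → w ∈ level n → V v ≡ V w → v ≡ w
      level-V-injective {n} = go (level n) (level-unique-V n)
        where
        go : ∀ xs → Unique (map V xs) → ∀ {v w} → v ∈ xs → w ∈ xs → V v ≡ V w → v ≡ w
        go (x ∷ xs) (n ∷ u) (here refl) (here refl) p = refl
        go (x ∷ xs) (n ∷ u) (here refl) (there k)   p = ⊥-elim (All.lookup n (∈-map⁺ V k) p)
        go (x ∷ xs) (n ∷ u) (there m)   (here refl) p = ⊥-elim (All.lookup n (∈-map⁺ V m) (sym p))
        go (x ∷ xs) (n ∷ u) (there m)   (there k)   p = go xs u m k p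

    size : State → ℕ → ℕ
    size c n = length (filter (λ w → state w ≟ˢ c) (level n))

    count-state : ∀ c n → HasCount (λ w → w ∈ level n × state w ≡ c) (size c n)
    count-state c n = count-filter (λ w → state w ≟ˢ c) (count-list (level-unique-words n))

    opaque
      count-type : ∀ τ n → HasCount (λ v → OnLevel n v × HasType τ v) (size (kind τ) n)
      count-type τ n = count-image V (λ (m , _) (k , _) → level-V-injective m k)
        (λ w (m , p) → let e , r , g = level-∈ m in
          subst (λ k → OnLevel k (V w)) e (onlevel⇐ w r g) , type⇐ τ r g p)
        (λ v (l , h) → let w , r , g , p , e = onlevel⇒ l
                           w′ , m , q , eq = level-complete w e r g
                           r≡ = type⇒ τ r g (subst (HasType τ) p h)
                       in w′ , (m , trans (sym (state-≈ eq)) r≡) , trans (sym q) (sym p))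
        (count-state (kind τ) n)

      count-level : ∀ n → HasCount (OnLevel n) (length (level n))
      count-level n = count-image V level-V-injective
        (λ w m → let e , r , g = level-∈ m in subst (λ k → OnLevel k (V w)) e (onlevel⇐ w r g))
        (λ v l → let w , r , g , p , e = onlevel⇒ l
                     w′ , m , q , _ = level-complete w e r g in w′ , m , trans (sym q) (sym p))
        (count-list (level-unique-words n))

      level-size : ∀ n → length (level n) ≡ sum (map (λ c → size c n) states)
      level-size n = trans (sym (trans (sum-const 1 (level n)) (ℕₚ.*-identityʳ _)))
        (trans (sum-classes state (λ _ → 1) (level n) states-unique (λ {w} _ → state∈states w))
          (cong sum (Listₚ.map-cong (λ c → ℕₚ.*-identityʳ (size c n)) states)))

    -- The edges up to state `c`, as pairs of points rather than words, so that counting by the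
    -- lower and by the upper end concerns one and the same set.
    Rising : ℕ → State → Point × Point → Set
    Rising n c (u , v) = ∃[ w ] ∃[ t ] length w ≡ n × Regular (t ∷ w) × state (t ∷ w) ≡ c × u ≡ V w × v ≡ V (t ∷ w)

    opaque
      -- The letters that ascend to state `c` are counted by their codes, and `ascents-↭` moves this
      -- count to the base flag, where the table applies.
      count-up : ∀ w c → Red w → Good w →
        HasCount (λ v → ∃[ t ] Regular (t ∷ w) × state (t ∷ w) ≡ c × v ≡ V (t ∷ w)) (step-count (state w) c)
      count-up w c r g = subst (HasCount _) eq (count-image (λ t → V (t ∷ w))
        (λ _ _ p → letter-injective w (V-injective p))
        (λ t ((_ , (n , a)) , p) → t , ((n , r) , good-step w g (All.lookup a)) ,
          trans (state-step {t} {w} (All.lookup a)) p , refl)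
        (λ v (t , ((n , _) , g′) , p , q) → t ,
          ((gens-full t , (n , All.tabulate (good-step⁻ w g′))) , trans (sym (state-step {t} {w} (good-step⁻ w g′))) p) , sym q)
        (count-filter (λ t → Γ-ascents.code (missing w) (desc w) t ≟ˢ c)
          (count-filter (Γ-ascents.allowed? (missing w) (desc w)) (count-list gens-unique))))
        where
        ts : List Gen
        ts = filter (Γ-ascents.allowed? (missing w) (desc w)) gens
        eq : length (filter (λ t → Γ-ascents.code (missing w) (desc w) t ≟ˢ c) ts) ≡ step-count (state w) c
        eq = trans (sym (Listₚ.length-map (Γ-ascents.code (missing w) (desc w))
                      (filter (λ t → Γ-ascents.code (missing w) (desc w) t ≟ˢ c) ts)))
          (trans (cong length (sym (filter-map (λ t → Γ-ascents.code (missing w) (desc w) t ≟ˢ c) (_≟ˢ c)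
                   (Γ-ascents.code (missing w) (desc w)) (λ _ p → p) (λ _ p → p) ts)))
            (count-↭ c (ascents-↭ (missing w) (desc w) (state-clique w))))

      rising-up : ∀ n c → HasCount (Rising n c) (sum (map (λ w → step-count (state w) c) (level n)))
      rising-up n c = count-image (λ (w , v) → V w , v)
        (λ { {w , v} {w′ , v′} (m , _) (k , _) p →
             cong₂ _,_ (level-V-injective m k (cong proj₁ p)) (cong proj₂ p) })
        (λ (w , v) (m , t , a , b , e) → w , t , proj₁ (level-∈ m) , a , b , refl , e)
        (λ { (u , v) (w , t , e , ((n , r) , g) , p , refl , refl) →
             let g₀ = good-tail {t} {w} g
                 w′ , m , q , eq = level-complete w e r g₀
                 k = prep t eq
             in (w′ , v) , (m , t , (≈-Red k (n , r) , good-≈ k g) , trans (sym (state-≈ k)) p , face-≃ [] (trace k))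
                , cong₂ _,_ (sym q) refl })
        (count-Σ (λ w → step-count (state w) c) (count-list (level-unique-words n))
          (λ w m → let _ , r , g = level-∈ m in count-up w c r g))

      -- Each descent of the upper end is one incoming edge, and a vertex of state `c` has `proj₂ c`
      -- of them.
      rising-down : ∀ n c → HasCount (Rising n c) (size c (suc n) * proj₂ c)
      rising-down n c = subst (HasCount (Rising n c)) (sum-const (proj₂ c) (filter (λ w → state w ≟ˢ c) (level (suc n))))
        (count-image {P = λ (w , u) → (w ∈ level (suc n) × state w ≡ c) × (∃[ t ] t ∈ desc w × u ≡ V (t ∷ w))}
          (λ (w , u) → u , V w)
          (λ { {w , u} {w′ , u′} ((m , _) , _) ((k , _) , _) p →
               cong₂ _,_ (level-V-injective m k (cong proj₂ p)) (cong proj₁ p) })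
          (λ { (w , u) ((m , p) , t , k , refl) →
               let e , r , g = level-∈ m
                   v , q , r′ , g′ , e′ , n∉ = down r g k
               in v , t , ℕₚ.suc-injective (trans (sym (≈-length q)) e) , ((n∉ , r′) , good-≈ q g) ,
                  trans (sym (state-≈ q)) p , e′ , face-≃ [] (trace q) })
          (λ { (u , v) (w , t , e , (r , g) , p , refl , refl) →
               let w′ , m , q , eq = level-complete (t ∷ w) (cong suc e) r g
               in (w′ , V w) , ((m , trans (sym (state-≈ eq)) p) , t , ≈-desc eq (here refl) ,
                    face-≃ [] (≃-trans (≃-sym (cancel t w)) (≃-prep t (trace eq)))) , cong₂ _,_ refl (sym q) })
          (count-Σ (λ _ → proj₂ c) (count-state c (suc n))
            (λ w (m , p) → subst (HasCount _) (cong proj₂ p)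
              (count-image (λ t → V (t ∷ w)) (λ _ _ q → letter-injective w (V-injective q))
                (λ t k → t , k , refl) (λ u (t , k , q) → t , k , sym q)
                (count-list (clique-unique (desc-clique w)))))))

      size-step : ∀ n c → size c (suc n) * proj₂ c ≡ sum (map (λ d → size d n * step-count d c) states)
      size-step n c = trans (count-unique (rising-down n c) (rising-up n c))
        (sum-classes state (λ d → step-count d c) (level n) states-unique (λ {w} _ → state∈states w))

      size-apex : ∀ n → size (4 , 0) (suc n) ≡ 0
      size-apex n = count-unique (count-state (4 , 0) (suc n))
        (count-⊥ λ { [] (m , _) → case proj₁ (level-∈ m) of λ () ; (t ∷ w) (_ , ()) })

      size-0 : map (λ c → size c 0) states ≡ 1 ∷ 0 ∷ 0 ∷ 0 ∷ 0 ∷ 0 ∷ 0 ∷ 0 ∷ 0 ∷ 0 ∷ 0 ∷ []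
      size-0 = cong₂ _∷_ one (cong₂ _∷_ (none 2 0) (cong₂ _∷_ (none 1 0) (cong₂ _∷_ (none 1 1) (cong₂ _∷_ (none 0 0)
        (cong₂ _∷_ (none 0 1) (cong₂ _∷_ (none 0 2) (cong₂ _∷_ (none′ 0) (cong₂ _∷_ (none′ 1) (cong₂ _∷_ (none′ 2)
          (cong₂ _∷_ (none′ 3) refl))))))))))
        where
        empty : ∀ {w} → w ∈ level 0 → w ≡ []
        empty {[]}    m = refl
        empty {t ∷ w} m = case proj₁ (level-∈ m) of λ ()
        one : size (4 , 0) 0 ≡ 1
        one = count-unique (count-state (4 , 0) 0)
          (([] ∷ []) , ([] ∷ []) , (λ w → mk⇔
            (λ { (here refl) → let v , m , _ , p = level-complete [] refl tt good-[] in
                   subst (_∈ level 0) (empty m) m , cong (_, 0) length-missing-[] })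
            (λ (m , _) → here (empty m))) , refl)
        none : ∀ m d → size (suc m , suc d) 0 ≡ 0
        none m d = count-unique (count-state (suc m , suc d) 0)
          (count-⊥ λ w (k , p) → case trans (sym (cong (λ w → length (desc w)) (empty k))) (cong proj₂ p) of λ ())
        none′ : ∀ d → size (0 , suc d) 0 ≡ 0
        none′ d = count-unique (count-state (0 , suc d) 0)
          (count-⊥ λ w (k , p) → case trans (sym (cong (λ w → length (desc w)) (empty k))) (cong proj₂ p) of λ ())

-- Recurrences from annihilated functionals

module Recurrences where
  open import Data.Integer.Base using (ℤ; +_; -[1+_])
  open import Data.Integer.Tactic.RingSolver using (solve-∀)
  import Data.Nat.Base as ℕ
  open import Data.Vec.Base as Vec using (zipWith; replicate; lookup)
  open import Function.Base using (id)
  open import Function.Strict using (force; force-≡)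

  dot : ∀ {n} → Vec ℤ n → Vec ℤ n → ℤ
  dot []       []       = + 0
  dot (a ∷ as) (x ∷ xs) = a Int.* x Int.+ dot as xs

  infixl 6 _⊕_
  infixr 7 _⊙_
  _⊕_ : ∀ {n} → Vec ℤ n → Vec ℤ n → Vec ℤ n
  _⊕_ = zipWith Int._+_

  _⊙_ : ∀ {n} → ℤ → Vec ℤ n → Vec ℤ n
  k ⊙ as = Vec.map (λ a → k Int.* a) as

  zeros : ∀ {n} → Vec ℤ n
  zeros = replicate _ (+ 0)

  dot-⊕ : ∀ {n} (as bs xs : Vec ℤ n) → dot (as ⊕ bs) xs ≡ dot as xs Int.+ dot bs xs
  dot-⊕ []       []       []       = refl
  dot-⊕ (a ∷ as) (b ∷ bs) (x ∷ xs) = trans (cong (λ z → (a Int.+ b) Int.* x Int.+ z) (dot-⊕ as bs xs))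
    (lemma a b x (dot as xs) (dot bs xs))
    where
    open Int using (_+_; _*_)
    lemma : ∀ a b x p q → (a + b) * x + (p + q) ≡ a * x + p + (b * x + q)
    lemma = solve-∀

  dot-⊙ : ∀ {n} k (as xs : Vec ℤ n) → dot (k ⊙ as) xs ≡ k Int.* dot as xs
  dot-⊙ k []       []       = sym (ℤₚ.*-zeroʳ k)
  dot-⊙ k (a ∷ as) (x ∷ xs) = trans (cong (λ z → k Int.* a Int.* x Int.+ z) (dot-⊙ k as xs))
    (lemma k a x (dot as xs))
    where
    open Int using (_+_; _*_)
    lemma : ∀ k a x p → k * a * x + k * p ≡ k * (a * x + p)
    lemma = solve-∀

  dot-zeros : ∀ {n} (xs : Vec ℤ n) → dot zeros xs ≡ + 0
  dot-zeros []       = refl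
  dot-zeros (x ∷ xs) = trans (ℤₚ.+-identityˡ (dot zeros xs)) (dot-zeros xs)

  unit : ∀ {n} → Fin n → Vec ℤ n
  unit zero    = + 1 ∷ zeros
  unit (suc i) = + 0 ∷ unit i

  dot-unit : ∀ {n} (i : Fin n) xs → dot (unit i) xs ≡ lookup xs i
  dot-unit zero    (x ∷ xs) = trans (cong₂ Int._+_ (ℤₚ.*-identityˡ x) (dot-zeros xs)) (ℤₚ.+-identityʳ x)
  dot-unit (suc i) (x ∷ xs) = trans (ℤₚ.+-identityˡ (dot (unit i) xs)) (dot-unit i xs)

  dot-ones : ∀ {n} (xs : Vec ℕ n) → dot (replicate n (+ 1)) (Vec.map +_ xs) ≡ + Vec.sum xs
  dot-ones []       = refl
  dot-ones (x ∷ xs) = cong₂ Int._+_ (ℤₚ.*-identityˡ (+ x)) (dot-ones xs)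

  evaluate : ∀ {X : Set} {n} → Vec ℤ n → (Vec ℤ n → X) → X
  evaluate []             f = f []
  evaluate (+ a ∷ as)     f = force a λ b → evaluate as λ bs → f (+ b ∷ bs)
  evaluate (-[1+ a ] ∷ as) f = force a λ b → evaluate as λ bs → f (-[1+ b ] ∷ bs)

  evaluate≡ : ∀ {X : Set} {n} (as : Vec ℤ n) (f : Vec ℤ n → X) → evaluate as f ≡ f as
  evaluate≡ []              f = refl
  evaluate≡ (+ a ∷ as)      f = trans (force-≡ a _) (evaluate≡ as _)
  evaluate≡ (-[1+ a ] ∷ as) f = trans (force-≡ a _) (evaluate≡ as _)

  -- Sequences of vectors with scale · y (n + 1) = M y (n), where M is given by its
  -- rows; the transpose of M acts on linear functionals.

  module Linear {m : ℕ} (scale : ℕ) {{nz : ℕ.NonZero scale}} (rows : Vec (Vec ℤ m) m) (y : ℕ → Vec ℤ m)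
                (y-step : ∀ n → (+ scale) ⊙ y (suc n) ≡ Vec.map (λ r → dot r (y n)) rows) where

    combine : ∀ {k} → Vec ℤ k → Vec (Vec ℤ m) k → Vec ℤ m
    combine []      []       = zeros
    combine (a ∷ e) (r ∷ rs) = a ⊙ r ⊕ combine e rs

    dot-combine : ∀ {k} (e : Vec ℤ k) rs x → dot e (Vec.map (λ r → dot r x) rs) ≡ dot (combine e rs) x
    dot-combine []      []       x = sym (dot-zeros x)
    dot-combine (a ∷ e) (r ∷ rs) x = sym (trans (dot-⊕ (a ⊙ r) (combine e rs) x)
      (cong₂ Int._+_ (dot-⊙ a r x) (sym (dot-combine e rs x))))

    dot-⊙ʳ : ∀ {k} c (e x : Vec ℤ k) → dot e (c ⊙ x) ≡ c Int.* dot e x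
    dot-⊙ʳ c []      []      = sym (ℤₚ.*-zeroʳ c)
    dot-⊙ʳ c (a ∷ e) (x ∷ v) = trans (cong (λ z → a Int.* (c Int.* x) Int.+ z) (dot-⊙ʳ c e v))
      (lemma c a x (dot e v))
      where
      open Int using (_+_; _*_)
      lemma : ∀ c a x p → a * (c * x) + c * p ≡ c * (a * x + p)
      lemma = solve-∀

    pullback : Vec ℤ m → Vec ℤ m
    pullback e = combine e rows

    dot-pullback : ∀ e n → + scale Int.* dot e (y (suc n)) ≡ dot (pullback e) (y n)
    dot-pullback e n = trans (sym (dot-⊙ʳ (+ scale) e (y (suc n))))
      (trans (cong (dot e) (y-step n)) (dot-combine e rows (y n)))

    power : List ℤ → ℕ
    power []       = 1
    power (_ ∷ as) = scale ℕ.* power as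

    shifts : (ℕ → ℤ) → List ℤ → ℕ → ℤ
    shifts x []       n = + 0
    shifts x (a ∷ as) n = a Int.* x n Int.+ shifts x as (suc n)

    -- Horner's scheme: up to powers of `scale` that clear denominators, this is the polynomial with
    -- coefficients `as`, evaluated at the transposed matrix and applied to `e`.
    residue : Vec ℤ m → List ℤ → Vec ℤ m
    residue e []       = zeros
    residue e (a ∷ as) = (+ (scale ℕ.* power as) Int.* a) ⊙ e ⊕ pullback (residue e as)

    dot-residue : ∀ e as n → + power as Int.* shifts (λ k → dot e (y k)) as n ≡ dot (residue e as) (y n)
    dot-residue e []       n = sym (dot-zeros (y n))
    dot-residue e (a ∷ as) n = begin
      + (scale ℕ.* power as) Int.* (a Int.* x Int.+ z)
        ≡⟨ cong (λ p → p Int.* (a Int.* x Int.+ z)) (ℤₚ.pos-* scale (power as)) ⟩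
      + scale Int.* + power as Int.* (a Int.* x Int.+ z)
        ≡⟨ lemma (+ scale) (+ power as) a x z ⟩
      + scale Int.* + power as Int.* a Int.* x Int.+ + scale Int.* (+ power as Int.* z)
        ≡⟨ cong₂ (λ p q → p Int.* a Int.* x Int.+ + scale Int.* q) (sym (ℤₚ.pos-* scale (power as))) (dot-residue e as (suc n)) ⟩
      + (scale ℕ.* power as) Int.* a Int.* x Int.+ + scale Int.* dot (residue e as) (y (suc n))
        ≡⟨ cong₂ Int._+_ (sym (dot-⊙ (+ (scale ℕ.* power as) Int.* a) e (y n))) (dot-pullback (residue e as) n) ⟩
      dot ((+ (scale ℕ.* power as) Int.* a) ⊙ e) (y n) Int.+ dot (pullback (residue e as)) (y n)
        ≡⟨ dot-⊕ ((+ (scale ℕ.* power as) Int.* a) ⊙ e) (pullback (residue e as)) (y n) ⟨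
      dot (residue e (a ∷ as)) (y n) ∎
      where
      open ≡-Reasoning
      x = dot e (y n)
      z = shifts (λ k → dot e (y k)) as (suc n)
      lemma : ∀ s p a x z → s Int.* p Int.* (a Int.* x Int.+ z) ≡ s Int.* p Int.* a Int.* x Int.+ s Int.* (p Int.* z)
      lemma = solve-∀

    -- Forcing every entry before it is used keeps the evaluation of the nested
    -- recursion from becoming exponential.

    strict-residue : ∀ {X : Set} → Vec ℤ m → List ℤ → (Vec ℤ m → X) → X
    strict-residue e []       f = f zeros
    strict-residue e (a ∷ as) f = strict-residue e as λ r →
      evaluate ((+ (scale ℕ.* power as) Int.* a) ⊙ e ⊕ pullback r) f

    strict-residue≡ : ∀ {X : Set} e as (f : Vec ℤ m → X) → strict-residue e as f ≡ f (residue e as)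
    strict-residue≡ e []       f = refl
    strict-residue≡ e (a ∷ as) f = trans (strict-residue≡ e as _) (evaluate≡ (residue e (a ∷ as)) f)

    power≢0 : ∀ as → ℕ.NonZero (power as)
    power≢0 []       = _
    power≢0 (_ ∷ as) = ℕₚ.m*n≢0 scale (power as) {{nz}} {{power≢0 as}}

    shifts-zero : ∀ e as → residue e as ≡ zeros → ∀ n → shifts (λ k → dot e (y k)) as n ≡ + 0
    shifts-zero e as p n with ℤₚ.i*j≡0⇒i≡0∨j≡0 (+ power as)
      (trans (dot-residue e as n) (trans (cong (λ r → dot r (y n)) p) (dot-zeros (y n))))
    ... | inj₂ q = q
    ... | inj₁ q with power as | power≢0 as
    ...   | zero | record { nonZero = () }
    shifts-zero e as p n | inj₁ () | suc _ | _

    shifts-cong : ∀ {f g : ℕ → ℤ} → (∀ k → f k ≡ g k) → ∀ as n → shifts f as n ≡ shifts g as n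
    shifts-cong p []       n = refl
    shifts-cong p (a ∷ as) n = cong₂ (λ x z → a Int.* x Int.+ z) (p n) (shifts-cong p as (suc n))

    -- Listed from the oldest term on. The blocks of the system have the characteristic polynomials
    -- x - 1 (rays), x² - 3x + 1 (2-faces), (x - 1)(x² - 8x + 1) (3-faces) and x⁴ - 116x³ + 366x² -
    -- 116x + 1 (interior). The three lists are the products of the first two, three and four of
    -- these, with the repeated factor x - 1 taken once.
    coefficients₉ coefficients₅ coefficients₃ : List ℤ
    coefficients₉ = Int.- + 1 ∷ + 128 ∷ Int.- + 1795 ∷ + 8837 ∷ Int.- + 19239 ∷ + 19239
                  ∷ Int.- + 8837 ∷ + 1795 ∷ Int.- + 128 ∷ + 1 ∷ []
    coefficients₅ = Int.- + 1 ∷ + 12 ∷ Int.- + 37 ∷ + 37 ∷ Int.- + 12 ∷ + 1 ∷ []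
    coefficients₃ = Int.- + 1 ∷ + 4 ∷ Int.- + 4 ∷ + 1 ∷ []

    module _ (x : ℕ → ℕ) (e : Vec ℤ m) (x-dot : ∀ n → + x (suc n) ≡ dot e (y n)) where

      private
        -- The vector `y n` belongs to level `n + 1`, so the oldest term that a recurrence can use
        -- is `x 1`.
        vanish : ∀ as → strict-residue e as id ≡ zeros → ∀ n → shifts (λ k → + x (suc k)) as n ≡ + 0
        vanish as p n = trans (shifts-cong x-dot as n) (shifts-zero e as (trans (sym (strict-residue≡ e as id)) p) n)

      recurrence₉ : strict-residue e coefficients₉ id ≡ zeros → Recurrence₉ x
      recurrence₉ p .(suc (suc (suc (suc (suc (suc (suc (suc (suc (suc n))))))))))
        (s≤s (s≤s (s≤s (s≤s (s≤s (s≤s (s≤s (s≤s (s≤s (s≤s (ℕ.z≤n {n}))))))))))) =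
        conclude (+ x (1 ℕ.+ n)) (+ x (2 ℕ.+ n)) (+ x (3 ℕ.+ n)) (+ x (4 ℕ.+ n)) (+ x (5 ℕ.+ n)) (+ x (6 ℕ.+ n)) (+ x (7 ℕ.+ n)) (+ x (8 ℕ.+ n)) (+ x (9 ℕ.+ n)) (+ x (10 ℕ.+ n))
          (vanish coefficients₉ p n)
        where
        open Int using (_+_; _-_; _*_; -_)
        conclude : ∀ a b c d e f g h i j → (- + 1 * a + (+ 128 * b + (- + 1795 * c + (+ 8837 * d + (- + 19239 * e + (+ 19239 * f
            + (- + 8837 * g + (+ 1795 * h + (- + 128 * i + (+ 1 * j + + 0)))))))))) ≡ + 0 →
          j ≡ + 128 * i - + 1795 * h + + 8837 * g - + 19239 * f + + 19239 * e - + 8837 * d + + 1795 * c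
            - + 128 * b + a
        conclude a b c d e f g h i j q = trans (lemma a b c d e f g h i j) (trans (cong (λ z → (+ 128 * i - + 1795 * h + + 8837 * g - + 19239 * f + + 19239 * e - + 8837 * d + + 1795 * c
            - + 128 * b + a) + z) q) (ℤₚ.+-identityʳ _))
          where
          lemma : ∀ a b c d e f g h i j → j ≡ (+ 128 * i - + 1795 * h + + 8837 * g - + 19239 * f + + 19239 * e - + 8837 * d + + 1795 * c
            - + 128 * b + a) + (- + 1 * a + (+ 128 * b + (- + 1795 * c + (+ 8837 * d + (- + 19239 * e + (+ 19239 * f
            + (- + 8837 * g + (+ 1795 * h + (- + 128 * i + (+ 1 * j + + 0))))))))))
          lemma = solve-∀

      recurrence₅ : strict-residue e coefficients₅ id ≡ zeros → Recurrence₅ x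
      recurrence₅ p .(suc (suc (suc (suc (suc (suc n))))))
        (s≤s (s≤s (s≤s (s≤s (s≤s (s≤s (ℕ.z≤n {n}))))))) =
        conclude (+ x (1 ℕ.+ n)) (+ x (2 ℕ.+ n)) (+ x (3 ℕ.+ n)) (+ x (4 ℕ.+ n)) (+ x (5 ℕ.+ n)) (+ x (6 ℕ.+ n))
          (vanish coefficients₅ p n)
        where
        open Int using (_+_; _-_; _*_; -_)
        conclude : ∀ a b c d e f → (- + 1 * a + (+ 12 * b + (- + 37 * c + (+ 37 * d + (- + 12 * e + (+ 1 * f + + 0)))))) ≡ + 0 →
          f ≡ + 12 * e - + 37 * d + + 37 * c - + 12 * b + a
        conclude a b c d e f q = trans (lemma a b c d e f) (trans (cong (λ z → (+ 12 * e - + 37 * d + + 37 * c - + 12 * b + a) + z) q) (ℤₚ.+-identityʳ _))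
          where
          lemma : ∀ a b c d e f → f ≡ (+ 12 * e - + 37 * d + + 37 * c - + 12 * b + a) + (- + 1 * a + (+ 12 * b + (- + 37 * c + (+ 37 * d + (- + 12 * e + (+ 1 * f + + 0))))))
          lemma = solve-∀

      recurrence₃ : strict-residue e coefficients₃ id ≡ zeros → Recurrence₃ x
      recurrence₃ p .(suc (suc (suc (suc n)))) (s≤s (s≤s (s≤s (s≤s (ℕ.z≤n {n}))))) =
        conclude (+ x (1 ℕ.+ n)) (+ x (2 ℕ.+ n)) (+ x (3 ℕ.+ n)) (+ x (4 ℕ.+ n))
          (vanish coefficients₃ p n)
        where
        open Int using (_+_; _-_; _*_; -_)
        conclude : ∀ a b c d → (- + 1 * a + (+ 4 * b + (- + 4 * c + (+ 1 * d + + 0)))) ≡ + 0 →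
          d ≡ + 4 * c - + 4 * b + a
        conclude a b c d q = trans (lemma a b c d) (trans (cong (λ z → (+ 4 * c - + 4 * b + a) + z) q) (ℤₚ.+-identityʳ _))
          where
          lemma : ∀ a b c d → d ≡ (+ 4 * c - + 4 * b + a) + (- + 1 * a + (+ 4 * b + (- + 4 * c + (+ 1 * d + + 0))))
          lemma = solve-∀

-- The linear system of the levels, its first values and its recurrences

module ConeNumbers where
  open Mirrors
  open Flags
  open Incidence
  open ConeCounts
  open Recurrences
  open import Data.Integer.Base using (ℤ; +_)
  import Data.Integer.Tactic.RingSolver as ℤ-solver
  open import Data.List.Base using (applyUpTo)
  open import Data.Nat.Base using (_+_; _*_)
  open import Data.Nat.ListAction using (sum)
  import Data.Nat.Tactic.RingSolver as ℕ-solver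
  open import Data.Product.Base using (Σ-syntax)
  open import Data.Vec.Base as Vec using (lookup; replicate)
  import Data.Vec.Properties as Vecₚ
  open import Function.Base using (id)

  kinds : Vec State 10
  kinds = (3 , 1) ∷ (2 , 1) ∷ (2 , 2) ∷ (1 , 1) ∷ (1 , 2) ∷ (1 , 3)
        ∷ (0 , 1) ∷ (0 , 2) ∷ (0 , 3) ∷ (0 , 4) ∷ []

  -- Counting edges yields d times the number of vertices with d incoming edges; the
  -- factor k = 12 / d makes all equations determine 12 times the next level.

  row : ℕ → Vec ℕ 10 → Vec ℤ 10
  row k = Vec.map (λ x → + (k * x))

  rows : Vec (Vec ℤ 10) 10
  rows =
      row 12 (1 ∷ 0 ∷ 0 ∷ 0 ∷ 0 ∷ 0 ∷ 0 ∷ 0 ∷ 0 ∷ 0 ∷ [])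
    ∷ row 12 (0 ∷ 2 ∷ 1 ∷ 0 ∷ 0 ∷ 0 ∷ 0 ∷ 0 ∷ 0 ∷ 0 ∷ [])
    ∷ row  6 (3 ∷ 2 ∷ 2 ∷ 0 ∷ 0 ∷ 0 ∷ 0 ∷ 0 ∷ 0 ∷ 0 ∷ [])
    ∷ row 12 (0 ∷ 0 ∷ 0 ∷ 6 ∷ 4 ∷ 3 ∷ 0 ∷ 0 ∷ 0 ∷ 0 ∷ [])
    ∷ row  6 (0 ∷ 2 ∷ 0 ∷ 5 ∷ 4 ∷ 3 ∷ 0 ∷ 0 ∷ 0 ∷ 0 ∷ [])
    ∷ row  4 (0 ∷ 0 ∷ 2 ∷ 0 ∷ 2 ∷ 3 ∷ 0 ∷ 0 ∷ 0 ∷ 0 ∷ [])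
    ∷ row 12 (0 ∷ 0 ∷ 0 ∷ 0 ∷ 0 ∷ 0 ∷ 107 ∷ 101 ∷ 97 ∷ 94 ∷ [])
    ∷ row  6 (0 ∷ 0 ∷ 0 ∷ 1 ∷ 0 ∷ 0 ∷ 12 ∷ 12 ∷ 12 ∷ 12 ∷ [])
    ∷ row  4 (0 ∷ 0 ∷ 0 ∷ 0 ∷ 1 ∷ 0 ∷ 0 ∷ 5 ∷ 6 ∷ 6 ∷ [])
    ∷ row  3 (0 ∷ 0 ∷ 0 ∷ 0 ∷ 0 ∷ 1 ∷ 0 ∷ 0 ∷ 2 ∷ 4 ∷ [])
    ∷ []

  -- Levels 1 to 9, each in the order of kinds.

  first-sizes : List (Vec ℕ 10)
  first-sizes =
      (4 ∷ 0 ∷ 0 ∷ 0 ∷ 0 ∷ 0 ∷ 0 ∷ 0 ∷ 0 ∷ 0 ∷ [])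
    ∷ (4 ∷ 0 ∷ 6 ∷ 0 ∷ 0 ∷ 0 ∷ 0 ∷ 0 ∷ 0 ∷ 0 ∷ [])
    ∷ (4 ∷ 6 ∷ 12 ∷ 0 ∷ 0 ∷ 4 ∷ 0 ∷ 0 ∷ 0 ∷ 0 ∷ [])
    ∷ (4 ∷ 24 ∷ 24 ∷ 12 ∷ 12 ∷ 12 ∷ 0 ∷ 0 ∷ 0 ∷ 1 ∷ [])
    ∷ (4 ∷ 72 ∷ 54 ∷ 156 ∷ 96 ∷ 36 ∷ 94 ∷ 12 ∷ 6 ∷ 4 ∷ [])
    ∷ (4 ∷ 198 ∷ 132 ∷ 1428 ∷ 708 ∷ 136 ∷ 12228 ∷ 774 ∷ 72 ∷ 16 ∷ [])
    ∷ (4 ∷ 528 ∷ 336 ∷ 11808 ∷ 5388 ∷ 696 ∷ 1395058 ∷ 79254 ∷ 1702 ∷ 86 ∷ [])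
    ∷ (4 ∷ 1392 ∷ 870 ∷ 94488 ∷ 41868 ∷ 4512 ∷ 157449038 ∷ 8862504 ∷ 137462 ∷ 1111 ∷ [])
    ∷ (4 ∷ 3654 ∷ 2268 ∷ 747936 ∷ 328116 ∷ 33004 ∷ 17755598218 ∷ 998747934 ∷ 15061942 ∷ 70970 ∷ [])
    ∷ []

  nth : ℕ → List ℕ → ℕ
  nth _       []       = 0
  nth zero    (x ∷ xs) = x
  nth (suc i) (x ∷ xs) = nth i xs

  column : ℕ → List ℕ
  column j = map (nth j) transitions

  inner : List ℕ → Vec ℕ 10
  inner l = nth 1 l ∷ nth 2 l ∷ nth 3 l ∷ nth 4 l ∷ nth 5 l ∷ nth 6 l ∷ nth 7 l ∷ nth 8 l ∷ nth 9 l ∷ nth 10 l ∷ []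

  column-roots : ∀ j → map (nth j) (map (λ d → map (step-count d) states) states) ≡ column j
  column-roots j = cong (map (nth j)) transitions-roots

  sum-dot : ∀ {n} k (f g : State → ℕ) (ds : Vec State n) →
            + (k * Vec.sum (Vec.map (λ d → f d * g d) ds))
            ≡ dot (Vec.map (λ x → + (k * x)) (Vec.map g ds)) (Vec.map (λ d → + f d) ds)
  sum-dot k f g []       = cong +_ (ℕₚ.*-zeroʳ k)
  sum-dot k f g (d ∷ ds) = begin
    + (k * (f d * g d + s))                      ≡⟨ cong +_ (lemma k (f d) (g d) s) ⟩
    + (k * g d * f d + k * s)                    ≡⟨ ℤₚ.pos-+ (k * g d * f d) (k * s) ⟩
    + (k * g d * f d) Int.+ + (k * s)            ≡⟨ cong₂ Int._+_ (ℤₚ.pos-* (k * g d) (f d)) (sum-dot k f g ds) ⟩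
    + (k * g d) Int.* + f d Int.+ dot (Vec.map (λ x → + (k * x)) (Vec.map g ds)) (Vec.map (λ d → + f d) ds) ∎
    where
    open ≡-Reasoning
    s = Vec.sum (Vec.map (λ d → f d * g d) ds)
    lemma : ∀ k a b s → k * (a * b + s) ≡ k * b * a + k * s
    lemma = ℕ-solver.solve-∀

  ⊙-cancel : ∀ {n} (xs ys : Vec ℕ n) → (+ 12) ⊙ Vec.map +_ xs ≡ (+ 12) ⊙ Vec.map +_ ys → xs ≡ ys
  ⊙-cancel []       []       _ = refl
  ⊙-cancel (x ∷ xs) (y ∷ ys) p = cong₂ _∷_
    (ℤₚ.+-injective (ℤₚ.*-cancelˡ-≡ (+ 12) (+ x) (+ y) (Vecₚ.∷-injectiveˡ p)))
    (⊙-cancel xs ys (Vecₚ.∷-injectiveʳ p))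

  module Numbers (g₀ : Symmetry) (σ₀ : List Gen) (σ₀-flag : Flag σ₀) where
    open Count g₀ σ₀ σ₀-flag public

    sizes : ℕ → Vec ℕ 10
    sizes n = Vec.map (λ c → size c (suc n)) kinds

    y : ℕ → Vec ℤ 10
    y n = Vec.map (λ c → + size c (suc n)) kinds

    opaque

      -- Each vertex of state `c` is counted `proj₂ c` times by its incoming edges, hence 12 times
      -- after multiplication by `k`. The apex term drops out because it occurs on level 0 only.
      size-row : ∀ n c k t → k * proj₂ c ≡ 12 → Vec.map (λ d → step-count d c) kinds ≡ t →
                 + 12 Int.* + size c (suc (suc n)) ≡ dot (row k t) (y n)
      size-row n c k t e refl = begin
        + 12 Int.* + size c (suc (suc n))              ≡⟨ ℤₚ.pos-* 12 (size c (suc (suc n))) ⟨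
        + (12 * size c (suc (suc n)))                  ≡⟨ cong (λ z → + (z * size c (suc (suc n)))) e ⟨
        + (k * proj₂ c * size c (suc (suc n)))
          ≡⟨ cong +_ (trans (ℕₚ.*-assoc k (proj₂ c) _) (cong (k *_) (trans (ℕₚ.*-comm (proj₂ c) _) (size-step (suc n) c)))) ⟩
        + (k * (size (4 , 0) (suc n) * step-count (4 , 0) c + s))
          ≡⟨ cong (λ z → + (k * (z * step-count (4 , 0) c + s))) (size-apex n) ⟩
        + (k * s)                                      ≡⟨ sum-dot k (λ d → size d (suc n)) (λ d → step-count d c) kinds ⟩
        dot (row k (Vec.map (λ d → step-count d c) kinds)) (y n) ∎
        where
        open ≡-Reasoning
        s : ℕ
        s = Vec.sum (Vec.map (λ d → size d (suc n) * step-count d c) kinds)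

      y-step : ∀ n → (+ 12) ⊙ y (suc n) ≡ Vec.map (λ r → dot r (y n)) rows
      y-step n =
        cong₂ _∷_ (size-row n (3 , 1) 12 (inner (column 1)) refl (cong inner (column-roots 1))) (
        cong₂ _∷_ (size-row n (2 , 1) 12 (inner (column 2)) refl (cong inner (column-roots 2))) (
        cong₂ _∷_ (size-row n (2 , 2) 6 (inner (column 3)) refl (cong inner (column-roots 3))) (
        cong₂ _∷_ (size-row n (1 , 1) 12 (inner (column 4)) refl (cong inner (column-roots 4))) (
        cong₂ _∷_ (size-row n (1 , 2) 6 (inner (column 5)) refl (cong inner (column-roots 5))) (
        cong₂ _∷_ (size-row n (1 , 3) 4 (inner (column 6)) refl (cong inner (column-roots 6))) (
        cong₂ _∷_ (size-row n (0 , 1) 12 (inner (column 7)) refl (cong inner (column-roots 7))) (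
        cong₂ _∷_ (size-row n (0 , 2) 6 (inner (column 8)) refl (cong inner (column-roots 8))) (
        cong₂ _∷_ (size-row n (0 , 3) 4 (inner (column 9)) refl (cong inner (column-roots 9))) (
        cong₂ _∷_ (size-row n (0 , 4) 3 (inner (column 10)) refl (cong inner (column-roots 10))) (
        refl))))))))))

      -- Level 0 consists of the apex alone, so the sum reduces to the entry of the apex in the
      -- column of `c`.
      size-first : ∀ c ts → map (λ d → step-count d c) states ≡ ts → size c 1 * proj₂ c ≡ nth 0 ts
      size-first c ts refl = trans (size-step 0 c) (trans (cong (weigh (map (λ d → step-count d c) states)) size-0) (lemma (step-count (4 , 0) c)))
        where
        weigh : List ℕ → List ℕ → ℕ
        weigh (t ∷ ts) (x ∷ xs) = x * t + weigh ts xs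
        weigh _        _        = 0
        lemma : ∀ a → 1 * a + 0 ≡ a
        lemma = ℕ-solver.solve-∀

      sizes-0 : sizes 0 ≡ 4 ∷ replicate 9 0
      sizes-0 =
        cong₂ _∷_ (ℕₚ.*-cancelʳ-≡ (size (3 , 1) 1) 4 1 (size-first (3 , 1) (column 1) (column-roots 1))) (
        cong₂ _∷_ (ℕₚ.*-cancelʳ-≡ (size (2 , 1) 1) 0 1 (size-first (2 , 1) (column 2) (column-roots 2))) (
        cong₂ _∷_ (ℕₚ.*-cancelʳ-≡ (size (2 , 2) 1) 0 2 (size-first (2 , 2) (column 3) (column-roots 3))) (
        cong₂ _∷_ (ℕₚ.*-cancelʳ-≡ (size (1 , 1) 1) 0 1 (size-first (1 , 1) (column 4) (column-roots 4))) (
        cong₂ _∷_ (ℕₚ.*-cancelʳ-≡ (size (1 , 2) 1) 0 2 (size-first (1 , 2) (column 5) (column-roots 5))) (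
        cong₂ _∷_ (ℕₚ.*-cancelʳ-≡ (size (1 , 3) 1) 0 3 (size-first (1 , 3) (column 6) (column-roots 6))) (
        cong₂ _∷_ (ℕₚ.*-cancelʳ-≡ (size (0 , 1) 1) 0 1 (size-first (0 , 1) (column 7) (column-roots 7))) (
        cong₂ _∷_ (ℕₚ.*-cancelʳ-≡ (size (0 , 2) 1) 0 2 (size-first (0 , 2) (column 8) (column-roots 8))) (
        cong₂ _∷_ (ℕₚ.*-cancelʳ-≡ (size (0 , 3) 1) 0 3 (size-first (0 , 3) (column 9) (column-roots 9))) (
        cong₂ _∷_ (ℕₚ.*-cancelʳ-≡ (size (0 , 4) 1) 0 4 (size-first (0 , 4) (column 10) (column-roots 10))) (
        refl))))))))))

    open Linear 12 rows y y-step public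

    opaque

      sizes-next : ∀ n v v′ → sizes n ≡ v →
                   (+ 12) ⊙ Vec.map +_ v′ ≡ Vec.map (λ r → dot r (Vec.map +_ v)) rows → sizes (suc n) ≡ v′
      sizes-next n v v′ p q = ⊙-cancel (sizes (suc n)) v′
        (trans (y-step n) (trans (cong (λ x → Vec.map (λ r → dot r (Vec.map +_ x)) rows) p) (sym q)))

      sizes-first : applyUpTo sizes 9 ≡ first-sizes
      sizes-first =
        let p₀ = sizes-0
            p₁ = sizes-next 0 _ _ p₀ refl
            p₂ = sizes-next 1 _ _ p₁ refl
            p₃ = sizes-next 2 _ _ p₂ refl
            p₄ = sizes-next 3 _ _ p₃ refl
            p₅ = sizes-next 4 _ _ p₄ refl
            p₆ = sizes-next 5 _ _ p₅ refl
            p₇ = sizes-next 6 _ _ p₆ refl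
            p₈ = sizes-next 7 _ _ p₇ refl
        in cong₂ _∷_ p₀ (cong₂ _∷_ p₁ (cong₂ _∷_ p₂ (cong₂ _∷_ p₃ (cong₂ _∷_ p₄ (cong₂ _∷_ p₅ (cong₂ _∷_ p₆
             (cong₂ _∷_ p₇ (cong₂ _∷_ p₈ refl))))))))

    total : ℕ → ℕ
    total n = sum (map (λ c → size c n) states)

    kind-index : VertexType → Fin 10
    kind-index A = 2F
    kind-index B = 1F
    kind-index C = 5F
    kind-index D = 4F
    kind-index E = 3F
    kind-index F = 9F
    kind-index G = 8F
    kind-index H = 7F
    kind-index K = 6F

    opaque

      size-dot : ∀ τ n → + size (kind τ) (suc n) ≡ dot (unit (kind-index τ)) (y n)
      size-dot τ n = sym (trans (dot-unit (kind-index τ) (y n)) (look τ))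
        where
        look : ∀ τ → lookup (y n) (kind-index τ) ≡ + size (kind τ) (suc n)
        look A = refl
        look B = refl
        look C = refl
        look D = refl
        look E = refl
        look F = refl
        look G = refl
        look H = refl
        look K = refl

      total-sum : ∀ n → total (suc n) ≡ Vec.sum (sizes n)
      total-sum n = cong (_+ Vec.sum (sizes n)) (size-apex n)

      total-dot : ∀ n → + total (suc n) ≡ dot (replicate 10 (+ 1)) (y n)
      total-dot n = trans (cong +_ (total-sum n)) (sym (dot-ones (sizes n)))

      -- The polynomial x - 1 annihilates the functional that picks out the ray vertices.
      ray-constant : ∀ n → size (3 , 1) (suc n) ≡ 4
      ray-constant zero    = cong (λ v → lookup v 0F) sizes-0
      ray-constant (suc n) = trans (ℤₚ.+-injective (steady (+ size (3 , 1) (suc n)) (+ size (3 , 1) (suc (suc n)))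
        (trans (shifts-cong (λ k → sym (dot-unit 0F (y k))) (Int.- + 1 ∷ + 1 ∷ []) n)
               (shifts-zero (unit 0F) (Int.- + 1 ∷ + 1 ∷ []) refl n)))) (ray-constant n)
        where
        steady : ∀ a b → Int.- + 1 Int.* a Int.+ (+ 1 Int.* b Int.+ + 0) ≡ + 0 → b ≡ a
        steady a b p = trans (lemma a b) (trans (cong (λ z → a Int.+ z) p) (ℤₚ.+-identityʳ a))
          where
          lemma : ∀ a b → b ≡ a Int.+ (Int.- + 1 Int.* a Int.+ (+ 1 Int.* b Int.+ + 0))
          lemma = ℤ-solver.solve-∀

      total-split : ∀ n → 1 ≤ n → total n ≡ size (kind A) n + size (kind B) n + size (kind C) n
        + size (kind D) n + size (kind E) n + size (kind F) n + size (kind G) n + size (kind H) n + size (kind K) n + 4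
      total-split (suc n) _ = trans (total-sum n) (trans (cong (_+ Vec.sum (Vec.tail (sizes n))) (ray-constant n))
        (lemma (size (kind A) (suc n)) (size (kind B) (suc n)) (size (kind C) (suc n)) (size (kind D) (suc n))
          (size (kind E) (suc n)) (size (kind F) (suc n)) (size (kind G) (suc n)) (size (kind H) (suc n)) (size (kind K) (suc n))))
        where
        lemma : ∀ a b c d e f g h k → 4 + (b + (a + (e + (d + (c + (k + (h + (g + (f + 0)))))))))
                                    ≡ a + b + c + d + e + f + g + h + k + 4
        lemma = ℕ-solver.solve-∀

      size-recurrence₉ : ∀ τ → Recurrence₉ (size (kind τ))
      size-recurrence₉ τ = recurrence₉ (size (kind τ)) (unit (kind-index τ)) (size-dot τ) (residue₉ τ)
        where
        residue₉ : ∀ τ → strict-residue (unit (kind-index τ)) coefficients₉ id ≡ zeros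
        residue₉ A = refl
        residue₉ B = refl
        residue₉ C = refl
        residue₉ D = refl
        residue₉ E = refl
        residue₉ F = refl
        residue₉ G = refl
        residue₉ H = refl
        residue₉ K = refl

      total-recurrence₉ : Recurrence₉ total
      total-recurrence₉ = recurrence₉ total (replicate 10 (+ 1)) total-dot refl

      recurrences₅ : Recurrence₅ (size (kind A)) × Recurrence₅ (size (kind B)) × Recurrence₅ (size (kind C))
                     × Recurrence₅ (size (kind D)) × Recurrence₅ (size (kind E))
      recurrences₅ = proof A refl , proof B refl , proof C refl , proof D refl , proof E refl
        where
        proof : ∀ τ → strict-residue (unit (kind-index τ)) coefficients₅ id ≡ zeros → Recurrence₅ (size (kind τ))
        proof τ = recurrence₅ (size (kind τ)) (unit (kind-index τ)) (size-dot τ)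

      recurrences₃ : Recurrence₃ (size (kind A)) × Recurrence₃ (size (kind B))
      recurrences₃ = proof A refl , proof B refl
        where
        proof : ∀ τ → strict-residue (unit (kind-index τ)) coefficients₃ id ≡ zeros → Recurrence₃ (size (kind τ))
        proof τ = recurrence₃ (size (kind τ)) (unit (kind-index τ)) (size-dot τ)

      first-values : ∀ i → applyUpTo (λ n → lookup (sizes n) i) 9 ≡ map (λ v → lookup v i) first-sizes
      first-values i = cong (map (λ v → lookup v i)) sizes-first

      first-totals : applyUpTo (λ n → total (suc n)) 9 ≡ map Vec.sum first-sizes
      first-totals = trans (totals 9 id) (cong (map Vec.sum) sizes-first)
        where
        totals : ∀ m (f : ℕ → ℕ) → applyUpTo (λ n → total (suc (f n))) m ≡ applyUpTo (λ n → Vec.sum (sizes (f n))) m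
        totals zero    f = refl
        totals (suc m) f = cong₂ _∷_ (total-sum (f 0)) (totals m (f ∘ suc))

      count-total : ∀ n → HasCount (OnLevel n) (total n)
      count-total n = subst (HasCount (OnLevel n)) (level-size n) (count-level n)

open import Data.List.Base using (applyUpTo)
open import Data.Nat.Base using (_+_)
open import Data.Product.Base using (Σ-syntax)
open Incidence using (module Mosaic)
open ConeCounts using (kind)
open ConeNumbers using (module Numbers)

theorem2 : ∀ (V₀ C₀ : Point) → Incident 0F 4F V₀ C₀ →
    Σ[ N ∈ (VertexType → ℕ → ℕ) ] Σ[ s ∈ (ℕ → ℕ) ]
    (∀ τ n → HasCount (λ v → Simplex.OnLevel V₀ C₀ n v × Simplex.HasType V₀ C₀ τ v) (N τ n)) ×
    (∀ n → HasCount (Simplex.OnLevel V₀ C₀ n) (s n)) ×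
    (∀ n → 1 ≤ n → s n ≡ N A n + N B n + N C n + N D n + N E n + N F n + N G n + N H n + N K n + 4) ×
    (∀ τ → Recurrence₉ (N τ)) × Recurrence₉ s ×
    applyUpTo (λ i → N A (suc i)) 9 ≡ 0 ∷ 6 ∷ 12 ∷ 24 ∷ 54 ∷ 132 ∷ 336 ∷ 870 ∷ 2268 ∷ [] ×
    applyUpTo (λ i → N B (suc i)) 9 ≡ 0 ∷ 0 ∷ 6 ∷ 24 ∷ 72 ∷ 198 ∷ 528 ∷ 1392 ∷ 3654 ∷ [] ×
    applyUpTo (λ i → N C (suc i)) 9 ≡ 0 ∷ 0 ∷ 4 ∷ 12 ∷ 36 ∷ 136 ∷ 696 ∷ 4512 ∷ 33004 ∷ [] ×
    applyUpTo (λ i → N D (suc i)) 9 ≡ 0 ∷ 0 ∷ 0 ∷ 12 ∷ 96 ∷ 708 ∷ 5388 ∷ 41868 ∷ 328116 ∷ [] ×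
    applyUpTo (λ i → N E (suc i)) 9 ≡ 0 ∷ 0 ∷ 0 ∷ 12 ∷ 156 ∷ 1428 ∷ 11808 ∷ 94488 ∷ 747936 ∷ [] ×
    applyUpTo (λ i → N F (suc i)) 9 ≡ 0 ∷ 0 ∷ 0 ∷ 1 ∷ 4 ∷ 16 ∷ 86 ∷ 1111 ∷ 70970 ∷ [] ×
    applyUpTo (λ i → N G (suc i)) 9 ≡ 0 ∷ 0 ∷ 0 ∷ 0 ∷ 6 ∷ 72 ∷ 1702 ∷ 137462 ∷ 15061942 ∷ [] ×
    applyUpTo (λ i → N H (suc i)) 9 ≡ 0 ∷ 0 ∷ 0 ∷ 0 ∷ 12 ∷ 774 ∷ 79254 ∷ 8862504 ∷ 998747934 ∷ [] ×
    applyUpTo (λ i → N K (suc i)) 9 ≡ 0 ∷ 0 ∷ 0 ∷ 0 ∷ 94 ∷ 12228 ∷ 1395058 ∷ 157449038 ∷ 17755598218 ∷ [] ×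
    applyUpTo (λ i → s (suc i)) 9 ≡ 4 ∷ 10 ∷ 26 ∷ 89 ∷ 534 ∷ 15696 ∷ 1494860 ∷ 166593249 ∷ 18770594046 ∷ [] ×
    (Recurrence₅ (N A) × Recurrence₅ (N B) × Recurrence₅ (N C) × Recurrence₅ (N D) × Recurrence₅ (N E)) ×
    (Recurrence₃ (N A) × Recurrence₃ (N B))
theorem2 V₀ C₀ (g₀ , p , q) = (λ τ → size (kind τ)) , total
  , (λ τ n → subst₂ (λ v c → HasCount (λ x → Simplex.OnLevel v c n x × Simplex.HasType v c τ x) (size (kind τ) n)) V≡ C≡ (count-type τ n))
  , (λ n → subst₂ (λ v c → HasCount (Simplex.OnLevel v c n) (total n)) V≡ C≡ (count-total n))
  , total-split , size-recurrence₉ , total-recurrence₉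
  , first-values 2F , first-values 1F , first-values 5F , first-values 4F , first-values 3F
  , first-values 9F , first-values 8F , first-values 7F , first-values 6F , first-totals
  , recurrences₅ , recurrences₃
  where
  base = Mosaic.base-flag g₀
  open Numbers g₀ (proj₁ base) (proj₁ (proj₂ base)) 
    using (size; total; count-type; count-total; total-split; size-recurrence₉; total-recurrence₉;
           first-values; first-totals; recurrences₅; recurrences₃)
  -- The cone was built with its apex and first hypercube written as faces at the empty word; these
  -- equations carry the counts over to the given points.
  V≡ : Mosaic.face g₀ [] [] ≡ V₀
  V≡ = trans (proj₁ (proj₂ (proj₂ base))) p
  C≡ : Mosaic.face g₀ [] (proj₁ base) ≡ C₀
  C≡ = trans (proj₂ (proj₂ (proj₂ base))) q
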